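{- Let $p\equiv3\pmod 4$ be a prime, $R\ge 2$ an even integer, and $h$ an odd positive integer with $2h\mid(p-1)$. Then $\mathrm{GPaley}(p^R,\frac{p^R-1}{2h})\not\cong\mathrm{TGPaley}(p^R,\frac{p^R-1}{2h})$, except in the case $(R,p,h)=(2,3,1)$, where $\mathrm{GPaley}(3^2,4)\cong\mathrm{TGPaley}(3^2,4)$.
   Context: Let $V=\mathbb{F}_{p^R}$ with a primitive element $\omega$; $\mathrm{Cay}(V,S)$ has vertex set $V$ and edges $\{u,v\}$ with $v-u\in S$. For $k\mid p^R-1$ (with $\frac{p^R-1}{k}$ even when $p$ is odd), $\mathrm{GPaley}(p^R,\frac{p^R-1}{k})=\mathrm{Cay}(V,\{\omega^{jk}:j\ge0\})$. For $R$ even, $p\equiv3\pmod4$ and $h$ odd with $2h\mid p-1$, with $S_0=\{\omega^{4hj}:j\ge0\}$, the twisted generalised Paley graph is $\mathrm{TGPaley}(p^R,\frac{p^R-1}{2h})=\mathrm{Cay}(V,S_0\cup\omega^{3h}S_0)$. -}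

module Defs where

open import Level using (0ℓ)
open import Data.Nat using (ℕ; zero; suc) renaming (_*_ to _*ℕ_)
open import Data.Fin using (Fin)
open import Data.Product using (Σ; ∃; _×_; _,_)
open import Data.Sum using (_⊎_)
open import Relation.Binary.PropositionalEquality using (_≡_; _≢_)
open import Relation.Nullary using (¬_)
open import Algebra.Structures using (IsCommutativeRing)
open import Function.Bundles using (_↔_; Inverse)

record FiniteField (q : ℕ) : Set₁ where
  field
    Carrier : Set
    _+_ _*_ : Carrier → Carrier → Carrier
    -_ : Carrier → Carrier
    0# 1# : Carrier
    isCommutativeRing : IsCommutativeRing _≡_ _+_ _*_ -_ 0# 1#
    0≢1 : 0# ≢ 1#
    inverse : ∀ x → x ≢ 0# → Σ Carrier (λ y → x * y ≡ 1#)
    enum : Carrier ↔ Fin q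

  infixl 6 _+_ _-_
  infixl 7 _*_

  _-_ : Carrier → Carrier → Carrier
  x - y = x + (- y)

  _^_ : Carrier → ℕ → Carrier
  x ^ zero = 1#
  x ^ suc n = x * (x ^ n)

  IsPrimitive : Carrier → Set
  IsPrimitive ω = ∀ x → x ≢ 0# → ∃ λ j → ω ^ j ≡ x

  CayAdj : (Carrier → Set) → Carrier → Carrier → Set
  CayAdj S u v = (S (v - u)) ⊎ (S (u - v))

  -- Connection set of GPaley(q, (q-1)/k) = {ω^(j k) : j ≥ 0}
  GPaleySet : Carrier → ℕ → Carrier → Set
  GPaleySet ω k x = ∃ λ j → ω ^ (j *ℕ k) ≡ x

  -- Connection set of TGPaley(q, (q-1)/(2h)) = S₀ ∪ ω^(3h) S₀,
  -- where S₀ = {ω^(4hj) : j ≥ 0}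
  TGPaleySet : Carrier → ℕ → Carrier → Set
  TGPaleySet ω h x =
    (∃ λ j → ω ^ (j *ℕ (4 *ℕ h)) ≡ x) ⊎ (∃ λ j → (ω ^ (3 *ℕ h)) * (ω ^ (j *ℕ (4 *ℕ h))) ≡ x)

  GPaleyAdj : Carrier → ℕ → Carrier → Carrier → Set
  GPaleyAdj ω k = CayAdj (GPaleySet ω k)

  TGPaleyAdj : Carrier → ℕ → Carrier → Carrier → Set
  TGPaleyAdj ω h = CayAdj (TGPaleySet ω h)

record GraphIso {V : Set} (A B : V → V → Set) : Set where
  field
    bij : V ↔ V
  open Inverse bij public using (to)
  field
    preserves : ∀ u v → A u v → B (to u) (to v)
    reflects  : ∀ u v → B (to u) (to v) → A u v

{-# OPTIONS --safe #-}
module Submission where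

-- Write q = p^R = κ + 1, κ = 4hm, p = 1 + 2hd, p + 1 = 4u. The moments Σ φ(x) x^a (0 ≤ a ≤ κ) of a function φ on
-- the field are, up to units and reversal, its polynomial coefficients, and convolution with the adjacency function G of
-- a Cayley graph acts on them with binomial weights that Lucas' theorem controls. Up to an additive constant,
-- a multiple of δ₀ and a scalar, G is a combination of the powers z^(2mi) for GPaley, and of the powers z^(mi)
-- with i ≢ 2 mod 4 for TGPaley.
--
-- For h ≥ 3, each convolution with the TGPaley function consumes at least 4d of the two lowest base p digits, so h + 1
-- convolutions vanish, whereas the first 2h convolutions with the GPaley function do not.
--
-- For h = 1, let f be an isomorphism with f 0 = 0. Comparing T(f^j) with (T′Y^j) ∘ f for suitable j shows that f^k is a
-- polynomial all of whose exponents have base p digits ≤ (p − 1)/2, for enough values of k. As deg f^k = k deg f as long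
-- as no reduction modulo x^q − x occurs, this is impossible if R ≥ 4. If R = 2 and p > 3, it forces f to be
-- c x or c x^p (apply it to f, f^p and f^((p−1)/2) f^p), and such a map does not carry a coset of the
-- squares to the TGPaley connection set.

open import Defs
open import Algebra.Bundles using (CommutativeRing)
open import Data.Empty using (⊥)
open import Data.Fin as Fin using (Fin; toℕ)
open import Data.Fin.Properties as Fin using ()
open import Data.Nat as ℕ using (ℕ; zero; suc)
open import Data.Nat.Coprimality using (prime⇒coprime; coprime-Bézout)
open import Data.Nat.Divisibility using (_∣_; _∤_; _∣?_; divides; ∣⇒≤; ∣-refl; m∣m*n; ∣m+n∣m⇒∣n; *-cancelʳ-∣; m%n≡0⇒n∣m)
open import Data.Nat.DivMod using (m≡m%n+[m/n]*n; m%n<n; m/n≤m; m/n<m; m/n*n≤m; m<n⇒m/n≡0; m<n⇒m%n≡m; [m+kn]%n≡m%n)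
open import Data.Nat.GCD using (module Bézout)
open import Data.Nat.Primality using (Prime; prime⇒nonZero)
open import Data.Nat.Properties as ℕ using ()
open import Data.Nat.Tactic.RingSolver using (solve-∀)
open import Data.Product using (∃; ∃₂; _×_; _,_; proj₁; proj₂)
open import Data.Sum using (_⊎_; inj₁; inj₂; [_,_]′)
open import Function.Base using (_∘_)
open import Function.Bundles using (_↔_; Inverse; mk↔ₛ′)
open import Function.Construct.Composition using (_↔-∘_)
open import Function.Construct.Symmetry using (↔-sym)
open import Relation.Binary.PropositionalEquality
open import Relation.Nullary using (¬_; Dec; yes; no; contradiction)
open import Relation.Nullary.Decidable using (_⊎-dec_)
open ≡-Reasoning

-- The split at h = 3 comes from counting digits. The odd multiples i m with i < 4h have weight at
-- least d + hd, with equality for m itself, and this reaches 4d only if h ≥ 3. For h = 1 the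
-- moments m and 3m of the TGPaley function weigh 2d, exactly like the moment 2m of the GPaley
-- function, so that iterated convolution shows no contrast. Powers of f are used for h = 1 because
-- a digit bound on the degree D alone says little, whereas every nonzero digit r < p has a multiple
-- k r between d + 1 and 2d = p - 1, which violates the bound for k D. The digit 1 needs k = d + 1,
-- and for R = 2 the argument gives no exponent k < p beyond d; this is why f^p and the Frobenius
-- map have to come in. The exponent d + p used there has second digit 1, which must not exceed u₁ =
-- (p - 3)/4. For p = 3 it does, and the maps α x + β x³ are not excluded: one of them is the
-- exceptional isomorphism.

module Arithmetic where

  open import Data.Nat
  open import Data.Nat.Properties

  -- Parity, repunits and base p digits

  even⊎odd : ∀ j → ∃ λ b → j ≡ b * 2 ⊎ j ≡ suc (b * 2)
  even⊎odd zero = 0 , inj₁ refl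
  even⊎odd (suc j) with even⊎odd j
  ... | b , inj₁ e = b , inj₂ (cong suc e)
  ... | b , inj₂ e = suc b , inj₁ (cong suc e)

  odd≢even : ∀ a b → suc (a * 2) ≢ b * 2
  odd≢even (suc a) (suc b) e = odd≢even a b (suc-injective (suc-injective e))

  repunit : ℕ → ℕ → ℕ
  repunit b zero = 0
  repunit b (suc n) = 1 + repunit b n * b

  repunit-^ : ∀ b n → suc (b * repunit (suc b) n) ≡ suc b ^ n
  repunit-^ b zero = cong suc (*-zeroʳ b)
  repunit-^ b (suc n) = begin
    suc (b * (1 + r * suc b))      ≡⟨ arith b r ⟩
    suc b * suc (b * r)            ≡⟨ cong (suc b *_) (repunit-^ b n) ⟩
    suc b * suc b ^ n ∎
    where
    r = repunit (suc b) n
    arith : ∀ b r → suc (b * (1 + r * suc b)) ≡ suc b * suc (b * r)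
    arith = solve-∀

  module Digits (p : ℕ) .⦃ _ : NonZero p ⦄ where

    -- Two digits suffice because m is p² - 1 divided by 4h, times a repunit in base p²: its base p
    -- digits have period two.
    weight : ℕ → ℕ
    weight a = a % p + (a / p) % p

    weight-≤ : ∀ a → suc (weight a) ≤ p + p
    weight-≤ a = +-mono-<-≤ (m%n<n a p) (<⇒≤ (m%n<n (a / p) p))

    %-digit : ∀ {r} A → r < p → (r + A * p) % p ≡ r
    %-digit {r} A r<p = trans ([m+kn]%n≡m%n r A p) (m<n⇒m%n≡m r<p)

    /-digit : ∀ {r} A → r < p → (r + A * p) / p ≡ A
    /-digit {r} A r<p = *-cancelʳ-≡ _ _ p (+-cancelˡ-≡ r _ _ (begin
      r + (r + A * p) / p * p                      ≡⟨ cong (_+ (r + A * p) / p * p) (%-digit A r<p) ⟨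
      (r + A * p) % p + (r + A * p) / p * p        ≡⟨ m≡m%n+[m/n]*n (r + A * p) p ⟨
      r + A * p ∎))

    weight-digits : ∀ {r s} A → r < p → s < p → weight (r + (s + A * p) * p) ≡ r + s
    weight-digits {r} {s} A r<p s<p = cong₂ _+_ (%-digit (s + A * p) r<p)
      (trans (cong (_% p) (/-digit (s + A * p) r<p)) (%-digit A s<p))

    ∸-digits : ∀ {r s A K} → s ≤ r → K ≤ A → (r + A * p) ∸ (s + K * p) ≡ (r ∸ s) + (A ∸ K) * p
    ∸-digits {r} {s} {A} {K} s≤r K≤A = trans (cong (_∸ (s + K * p)) (begin
        r + A * p                                         ≡⟨ cong₂ (λ x y → x + y * p) (m∸n+n≡m s≤r) (m∸n+n≡m K≤A) ⟨
        (r ∸ s + s) + (A ∸ K + K) * p                     ≡⟨ arith (r ∸ s) s (A ∸ K) K p ⟩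
        (r ∸ s) + (A ∸ K) * p + (s + K * p) ∎))
      (m+n∸n≡m _ (s + K * p))
      where
      arith : ∀ a s b k p → (a + s) + (b + k) * p ≡ a + b * p + (s + k * p)
      arith = solve-∀

    -- The hypotheses say that subtracting k from a borrows at neither of the two lowest digits.
    weight-∸ : ∀ {a k} → k % p ≤ a % p → k / p ≤ a / p → (k / p) % p ≤ (a / p) % p → (k / p) / p ≤ (a / p) / p →
      weight a ≡ weight k + weight (a ∸ k)
    weight-∸ {a} {k} l₀ l l₁ l₂ = begin
      r + s
        ≡⟨ cong₂ _+_ (m+[n∸m]≡n l₀) (m+[n∸m]≡n l₁) ⟨
      (r′ + (r ∸ r′)) + (s′ + (s ∸ s′))
        ≡⟨ arith r′ (r ∸ r′) s′ (s ∸ s′) ⟩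
      (r′ + s′) + ((r ∸ r′) + (s ∸ s′))
        ≡⟨ cong (r′ + s′ +_) (weight-digits ((a / p) / p ∸ (k / p) / p) (≤-<-trans (m∸n≤m r r′) (m%n<n a p)) (≤-<-trans (m∸n≤m s s′) (m%n<n (a / p) p))) ⟨
      (r′ + s′) + weight ((r ∸ r′) + ((s ∸ s′) + ((a / p) / p ∸ (k / p) / p) * p) * p)
        ≡⟨ cong (λ x → r′ + s′ + weight ((r ∸ r′) + x * p)) (trans (cong₂ _∸_ (m≡m%n+[m/n]*n (a / p) p) (m≡m%n+[m/n]*n (k / p) p)) (∸-digits l₁ l₂)) ⟨
      (r′ + s′) + weight ((r ∸ r′) + (a / p ∸ k / p) * p)
        ≡⟨ cong (λ x → r′ + s′ + weight x) (trans (cong₂ _∸_ (m≡m%n+[m/n]*n a p) (m≡m%n+[m/n]*n k p)) (∸-digits l₀ l)) ⟨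
      weight k + weight (a ∸ k) ∎
      where
      r = a % p
      r′ = k % p
      s = (a / p) % p
      s′ = (k / p) % p
      arith : ∀ a b c d → (a + b) + (c + d) ≡ (a + c) + (b + d)
      arith = solve-∀

  -- The parameters of the graphs and the digits of multiples of m

  module Parameters (h d u p : ℕ) .⦃ _ : NonZero p ⦄ (p≡ : p ≡ suc (2 * (h * d))) (1+p≡ : suc p ≡ 4 * u) where
    open Digits p

    1+hd≡2u : suc (h * d) ≡ u * 2
    1+hd≡2u = *-cancelˡ-≡ _ _ 2 (begin
      2 * suc (h * d)            ≡⟨ arith (h * d) ⟩
      suc (suc (2 * (h * d)))    ≡⟨ cong suc p≡ ⟨
      suc p                      ≡⟨ 1+p≡ ⟩
      4 * u                      ≡⟨ arith′ u ⟩
      2 * (u * 2) ∎)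
      where
      arith : ∀ x → 2 * suc x ≡ suc (suc (2 * x))
      arith = solve-∀
      arith′ : ∀ u → 4 * u ≡ 2 * (u * 2)
      arith′ = solve-∀

    -- Since p ≡ 3 mod 4, the number h d = (p - 1)/2 is odd, and so is its factor d.
    d-odd : ∃ λ c → d ≡ suc (c * 2)
    d-odd with even⊎odd d
    ... | c , inj₂ e = c , e
    ... | c , inj₁ refl = contradiction (trans (cong suc (*-assoc h c 2)) 1+hd≡2u) (odd≢even (h * c) u)

    -- M = (p² − 1)/(4h)
    M : ℕ
    M = 2 * (u * d)

    1+4hM≡p² : suc (4 * h * M) ≡ p * p
    1+4hM≡p² = begin
      suc (4 * h * (2 * (u * d)))              ≡⟨ arith h u d ⟩
      suc (2 * (h * d) * (4 * u))              ≡⟨ cong (λ x → suc (2 * (h * d) * x)) 1+p≡ ⟨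
      suc (2 * (h * d) * suc p)                ≡⟨ cong (λ x → suc (x * suc p)) (cong pred p≡) ⟨
      suc (pred p * suc p)                     ≡⟨ square p ⟩
      p * p ∎
      where
      arith : ∀ h u d → suc (4 * h * (2 * (u * d))) ≡ suc (2 * (h * d) * (4 * u))
      arith = solve-∀
      square : ∀ p .⦃ _ : NonZero p ⦄ → suc (pred p * suc p) ≡ p * p
      square (suc p) = lem p
        where
        lem : ∀ p → suc (p * suc (suc p)) ≡ suc p * suc p
        lem = solve-∀

    κ≡ : ∀ n → suc (4 * h * (M * repunit (p * p) n)) ≡ p ^ (n * 2)
    κ≡ n = begin
      suc (4 * h * (M * repunit (p * p) n))         ≡⟨ cong suc (*-assoc (4 * h) M _) ⟨
      suc (4 * h * M * repunit (p * p) n)           ≡⟨ cong (λ b → suc (4 * h * M * repunit b n)) 1+4hM≡p² ⟨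
      suc (4 * h * M * repunit (suc (4 * h * M)) n) ≡⟨ repunit-^ (4 * h * M) n ⟩
      suc (4 * h * M) ^ n                           ≡⟨ cong (_^ n) (trans 1+4hM≡p² (cong (p *_) (sym (*-identityʳ p)))) ⟩
      (p ^ 2) ^ n                                   ≡⟨ ^-*-assoc p 2 n ⟩
      p ^ (2 * n)                                   ≡⟨ cong (p ^_) (*-comm 2 n) ⟩
      p ^ (n * 2) ∎

    2M≡ : 2 * M ≡ d * suc p
    2M≡ = trans (arith u d) (cong (d *_) (sym 1+p≡))
      where
      arith : ∀ u d → 2 * (2 * (u * d)) ≡ d * (4 * u)
      arith = solve-∀

    -- The number 2M = d (p + 1) has both digits equal to d, so all base p digits of 2m are d.
    2m≡d*repunit : ∀ n → 2 * (M * repunit (p * p) n) ≡ d * repunit p (n * 2)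
    2m≡d*repunit zero = trans (cong (2 *_) (*-zeroʳ M)) (sym (*-zeroʳ d))
    2m≡d*repunit (suc n) = begin
      2 * (M * (1 + ρ * (p * p)))                 ≡⟨ arith M ρ p ⟩
      2 * M + 2 * (M * ρ) * (p * p)               ≡⟨ cong₂ (λ x y → x + y * (p * p)) 2M≡ (2m≡d*repunit n) ⟩
      d * suc p + d * σ * (p * p)                 ≡⟨ arith′ d σ p ⟩
      d * (1 + (1 + σ * p) * p) ∎
      where
      ρ = repunit (p * p) n
      σ = repunit p (n * 2)
      arith : ∀ M ρ p → 2 * (M * (1 + ρ * (p * p))) ≡ 2 * M + 2 * (M * ρ) * (p * p)
      arith = solve-∀
      arith′ : ∀ d σ p → d * suc p + d * σ * (p * p) ≡ d * (1 + (1 + σ * p) * p)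
      arith′ = solve-∀

    -- The repunit is 1 modulo p², so that the two lowest digits of i m can be read off i M.
    multiple-digits : ∀ i r s n → i * M ≡ r + s * p →
      i * (M * repunit (p * p) (suc n)) ≡ r + (s + i * M * repunit (p * p) n * p) * p
    multiple-digits i r s n e = begin
      i * (M * (1 + ρ * (p * p)))                    ≡⟨ arith i M ρ p ⟩
      i * M + i * M * ρ * p * p                      ≡⟨ cong (_+ i * M * ρ * p * p) e ⟩
      r + s * p + i * M * ρ * p * p                  ≡⟨ arith′ r s (i * M * ρ * p) p ⟩
      r + (s + i * M * ρ * p) * p ∎
      where
      ρ = repunit (p * p) n
      arith : ∀ i M ρ p → i * (M * (1 + ρ * (p * p))) ≡ i * M + i * M * ρ * p * p
      arith = solve-∀
      arith′ : ∀ r s x p → r + s * p + x * p ≡ r + (s + x) * p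
      arith′ = solve-∀

    module _ (3≤h : 3 ≤ h) where

      private
        -- This is where h ≥ 3 enters: d + hd is the weight of the lightest odd multiple.
        bound : 4 * d ≤ d + h * d
        bound = *-monoˡ-≤ d (s≤s 3≤h)

      -- As 4cM = 2cd · 4u = 2cd (p + 1) and 2cd < p for c < h, both digits equal 2cd.
      weight-multiple-even : ∀ c n → 0 < c → c * 4 < 4 * h → 4 * d ≤ weight (c * 4 * (M * repunit (p * p) (suc n)))
      weight-multiple-even c n 0<c c4<4h = subst (4 * d ≤_) (sym (trans (cong weight (multiple-digits (c * 4) r r n digits)) (weight-digits (c * 4 * M * repunit (p * p) n) r<p r<p)))
        (subst (4 * d ≤_) (arith″ c d) (*-monoˡ-≤ d (*-monoʳ-≤ 4 0<c)))
        where
        r = 2 * (c * d)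
        c<h : c < h
        c<h = *-cancelˡ-< 4 c h (subst (_< 4 * h) (*-comm c 4) c4<4h)
        r<p : r < p
        r<p = subst (r <_) (sym p≡) (s≤s (*-monoʳ-≤ 2 (*-monoˡ-≤ d (<⇒≤ c<h))))
        arith : ∀ c u d → c * 4 * (2 * (u * d)) ≡ 2 * (c * d) * (4 * u)
        arith = solve-∀
        arith′ : ∀ r p → r * suc p ≡ r + r * p
        arith′ = solve-∀
        arith″ : ∀ c d → 4 * c * d ≡ 2 * (c * d) + 2 * (c * d)
        arith″ = solve-∀
        digits : c * 4 * M ≡ r + r * p
        digits = trans (arith c u d) (trans (cong (r *_) (sym 1+p≡)) (arith′ r p))

      -- The product of i with 2ud has digits (y − 1)/2 and (p + y)/2, where y = i d, with a carry when y > p − 2.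
      weight-multiple-odd : ∀ c n → suc (c * 2) < 4 * h → 4 * d ≤ weight (suc (c * 2) * (M * repunit (p * p) (suc n)))
      weight-multiple-odd c n i<4h with d-odd
      ... | c₁ , d≡ = cases (suc b <? u * 2)
        where
        i = suc (c * 2)
        b = c * 2 * c₁ + c + c₁
        y≡ : i * d ≡ suc (b * 2)
        y≡ = trans (cong (i *_) d≡) (arith c c₁)
          where
          arith : ∀ c c₁ → suc (c * 2) * suc (c₁ * 2) ≡ suc ((c * 2 * c₁ + c + c₁) * 2)
          arith = solve-∀
        iM≡ : i * M ≡ u * 2 + b * suc p
        iM≡ = begin
          i * (2 * (u * d))              ≡⟨ arith i u d ⟩
          i * d * (u * 2)                ≡⟨ cong (_* (u * 2)) y≡ ⟩
          suc (b * 2) * (u * 2)          ≡⟨ arith′ b u ⟩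
          u * 2 + b * (4 * u)            ≡⟨ cong (λ x → u * 2 + b * x) 1+p≡ ⟨
          u * 2 + b * suc p ∎
          where
          arith : ∀ i u d → i * (2 * (u * d)) ≡ i * d * (u * 2)
          arith = solve-∀
          arith′ : ∀ b u → suc (b * 2) * (u * 2) ≡ u * 2 + b * (4 * u)
          arith′ = solve-∀
        p≡4u : suc p ≡ u * 2 + u * 2
        p≡4u = trans 1+p≡ (arith u)
          where
          arith : ∀ u → 4 * u ≡ u * 2 + u * 2
          arith = solve-∀
        cases : _ → 4 * d ≤ weight (i * (M * repunit (p * p) (suc n)))
        -- Without a carry the digits are b + 2u and b, of sum 2b + 2u = i d + h d.
        cases (yes 1+b<2u) = subst (4 * d ≤_)
          (sym (trans (cong weight (multiple-digits i (b + u * 2) b n (trans iM≡ (arith u b p)))) (weight-digits (i * M * repunit (p * p) n) r<p s<p)))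
          (≤-trans bound (≤-trans (+-monoˡ-≤ (h * d) d≤) (≤-reflexive (trans (sym (+-suc (b * 2) (h * d))) (trans (cong (b * 2 +_) 1+hd≡2u) (arith′ b u))))))
          where
          arith : ∀ u b p → u * 2 + b * suc p ≡ b + u * 2 + b * p
          arith = solve-∀
          arith′ : ∀ b u → b * 2 + u * 2 ≡ b + u * 2 + b
          arith′ = solve-∀
          d≤ : d ≤ suc (b * 2)
          d≤ = subst (d ≤_) y≡ (m≤m+n d (c * 2 * d))
          r<p : b + u * 2 < p
          r<p = s≤s⁻¹ (subst (suc (b + u * 2) <_) (sym p≡4u) (+-monoˡ-< (u * 2) 1+b<2u))
          s<p : b < p
          s<p = ≤-<-trans (m≤m+n b (u * 2)) r<p
        -- Moving p = 4u - 1 from the low digit b + 2u to the next one leaves r = b + 1 - 2u and s =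
        -- b + 1. The weight is now (2r + 1) + h d, where 2r + 1 = (i - 2h) d is a positive multiple
        -- of d.
        cases (no 1+b≮2u) = subst (4 * d ≤_)
          (sym (trans (cong weight (multiple-digits i r s n digits)) (weight-digits (i * M * repunit (p * p) n) r<p s<p)))
          (≤-trans bound (≤-trans (+-monoˡ-≤ (h * d) d≤) (≤-reflexive (trans (sym (+-suc (r * 2) (h * d))) (trans (cong (r * 2 +_) 1+hd≡2u) (arith′ r u))))))
          where
          r = suc b ∸ u * 2
          s = u * 2 + r
          1+b≡ : suc b ≡ s
          1+b≡ = sym (m+[n∸m]≡n (≮⇒≥ 1+b≮2u))
          arith′ : ∀ r u → r * 2 + u * 2 ≡ r + (u * 2 + r)
          arith′ = solve-∀
          digits : i * M ≡ r + s * p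
          digits = +-cancelʳ-≡ (suc p) _ _ (begin
            i * M + suc p                      ≡⟨ cong (_+ suc p) iM≡ ⟩
            u * 2 + b * suc p + suc p          ≡⟨ arith u b p ⟩
            u * 2 + suc b + suc b * p          ≡⟨ cong (λ x → u * 2 + x + x * p) 1+b≡ ⟩
            u * 2 + s + s * p                  ≡⟨ arith″ u r (s * p) ⟩
            r + s * p + (u * 2 + u * 2)        ≡⟨ cong (r + s * p +_) p≡4u ⟨
            r + s * p + suc p ∎)
            where
            arith : ∀ u b p → u * 2 + b * suc p + suc p ≡ u * 2 + suc b + suc b * p
            arith = solve-∀
            arith″ : ∀ u r x → u * 2 + (u * 2 + r) + x ≡ r + x + (u * 2 + u * 2)
            arith″ = solve-∀
          -- i d is odd and at least p = 2hd + 1, hence i ≥ 2h + 1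
          y≡p+2r : i * d ≡ p + r * 2
          y≡p+2r = suc-injective (begin
            suc (i * d)                 ≡⟨ cong suc y≡ ⟩
            suc b * 2                   ≡⟨ cong (_* 2) 1+b≡ ⟩
            (u * 2 + r) * 2             ≡⟨ arith u r ⟩
            u * 2 + u * 2 + r * 2       ≡⟨ cong (_+ r * 2) p≡4u ⟨
            suc p + r * 2 ∎)
            where
            arith : ∀ u r → (u * 2 + r) * 2 ≡ u * 2 + u * 2 + r * 2
            arith = solve-∀
          2h<i : 2 * h < i
          2h<i = *-cancelʳ-< d (2 * h) i (subst (2 * h * d <_) (sym y≡p+2r)
            (<-≤-trans (subst (2 * h * d <_) (sym p≡) (s≤s (≤-reflexive (*-assoc 2 h d)))) (m≤m+n p (r * 2))))
          d≤ : d ≤ suc (r * 2)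
          d≤ = +-cancelʳ-≤ (2 * h * d) d _ (subst₂ _≤_ refl
            (trans y≡p+2r (trans (cong (_+ r * 2) p≡) (trans (cong suc (trans (+-comm _ (r * 2)) (cong (r * 2 +_) (sym (*-assoc 2 h d))))) refl)))
            (*-monoˡ-≤ d 2h<i))
          y<4hd : i * d ≤ 4 * h * d
          y<4hd = *-monoˡ-≤ d (<⇒≤ i<4h)
          -- There is no second carry: 2s = i d + 1 stays below 2p = 4hd + 2 because i < 4h.
          s<p : s < p
          s<p = *-cancelʳ-< 2 s p (subst₂ _<_ (sym 2s≡) (trans (arith″ h d) (cong (_* 2) (sym p≡))) (s≤s (s≤s y<4hd)))
            where
            arith : ∀ u r → (u * 2 + r) * 2 ≡ u * 2 + u * 2 + r * 2
            arith = solve-∀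
            arith″ : ∀ h d → suc (suc (4 * h * d)) ≡ suc (2 * (h * d)) * 2
            arith″ = solve-∀
            2s≡ : s * 2 ≡ suc (i * d)
            2s≡ = begin
              (u * 2 + r) * 2              ≡⟨ arith u r ⟩
              u * 2 + u * 2 + r * 2        ≡⟨ cong (_+ r * 2) p≡4u ⟨
              suc (p + r * 2)              ≡⟨ cong suc y≡p+2r ⟨
              suc (i * d) ∎
          r<p : r < p
          r<p = ≤-<-trans (m≤n+m r (u * 2)) s<p

-- Sums over a finite field and binomial coefficients in it

module FieldSums {q : ℕ} (F : FiniteField q) where

  open FiniteField F public

  R : CommutativeRing _ _
  R = record { isCommutativeRing = isCommutativeRing }

  open CommutativeRing R public
    using (+-assoc; +-comm; +-identityˡ; +-identityʳ; *-assoc; *-comm; *-identityˡ; *-identityʳ;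
           distribˡ; distribʳ; zeroˡ; zeroʳ; -‿inverseˡ; -‿inverseʳ)
  open import Algebra.Properties.Ring (CommutativeRing.ring R) public
    using (-‿distribˡ-*; -‿distribʳ-*; -‿involutive; -0#≈0#; -1*x≈-x; -‿+-comm)
    renaming (x∙y⁻¹≈ε⇒x≈y to -≡0⇒≡; +-inverseˡ-unique to neg-uniqueˡ)
  open import Algebra.Properties.Semiring.Sum (CommutativeRing.semiring R) public
    using (sum; sum-cong-≗; sum-replicate-zero; sum-init-last; ∑-distrib-+; ∑-comm; sum-permute; *-distribˡ-sum; *-distribʳ-sum)
  open import Algebra.Solver.Ring.NaturalCoefficients.Default (CommutativeRing.commutativeSemiring R) public
    using (solve; _:=_; _:+_; _:*_; con)

  -‿*ˡ : ∀ x y → (- x) * y ≡ - (x * y)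
  -‿*ˡ x y = sym (-‿distribˡ-* x y)

  +-cancelʳ : ∀ x y z → x + z ≡ y + z → x ≡ y
  +-cancelʳ x y z e = begin
    x                ≡⟨ +-identityʳ x ⟨
    x + 0#           ≡⟨ cong (x +_) (-‿inverseʳ z) ⟨
    x + (z + - z)    ≡⟨ +-assoc x z (- z) ⟨
    x + z + - z      ≡⟨ cong (_+ - z) e ⟩
    y + z + - z      ≡⟨ +-assoc y z (- z) ⟩
    y + (z + - z)    ≡⟨ cong (y +_) (-‿inverseʳ z) ⟩
    y + 0#           ≡⟨ +-identityʳ y ⟩
    y ∎

  -+-cancel : ∀ x y → x - y + y ≡ x
  -+-cancel x y = trans (+-assoc x (- y) y) (trans (cong (x +_) (-‿inverseˡ y)) (+-identityʳ x))

  +--cancel : ∀ x y → x + y - y ≡ x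
  +--cancel x y = trans (+-assoc x y (- y)) (trans (cong (x +_) (-‿inverseʳ y)) (+-identityʳ x))

  -‿swap : ∀ x y → - (x - y) ≡ y - x
  -‿swap x y = trans (sym (-‿+-comm x (- y))) (trans (cong (- x +_) (-‿involutive y)) (+-comm (- x) y))

  to : Carrier → Fin q
  to = Inverse.to enum

  from : Fin q → Carrier
  from = Inverse.from enum

  from-to : ∀ x → from (to x) ≡ x
  from-to = Inverse.strictlyInverseʳ enum

  to-injective : ∀ {x y} → to x ≡ to y → x ≡ y
  to-injective {x} {y} e = trans (sym (from-to x)) (trans (cong from e) (from-to y))

  infix 4 _≟_

  _≟_ : (x y : Carrier) → Dec (x ≡ y)
  x ≟ y with to x Fin.≟ to y
  ... | yes e = yes (to-injective e)
  ... | no ne = no (ne ∘ cong to)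

  *-cancelˡ : ∀ x {y z} → x ≢ 0# → x * y ≡ x * z → y ≡ z
  *-cancelˡ x {y} {z} x≢0 e with inverse x x≢0
  ... | x⁻¹ , xx⁻¹ = begin
    y               ≡⟨ lem y ⟩
    x⁻¹ * (x * y)   ≡⟨ cong (x⁻¹ *_) e ⟩
    x⁻¹ * (x * z)   ≡⟨ lem z ⟨
    z ∎
    where
    lem : ∀ y → y ≡ x⁻¹ * (x * y)
    lem y = begin
      y                ≡⟨ *-identityˡ y ⟨
      1# * y           ≡⟨ cong (_* y) xx⁻¹ ⟨
      x * x⁻¹ * y      ≡⟨ cong (_* y) (*-comm x x⁻¹) ⟩
      x⁻¹ * x * y      ≡⟨ *-assoc x⁻¹ x y ⟩
      x⁻¹ * (x * y)    ∎

  *-nonzero : ∀ {x y} → x ≢ 0# → y ≢ 0# → x * y ≢ 0#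
  *-nonzero {x} {y} x≢0 y≢0 e = y≢0 (*-cancelˡ x x≢0 (trans e (sym (zeroʳ x))))

  *≢0⇒ˡ : ∀ {x y} → x * y ≢ 0# → x ≢ 0#
  *≢0⇒ˡ {x} {y} ne e = ne (trans (cong (_* y) e) (zeroˡ y))

  *≢0⇒ʳ : ∀ {x y} → x * y ≢ 0# → y ≢ 0#
  *≢0⇒ʳ {x} {y} ne e = ne (trans (cong (x *_) e) (zeroʳ x))

  -‿nonzero : ∀ {x} → x ≢ 0# → - x ≢ 0#
  -‿nonzero {x} ne e = ne (trans (sym (-‿involutive x)) (trans (cong -_ e) -0#≈0#))

  -- Typically b is a binomial coefficient and g a moment of a kernel. Their being nonzero confines
  -- the summation index, and only then does the third factor have to be shown to vanish.
  *-*-zero : ∀ {b g x} → (b ≢ 0# → g ≢ 0# → x ≡ 0#) → b * (g * x) ≡ 0#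
  *-*-zero {b} {g} {x} z with b ≟ 0# | g ≟ 0#
  ... | yes refl | _ = zeroˡ _
  ... | no _ | yes refl = trans (cong (b *_) (zeroˡ x)) (zeroʳ b)
  ... | no nb | no ng = trans (cong (λ y → b * (g * y)) (z nb ng)) (trans (cong (b *_) (zeroʳ g)) (zeroʳ b))

  1≢0 : 1# ≢ 0#
  1≢0 = 0≢1 ∘ sym

  ^-+ : ∀ x m n → x ^ (m ℕ.+ n) ≡ x ^ m * x ^ n
  ^-+ x zero n = sym (*-identityˡ _)
  ^-+ x (suc m) n = trans (cong (x *_) (^-+ x m n)) (sym (*-assoc _ _ _))

  1^ : ∀ n → 1# ^ n ≡ 1#
  1^ zero = refl
  1^ (suc n) = trans (*-identityˡ _) (1^ n)

  ^-*-distrib : ∀ x y n → (x * y) ^ n ≡ x ^ n * y ^ n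
  ^-*-distrib x y zero = sym (*-identityˡ _)
  ^-*-distrib x y (suc n) = trans (cong (x * y *_) (^-*-distrib x y n))
    (solve 4 (λ a b c d → a :* b :* (c :* d) := a :* c :* (b :* d)) refl x y (x ^ n) (y ^ n))

  ^-assoc : ∀ x m n → x ^ (m ℕ.* n) ≡ (x ^ n) ^ m
  ^-assoc x zero n = refl
  ^-assoc x (suc m) n = trans (^-+ x n (m ℕ.* n)) (cong (x ^ n *_) (^-assoc x m n))

  ^-assoc′ : ∀ x m n → x ^ (m ℕ.* n) ≡ (x ^ m) ^ n
  ^-assoc′ x m n = trans (cong (x ^_) (ℕ.*-comm m n)) (^-assoc x n m)

  ^-nonzero : ∀ {x} n → x ≢ 0# → x ^ n ≢ 0#
  ^-nonzero zero ne = 1≢0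
  ^-nonzero (suc n) ne = *-nonzero ne (^-nonzero n ne)

  ^≡0⇒≡0 : ∀ x n → x ^ n ≡ 0# → x ≡ 0#
  ^≡0⇒≡0 x n e with x ≟ 0#
  ... | yes x≡0 = x≡0
  ... | no ne = contradiction e (^-nonzero n ne)

  0^ : ∀ {n} → 0 ℕ.< n → 0# ^ n ≡ 0#
  0^ (ℕ.s≤s _) = zeroˡ _

  -1^even : ∀ x n → (- x) ^ (n ℕ.* 2) ≡ x ^ (n ℕ.* 2)
  -1^even x n = trans (^-assoc (- x) n 2) (trans (cong (_^ n) sq) (sym (^-assoc x n 2)))
    where
    sq : - x * (- x * 1#) ≡ x * (x * 1#)
    sq = trans (cong (- x *_) (*-identityʳ (- x))) (trans (-‿*ˡ x (- x)) (trans (cong -_ (sym (-‿distribʳ-* x x)))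
      (trans (-‿involutive _) (cong (x *_) (sym (*-identityʳ x))))))

  -1*-1 : - 1# * - 1# ≡ 1#
  -1*-1 = trans (cong (λ z → - 1# * z) (sym (*-identityʳ (- 1#)))) (trans (-1^even 1# 1) (1^ 2))

  ι : ℕ → Carrier
  ι zero = 0#
  ι (suc n) = 1# + ι n

  ι-+ : ∀ m n → ι (m ℕ.+ n) ≡ ι m + ι n
  ι-+ zero n = sym (+-identityˡ _)
  ι-+ (suc m) n = trans (cong (1# +_) (ι-+ m n)) (sym (+-assoc _ _ _))

  ι-* : ∀ m n → ι (m ℕ.* n) ≡ ι m * ι n
  ι-* zero n = sym (zeroˡ _)
  ι-* (suc m) n = trans (ι-+ n (m ℕ.* n)) (trans (cong (ι n +_) (ι-* m n))
    (solve 2 (λ a b → b :+ a :* b := (con 1 :+ a) :* b) refl (ι m) (ι n)))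

  ι-^ : ∀ m n → ι (m ℕ.^ n) ≡ ι m ^ n
  ι-^ m zero = +-identityʳ _
  ι-^ m (suc n) = trans (ι-* m (m ℕ.^ n)) (cong (ι m *_) (ι-^ m n))

  sum-zero : ∀ {n} (t : Fin n → Carrier) → (∀ i → t i ≡ 0#) → sum t ≡ 0#
  sum-zero {n} t z = trans (sum-cong-≗ z) (sum-replicate-zero n)

  sum-single : ∀ {n} (t : Fin n → Carrier) i → (∀ j → j ≢ i → t j ≡ 0#) → sum t ≡ t i
  sum-single {suc n} t Fin.zero z =
    trans (cong (t Fin.zero +_) (sum-zero (t ∘ Fin.suc) (λ j → z (Fin.suc j) λ ()))) (+-identityʳ _)
  sum-single {suc n} t (Fin.suc i) z = trans (cong₂ _+_ (z Fin.zero λ ())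
    (sum-single (t ∘ Fin.suc) i (λ j ne → z (Fin.suc j) (ne ∘ Fin.suc-injective)))) (+-identityˡ _)

  sum-one : ∀ n → sum {n} (λ _ → 1#) ≡ ι n
  sum-one zero = refl
  sum-one (suc n) = cong (1# +_) (sum-one n)

  opaque
    Σ< : ℕ → (ℕ → Carrier) → Carrier
    Σ< n a = sum {n} (a ∘ toℕ)

    ΣF : (Carrier → Carrier) → Carrier
    ΣF φ = sum (φ ∘ from)

    Σ<-cong : ∀ n {a b} → (∀ i → i ℕ.< n → a i ≡ b i) → Σ< n a ≡ Σ< n b
    Σ<-cong n e = sum-cong-≗ λ i → e (toℕ i) (Fin.toℕ<n i)

    Σ<-zero : ∀ n a → (∀ i → i ℕ.< n → a i ≡ 0#) → Σ< n a ≡ 0#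
    Σ<-zero n a z = sum-zero _ λ i → z (toℕ i) (Fin.toℕ<n i)

    Σ<-single : ∀ n a k → k ℕ.< n → (∀ i → i ℕ.< n → i ≢ k → a i ≡ 0#) → Σ< n a ≡ a k
    Σ<-single n a k k<n z = trans
      (sum-single (a ∘ toℕ) (Fin.fromℕ< k<n) λ j ne → z (toℕ j) (Fin.toℕ<n j)
        λ e → ne (Fin.toℕ-injective (trans e (sym (Fin.toℕ-fromℕ< k<n)))))
      (cong a (Fin.toℕ-fromℕ< k<n))

    Σ<-last : ∀ n a → Σ< (suc n) a ≡ Σ< n a + a n
    Σ<-last n a = trans (sum-init-last {n} (a ∘ toℕ))
      (cong₂ _+_ (sum-cong-≗ {n} λ i → cong a (Fin.toℕ-inject₁ i)) (cong a (Fin.toℕ-fromℕ n)))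

    Σ<-* : ∀ n c a → c * Σ< n a ≡ Σ< n (λ i → c * a i)
    Σ<-* n c a = *-distribˡ-sum {n} c (a ∘ toℕ)

    Σ<-+ : ∀ n a b → Σ< n (λ i → a i + b i) ≡ Σ< n a + Σ< n b
    Σ<-+ n a b = ∑-distrib-+ {n} (a ∘ toℕ) (b ∘ toℕ)

    ΣF-cong : ∀ {φ ψ : Carrier → Carrier} → (∀ x → φ x ≡ ψ x) → ΣF φ ≡ ΣF ψ
    ΣF-cong e = sum-cong-≗ λ i → e (from i)

    ΣF-+ : ∀ φ ψ → ΣF (λ x → φ x + ψ x) ≡ ΣF φ + ΣF ψ
    ΣF-+ φ ψ = ∑-distrib-+ (φ ∘ from) (ψ ∘ from)

    ΣF-*ˡ : ∀ c φ → c * ΣF φ ≡ ΣF (λ x → c * φ x)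
    ΣF-*ˡ c φ = *-distribˡ-sum c (φ ∘ from)

    ΣF-*ʳ : ∀ c φ → ΣF φ * c ≡ ΣF (λ x → φ x * c)
    ΣF-*ʳ c φ = *-distribʳ-sum c (φ ∘ from)

    ΣF-swap : ∀ (θ : Carrier → Carrier → Carrier) → ΣF (λ x → ΣF (θ x)) ≡ ΣF (λ y → ΣF (λ x → θ x y))
    ΣF-swap θ = ∑-comm (λ i j → θ (from i) (from j))

    ΣF-Σ< : ∀ n (θ : Carrier → ℕ → Carrier) → ΣF (λ x → Σ< n (θ x)) ≡ Σ< n (λ k → ΣF (λ x → θ x k))
    ΣF-Σ< n θ = ∑-comm {q} {n} (λ i j → θ (from i) (toℕ j))

    ΣF-single : ∀ φ x → (∀ y → y ≢ x → φ y ≡ 0#) → ΣF φ ≡ φ x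
    ΣF-single φ x z = trans
      (sum-single (φ ∘ from) (to x) λ j ne → z (from j) λ e → ne (trans (sym (Inverse.strictlyInverseˡ enum j)) (cong to e)))
      (cong φ (from-to x))

    ΣF-perm : ∀ (π : Carrier ↔ Carrier) φ → ΣF φ ≡ ΣF (φ ∘ Inverse.to π)
    ΣF-perm π φ = trans (sum-permute (φ ∘ from) (enum ↔-∘ (π ↔-∘ ↔-sym enum)))
      (ΣF-cong′ λ i → cong φ (from-to _))
      where
      ΣF-cong′ : ∀ {s t : Fin q → Carrier} → (∀ i → s i ≡ t i) → sum s ≡ sum t
      ΣF-cong′ = sum-cong-≗

    ΣF-perm′ : ∀ (f g : Carrier → Carrier) → (∀ x → f (g x) ≡ x) → (∀ x → g (f x) ≡ x) → ∀ φ → ΣF φ ≡ ΣF (φ ∘ f)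
    ΣF-perm′ f g fg gf = ΣF-perm (mk↔ₛ′ f g fg gf)

    ΣF-shift : ∀ c φ → ΣF φ ≡ ΣF (λ x → φ (x + c))
    ΣF-shift c = ΣF-perm′ (_+ c) (_- c) (λ x → -+-cancel x c) (λ x → +--cancel x c)

    -- Translation by 1 permutes the field, so it fixes the sum of all elements, yet it adds q times
    -- 1 to that sum.
    ι-q : ι q ≡ 0#
    ι-q = trans (sym (sum-one q)) (+-cancelʳ _ _ (ΣF (λ x → x)) (begin
      ΣF (λ _ → 1#) + ΣF (λ x → x)  ≡⟨ +-comm _ _ ⟩
      ΣF (λ x → x) + ΣF (λ _ → 1#)  ≡⟨ ΣF-+ (λ x → x) (λ _ → 1#) ⟨
      ΣF (λ x → x + 1#)             ≡⟨ ΣF-shift 1# (λ x → x) ⟨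
      ΣF (λ x → x)                  ≡⟨ +-identityˡ _ ⟨
      0# + ΣF (λ x → x) ∎))

    ΣF-1 : ΣF (λ _ → 1#) ≡ 0#
    ΣF-1 = trans (sum-one q) ι-q

  δ : Carrier → Carrier
  δ x with x ≟ 0#
  ... | yes _ = 1#
  ... | no _ = 0#

  δ-0 : δ 0# ≡ 1#
  δ-0 with 0# ≟ 0#
  ... | yes _ = refl
  ... | no ne = contradiction refl ne

  δ-≢ : ∀ {x} → x ≢ 0# → δ x ≡ 0#
  δ-≢ {x} ne with x ≟ 0#
  ... | yes e = contradiction e ne
  ... | no _ = refl

  -- Pascal's recursion is run inside the field, which makes Lucas' theorem an equality of field
  -- elements instead of a congruence.
  binom : ℕ → ℕ → Carrier
  binom _ zero = 1#
  binom zero (suc k) = 0#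
  binom (suc n) (suc k) = binom n k + binom n (suc k)

  binom-> : ∀ {n k} → n ℕ.< k → binom n k ≡ 0#
  binom-> {zero} {suc k} _ = refl
  binom-> {suc n} {suc k} (ℕ.s≤s n<k) = trans (cong₂ _+_ (binom-> n<k) (binom-> (ℕ.m<n⇒m<1+n n<k))) (+-identityˡ _)

  binom-diag : ∀ n → binom n n ≡ 1#
  binom-diag zero = refl
  binom-diag (suc n) = trans (cong₂ _+_ (binom-diag n) (binom-> (ℕ.n<1+n n))) (+-identityʳ _)

  binom≢0⇒≤ : ∀ {n k} → binom n k ≢ 0# → k ℕ.≤ n
  binom≢0⇒≤ {n} {k} ne = ℕ.≮⇒≥ λ lt → ne (binom-> lt)

  -- Absorption replaces factorials: it transfers the vanishing of `ι p`, and the nonvanishing of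
  -- smaller `ι k`, to binomial coefficients.
  binom-absorb : ∀ n k → ι (suc k) * binom (suc n) (suc k) ≡ ι (suc n) * binom n k
  binom-absorb zero zero = cong (ι 1 *_) (+-identityʳ 1#)
  binom-absorb zero (suc k) = trans (cong (ι (suc (suc k)) *_) (+-identityʳ 0#)) (trans (zeroʳ _) (sym (zeroʳ _)))
  binom-absorb (suc n) zero = begin
    ι 1 * (1# + binom (suc n) 1)        ≡⟨ distribˡ _ _ _ ⟩
    ι 1 * 1# + ι 1 * binom (suc n) 1    ≡⟨ cong₂ _+_ (trans (*-identityʳ _) (+-identityʳ 1#)) (binom-absorb n zero) ⟩
    1# + ι (suc n) * 1#                 ≡⟨ solve 1 (λ a → con 1 :+ a :* con 1 := (con 1 :+ a) :* con 1) refl (ι (suc n)) ⟩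
    ι (suc (suc n)) * 1# ∎
  binom-absorb (suc n) (suc k) = begin
    (1# + ι (suc k)) * (b + c)
      ≡⟨ solve 3 (λ i b c → (con 1 :+ i) :* (b :+ c) := i :* b :+ b :+ (con 1 :+ i) :* c) refl (ι (suc k)) b c ⟩
    ι (suc k) * b + b + ι (suc (suc k)) * c
      ≡⟨ cong₂ (λ x y → x + b + y) (binom-absorb n k) (binom-absorb n (suc k)) ⟩
    ι (suc n) * binom n k + (binom n k + binom n (suc k)) + ι (suc n) * binom n (suc k)
      ≡⟨ solve 3 (λ i b c → i :* b :+ (b :+ c) :+ i :* c := (con 1 :+ i) :* (b :+ c)) refl (ι (suc n)) (binom n k) (binom n (suc k)) ⟩
    ι (suc (suc n)) * b ∎
    where
    b = binom (suc n) (suc k)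
    c = binom (suc n) (suc (suc k))

  opaque
    unfolding Σ<

    binomial-theorem : ∀ n x y → (x + y) ^ n ≡ Σ< (suc n) (λ k → binom n k * (x ^ k * y ^ (n ℕ.∸ k)))
    binomial-theorem zero x y = solve 0 (con 1 := con 1 :* (con 1 :* con 1) :+ con 0) refl
    binomial-theorem (suc n) x y = begin
      (x + y) * (x + y) ^ n
        ≡⟨ cong ((x + y) *_) (binomial-theorem n x y) ⟩
      (x + y) * Σ< (suc n) e
        ≡⟨ distribʳ _ _ _ ⟩
      x * Σ< (suc n) e + y * Σ< (suc n) e
        ≡⟨ cong₂ _+_ (Σ<-* (suc n) x e) (Σ<-* (suc n) y e) ⟩
      Σ< (suc n) (λ k → x * e k) + Σ< (suc n) (λ k → y * e k)
        ≡⟨ cong (Σ< (suc n) (λ k → x * e k) +_) yside ⟩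
      Σ< (suc n) (λ k → x * e k) + (y₀ + Σ< (suc n) g)
        ≡⟨ solve 3 (λ a b c → a :+ (b :+ c) := b :+ (a :+ c)) refl _ _ _ ⟩
      y₀ + (Σ< (suc n) (λ k → x * e k) + Σ< (suc n) g)
        ≡⟨ cong (y₀ +_) (sym (Σ<-+ (suc n) (λ k → x * e k) g)) ⟩
      y₀ + Σ< (suc n) (λ k → x * e k + g k)
        ≡⟨ cong (y₀ +_) (Σ<-cong (suc n) {λ k → x * e k + g k} λ k _ →
             solve 5 (λ x b c z w → x :* (b :* (z :* w)) :+ c :* (x :* z :* w) := (b :+ c) :* (x :* z :* w))
               refl x (binom n k) (binom n (suc k)) (x ^ k) (y ^ (n ℕ.∸ k))) ⟩
      Σ< (suc (suc n)) (λ k → binom (suc n) k * (x ^ k * y ^ (suc n ℕ.∸ k))) ∎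
      where
      e g : ℕ → Carrier
      e k = binom n k * (x ^ k * y ^ (n ℕ.∸ k))
      g k = binom n (suc k) * (x ^ suc k * y ^ (n ℕ.∸ k))
      y₀ : Carrier
      y₀ = 1# * (1# * y ^ suc n)
      yside : Σ< (suc n) (λ k → y * e k) ≡ y₀ + Σ< (suc n) g
      yside = cong₂ _+_
        (solve 2 (λ y z → y :* (con 1 :* (con 1 :* z)) := con 1 :* (con 1 :* (y :* z))) refl y (y ^ n))
        (begin
          Σ< n (λ k → y * e (suc k))
            ≡⟨ Σ<-cong n step ⟩
          Σ< n g
            ≡⟨ +-identityʳ _ ⟨
          Σ< n g + 0#
            ≡⟨ cong (Σ< n g +_) (trans (cong (_* (x ^ suc n * y ^ (n ℕ.∸ n))) (binom-> (ℕ.n<1+n n))) (zeroˡ _)) ⟨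
          Σ< n g + g n
            ≡⟨ Σ<-last n g ⟨
          Σ< (suc n) g ∎)
        where
        step : ∀ k → k ℕ.< n → y * e (suc k) ≡ g k
        step k k<n = begin
          y * (binom n (suc k) * (x ^ suc k * y ^ (n ℕ.∸ suc k)))
            ≡⟨ solve 4 (λ y b z w → y :* (b :* (z :* w)) := b :* (z :* (y :* w))) refl y (binom n (suc k)) (x ^ suc k) (y ^ (n ℕ.∸ suc k)) ⟩
          binom n (suc k) * (x ^ suc k * y ^ suc (n ℕ.∸ suc k))
            ≡⟨ cong (λ z → binom n (suc k) * (x ^ suc k * y ^ z)) (sym (ℕ.+-∸-assoc 1 k<n)) ⟩
          g k ∎

-- Binomial coefficients in characteristic p: Frobenius and Lucas

module Binomials {q : ℕ} (F : FiniteField q) (p n : ℕ) (p-prime : Prime p) (q≡p^n : q ≡ p ℕ.^ n) where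

  open FieldSums F

  ι-p : ι p ≡ 0#
  ι-p = ^≡0⇒≡0 (ι p) n (trans (sym (ι-^ p n)) (trans (cong ι (sym q≡p^n)) ι-q))

  -- If k and p both vanished in the field, a Bézout relation between them would read 1 = 0.
  ι-nonzero : ∀ {k} → 0 ℕ.< k → k ℕ.< p → ι k ≢ 0#
  ι-nonzero {k} 0<k k<p ιk≡0 = bezout (coprime-Bézout (prime⇒coprime p-prime ⦃ ℕ.>-nonZero 0<k ⦄ k<p))
    where
    vanish : ∀ x {y} → ι y ≡ 0# → ι (x ℕ.* y) ≡ 0#
    vanish x e = trans (ι-* x _) (trans (cong (ι x *_) e) (zeroʳ _))
    one : ∀ x y {a b} → ι a ≡ 0# → ι b ≡ 0# → 1 ℕ.+ x ℕ.* a ≡ y ℕ.* b → 1# ≡ 0#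
    one x y {a} {b} ea eb e = begin
      1#                       ≡⟨ +-identityʳ _ ⟨
      1# + 0#                  ≡⟨ cong (1# +_) (vanish x ea) ⟨
      ι (1 ℕ.+ x ℕ.* a)        ≡⟨ cong ι e ⟩
      ι (y ℕ.* b)              ≡⟨ vanish y eb ⟩
      0# ∎
    bezout : ¬ Bézout.Identity 1 p k
    bezout (Bézout.+- x y e) = 1≢0 (one y x ιk≡0 ι-p e)
    bezout (Bézout.-+ x y e) = 1≢0 (one x y ι-p ιk≡0 e)

  binom-nonzero : ∀ {r s} → s ℕ.≤ r → r ℕ.< p → binom r s ≢ 0#
  binom-nonzero {r} {zero} _ _ = 1≢0
  binom-nonzero {suc r} {suc s} (ℕ.s≤s s≤r) r<p =
    *≢0⇒ʳ λ e → *-nonzero (ι-nonzero ℕ.z<s r<p) (binom-nonzero s≤r (ℕ.<-trans (ℕ.n<1+n r) r<p)) (trans (sym (binom-absorb r s)) e)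

  -- This is additivity of the P-th power on the level of coefficients. P is left general because
  -- both P = p and P = q are needed.
  FrobeniusExponent : ℕ → Set
  FrobeniusExponent P = ∀ k → 0 ℕ.< k → k ℕ.< P → binom P k ≡ 0#

  module _ {P′ : ℕ} (frob : FrobeniusExponent (suc P′)) where
    private
      P = suc P′

      swap : ∀ a b → a ℕ.+ (P ℕ.+ b) ≡ P ℕ.+ (a ℕ.+ b)
      swap a b = trans (sym (ℕ.+-assoc a P b)) (trans (cong (ℕ._+ b) (ℕ.+-comm a P)) (ℕ.+-assoc P a b))

    -- This lemma and `binom-P+-high` compare coefficients in (1 + x)^(P + N) = (1 + x^P)(1 + x)^N;
    -- below degree P the first factor has no effect.
    binom-P+-low : ∀ N k → k ℕ.< P → binom (P ℕ.+ N) k ≡ binom N k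
    binom-P+-low N zero _ = refl
    binom-P+-low zero (suc k) k<P = trans (cong (λ z → binom z (suc k)) (ℕ.+-identityʳ P)) (frob (suc k) ℕ.z<s k<P)
    binom-P+-low (suc N) (suc k) k<P = trans (cong (λ z → binom z (suc k)) (ℕ.+-suc P N))
      (cong₂ _+_ (binom-P+-low N k (ℕ.<-trans (ℕ.n<1+n k) k<P)) (binom-P+-low N (suc k) k<P))

    binom-P+-high : ∀ N k → binom (P ℕ.+ N) (P ℕ.+ k) ≡ binom N (P ℕ.+ k) + binom N k
    binom-P+-high zero zero = begin
      binom (P ℕ.+ 0) (P ℕ.+ 0)     ≡⟨ binom-diag (P ℕ.+ 0) ⟩
      1#                            ≡⟨ +-identityˡ 1# ⟨
      0# + 1#                       ∎
    binom-P+-high zero (suc k) = trans (binom-> (ℕ.+-monoʳ-< P ℕ.z<s)) (sym (+-identityˡ 0#))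
    binom-P+-high (suc N) zero = begin
      binom (P ℕ.+ suc N) (P ℕ.+ 0)                            ≡⟨ cong₂ binom (ℕ.+-suc P N) (ℕ.+-identityʳ P) ⟩
      binom (P ℕ.+ N) P′ + binom (P ℕ.+ N) P                   ≡⟨ cong₂ _+_ (binom-P+-low N P′ ℕ.≤-refl) (cong (binom (P ℕ.+ N)) (sym (ℕ.+-identityʳ P))) ⟩
      binom N P′ + binom (P ℕ.+ N) (P ℕ.+ 0)                   ≡⟨ cong (binom N P′ +_) (binom-P+-high N zero) ⟩
      binom N P′ + (binom N (P ℕ.+ 0) + 1#)                    ≡⟨ +-assoc _ _ _ ⟨
      binom N P′ + binom N (P ℕ.+ 0) + 1#                      ≡⟨ cong (λ z → binom N z + binom N (P ℕ.+ 0) + 1#) (ℕ.+-identityʳ P′) ⟨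
      binom (suc N) (P ℕ.+ 0) + 1# ∎
    binom-P+-high (suc N) (suc k) = begin
      binom (P ℕ.+ suc N) (P ℕ.+ suc k)
        ≡⟨ cong (λ z → binom z (P ℕ.+ suc k)) (ℕ.+-suc P N) ⟩
      binom (P ℕ.+ N) (P′ ℕ.+ suc k) + binom (P ℕ.+ N) (P ℕ.+ suc k)
        ≡⟨ cong₂ _+_ (trans (cong (binom (P ℕ.+ N)) (ℕ.+-suc P′ k)) (binom-P+-high N k)) (binom-P+-high N (suc k)) ⟩
      (binom N (P ℕ.+ k) + binom N k) + (binom N (P ℕ.+ suc k) + binom N (suc k))
        ≡⟨ solve 4 (λ a b c d → (a :+ b) :+ (c :+ d) := (a :+ c) :+ (b :+ d)) refl _ _ _ _ ⟩
      (binom N (P ℕ.+ k) + binom N (P ℕ.+ suc k)) + (binom N k + binom N (suc k))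
        ≡⟨ cong (λ z → (binom N z + binom N (P ℕ.+ suc k)) + (binom N k + binom N (suc k))) (sym (ℕ.+-suc P′ k)) ⟩
      binom (suc N) (P ℕ.+ suc k) + binom (suc N) (suc k) ∎

    -- Induction on the upper quotient: removing one P from the upper entry becomes Pascal's
    -- recursion for the quotients.
    lucas-suc : ∀ {r s} n k → r ℕ.< P → s ℕ.< P → binom (r ℕ.+ n ℕ.* P) (s ℕ.+ k ℕ.* P) ≡ binom r s * binom n k
    lucas-suc {r} {s} zero zero _ _ = trans (cong₂ binom (ℕ.+-identityʳ r) (ℕ.+-identityʳ s)) (sym (*-identityʳ _))
    lucas-suc {r} {s} zero (suc k) r<P _ = trans
      (binom-> (ℕ.<-≤-trans (subst (ℕ._< P) (sym (ℕ.+-identityʳ r)) r<P) (ℕ.≤-trans (ℕ.m≤m+n P (k ℕ.* P)) (ℕ.m≤n+m _ s))))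
      (sym (zeroʳ _))
    lucas-suc {r} {s} (suc n) zero r<P s<P = begin
      binom (r ℕ.+ (P ℕ.+ n ℕ.* P)) (s ℕ.+ 0)    ≡⟨ cong (λ z → binom z (s ℕ.+ 0)) (swap r (n ℕ.* P)) ⟩
      binom (P ℕ.+ (r ℕ.+ n ℕ.* P)) (s ℕ.+ 0)    ≡⟨ binom-P+-low _ (s ℕ.+ 0) (subst (ℕ._< P) (sym (ℕ.+-identityʳ s)) s<P) ⟩
      binom (r ℕ.+ n ℕ.* P) (s ℕ.+ 0)            ≡⟨ lucas-suc n zero r<P s<P ⟩
      binom r s * 1# ∎
    lucas-suc {r} {s} (suc n) (suc k) r<P s<P = begin
      binom (r ℕ.+ (P ℕ.+ n ℕ.* P)) (s ℕ.+ (P ℕ.+ k ℕ.* P))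
        ≡⟨ cong₂ binom (swap r (n ℕ.* P)) (swap s (k ℕ.* P)) ⟩
      binom (P ℕ.+ N) (P ℕ.+ (s ℕ.+ k ℕ.* P))
        ≡⟨ binom-P+-high N (s ℕ.+ k ℕ.* P) ⟩
      binom N (P ℕ.+ (s ℕ.+ k ℕ.* P)) + binom N (s ℕ.+ k ℕ.* P)
        ≡⟨ cong₂ _+_ (trans (cong (binom N) (sym (swap s (k ℕ.* P)))) (lucas-suc n (suc k) r<P s<P)) (lucas-suc n k r<P s<P) ⟩
      binom r s * binom n (suc k) + binom r s * binom n k
        ≡⟨ solve 3 (λ a b c → a :* b :+ a :* c := a :* (c :+ b)) refl _ _ _ ⟩
      binom r s * binom (suc n) (suc k) ∎
      where
      N = r ℕ.+ n ℕ.* P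

    opaque
      unfolding Σ< ΣF

      frobenius-additive-suc : ∀ x y → (x + y) ^ P ≡ x ^ P + y ^ P
      frobenius-additive-suc x y = begin
        (x + y) ^ P
          ≡⟨ binomial-theorem P x y ⟩
        Σ< (suc P) e
          ≡⟨ Σ<-last P e ⟩
        e 0 + Σ< P′ (λ k → e (suc k)) + e P
          ≡⟨ cong₂ _+_ (cong (e 0 +_) (Σ<-zero P′ (λ k → e (suc k)) λ k k<P′ →
               trans (cong (_* (x ^ suc k * y ^ (P ℕ.∸ suc k))) (frob (suc k) ℕ.z<s (ℕ.s≤s k<P′))) (zeroˡ _)))
             (cong₂ (λ b z → b * (x ^ P * y ^ z)) (binom-diag P) (ℕ.n∸n≡0 P)) ⟩
        1# * (1# * y ^ P) + 0# + 1# * (x ^ P * 1#)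
          ≡⟨ solve 2 (λ a b → con 1 :* (con 1 :* b) :+ con 0 :+ con 1 :* (a :* con 1) := a :+ b) refl (x ^ P) (y ^ P) ⟩
        x ^ P + y ^ P ∎
        where
        e : ℕ → Carrier
        e k = binom P k * (x ^ k * y ^ (P ℕ.∸ k))

      frobenius-Σ-suc : ∀ φ → ΣF φ ^ P ≡ ΣF (λ x → φ x ^ P)
      frobenius-Σ-suc φ = go (λ i → φ (from i))
        where
        go : ∀ {m} (t : Fin m → Carrier) → sum t ^ P ≡ sum (λ i → t i ^ P)
        go {zero} t = zeroˡ _
        go {suc m} t = trans (frobenius-additive-suc _ _) (cong ((t Fin.zero ^ P) +_) (go (λ i → t (Fin.suc i))))

  lucas : ∀ {P r s} → FrobeniusExponent P → ∀ a b → r ℕ.< P → s ℕ.< P →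
    binom (r ℕ.+ a ℕ.* P) (s ℕ.+ b ℕ.* P) ≡ binom r s * binom a b
  lucas {suc _} frob = lucas-suc frob

  frobenius-additive : ∀ {P} → 0 ℕ.< P → FrobeniusExponent P → ∀ x y → (x + y) ^ P ≡ x ^ P + y ^ P
  frobenius-additive {suc _} _ frob = frobenius-additive-suc frob

  frobenius-Σ : ∀ {P} → 0 ℕ.< P → FrobeniusExponent P → ∀ φ → ΣF φ ^ P ≡ ΣF (λ x → φ x ^ P)
  frobenius-Σ {suc _} _ frob = frobenius-Σ-suc frob

  -- Lucas' theorem for P splits the coefficient. A nonzero low digit of k kills the factor with
  -- upper entry 0; a zero low digit leaves an inner coefficient of P′.
  frobeniusExponent-* : ∀ {P P′} → FrobeniusExponent P → FrobeniusExponent P′ → FrobeniusExponent (P′ ℕ.* P)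
  frobeniusExponent-* {zero} {P′} _ _ k _ k<0 = contradiction (subst (k ℕ.<_) (ℕ.*-zeroʳ P′) k<0) ℕ.n≮0
  frobeniusExponent-* {P@(suc _)} {P′} f f′ k 0<k k<P′P = begin
    binom (P′ ℕ.* P) k                                       ≡⟨ cong (binom (P′ ℕ.* P)) (m≡m%n+[m/n]*n k P) ⟩
    binom (0 ℕ.+ P′ ℕ.* P) (k ℕ.% P ℕ.+ (k ℕ./ P) ℕ.* P)     ≡⟨ lucas f P′ (k ℕ./ P) ℕ.z<s (m%n<n k P) ⟩
    binom 0 (k ℕ.% P) * binom P′ (k ℕ./ P)                   ≡⟨ digits (k ℕ.% P) (k ℕ./ P) (m≡m%n+[m/n]*n k P) ⟩
    0# ∎
    where
    digits : ∀ s t → k ≡ s ℕ.+ t ℕ.* P → binom 0 s * binom P′ t ≡ 0#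
    digits (suc s) t _ = zeroˡ _
    digits zero zero e = contradiction (subst (0 ℕ.<_) e 0<k) ℕ.n≮0
    digits zero (suc t) e = trans (*-identityˡ _)
      (f′ (suc t) ℕ.z<s (ℕ.*-cancelʳ-< P (suc t) P′ (subst (ℕ._< P′ ℕ.* P) e k<P′P)))

  frobeniusExponent-p : FrobeniusExponent p
  frobeniusExponent-p = go p refl
    where
    go : ∀ p′ → p ≡ p′ → FrobeniusExponent p′
    go (suc p′) refl (suc k) _ k<p = *-cancelˡ (ι (suc k)) (ι-nonzero ℕ.z<s k<p) (begin
      ι (suc k) * binom p (suc k)     ≡⟨ binom-absorb p′ k ⟩
      ι p * binom p′ k                ≡⟨ cong (_* binom p′ k) ι-p ⟩
      0# * binom p′ k                 ≡⟨ zeroˡ _ ⟩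
      0#                              ≡⟨ zeroʳ _ ⟨
      ι (suc k) * 0# ∎)

  frobeniusExponent-^ : ∀ i → FrobeniusExponent (p ℕ.^ i)
  frobeniusExponent-^ zero (suc k) _ (ℕ.s≤s ())
  frobeniusExponent-^ (suc i) = frobeniusExponent-* (frobeniusExponent-^ i) frobeniusExponent-p

  -- The inner coefficients of row q vanish, so that neighbours in row κ = q - 1 are opposite,
  -- starting from 1.
  binom-κ-nonzero : ∀ {κ} → q ≡ suc κ → ∀ k → k ℕ.≤ κ → binom κ k ≢ 0#
  binom-κ-nonzero q≡ zero _ = 1≢0
  binom-κ-nonzero {κ} q≡ (suc k) k<κ e = binom-κ-nonzero q≡ k (ℕ.<⇒≤ k<κ) (begin
    binom κ k                        ≡⟨ +-identityʳ _ ⟨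
    binom κ k + 0#                   ≡⟨ cong (binom κ k +_) e ⟨
    binom (suc κ) (suc k)            ≡⟨ subst FrobeniusExponent (trans (sym q≡p^n) q≡) (frobeniusExponent-^ n) (suc k) ℕ.z<s (ℕ.s≤s k<κ) ⟩
    0# ∎)

-- Power sums, moments and convolution

module Moments {q : ℕ} (F : FiniteField q) (κ : ℕ) (q≡ : q ≡ suc κ) (1<κ : 1 ℕ.< κ)
  (2≢0 : FiniteField._+_ F (FiniteField.1# F) (FiniteField.1# F) ≢ FiniteField.0# F)
  (ω : FiniteField.Carrier F) (isPrimitive : FiniteField.IsPrimitive F ω) where

  open FieldSums F

  instance
    κ-nonZero : ℕ.NonZero κ
    κ-nonZero = ℕ.>-nonZero (ℕ.<-trans ℕ.z<s 1<κ)

  0<κ : 0 ℕ.< κ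
  0<κ = ℕ.<-trans ℕ.z<s 1<κ

  -1≢1 : - 1# ≢ 1#
  -1≢1 e = 2≢0 (trans (cong (1# +_) (sym e)) (-‿inverseʳ 1#))

  ω≢0 : ω ≢ 0#
  ω≢0 ω≡0 with isPrimitive (- 1#) (-‿nonzero 1≢0)
  ... | zero , e = -1≢1 (sym e)
  ... | suc j , e = -‿nonzero 1≢0 (trans (sym e) (trans (cong (_* ω ^ j) ω≡0) (zeroˡ _)))

  -- Avoiding one value saves one pigeonhole, which brings the period of ω down to at most κ instead
  -- of q.
  pigeonhole-avoiding : ∀ {q κ} → q ≡ suc κ → (z : Fin q) (f : ℕ → Fin q) → (∀ i → f i ≢ z) →
    ∃₂ λ i c → 0 ℕ.< c × c ℕ.≤ κ × f (c ℕ.+ i) ≡ f i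
  pigeonhole-avoiding {κ = κ} refl z f f≢z
    with Fin.pigeonhole (ℕ.n<1+n κ) (λ (i : Fin (suc κ)) → Fin.punchOut (f≢z (toℕ i) ∘ sym))
  ... | i , j , i<j , e = toℕ i , toℕ j ℕ.∸ toℕ i , ℕ.m<n⇒0<n∸m i<j , ℕ.≤-trans (ℕ.m∸n≤m _ (toℕ i)) (ℕ.s≤s⁻¹ (Fin.toℕ<n j)) ,
    trans (cong f (ℕ.m∸n+n≡m (ℕ.<⇒≤ i<j))) (sym (Fin.punchOut-injective (f≢z (toℕ i) ∘ sym) (f≢z (toℕ j) ∘ sym) e))

  ω^-period : ∀ {c} → ω ^ c ≡ 1# → ∀ i j → ω ^ (i ℕ.+ j ℕ.* c) ≡ ω ^ i
  ω^-period {c} e i j = begin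
    ω ^ (i ℕ.+ j ℕ.* c)       ≡⟨ ^-+ ω i (j ℕ.* c) ⟩
    ω ^ i * ω ^ (j ℕ.* c)     ≡⟨ cong (ω ^ i *_) (trans (^-assoc ω j c) (trans (cong (_^ j) e) (1^ j))) ⟩
    ω ^ i * 1#                ≡⟨ *-identityʳ _ ⟩
    ω ^ i ∎

  -- If ω^c = 1, logarithms modulo c and one extra symbol for 0 inject the field into c + 1 symbols.
  order-≥ : ∀ c → 0 ℕ.< c → ω ^ c ≡ 1# → κ ℕ.≤ c
  order-≥ c 0<c e = ℕ.s≤s⁻¹ (subst (ℕ._≤ suc c) q≡ (Fin.injective⇒≤ {f = code ∘ from} (from-injective ∘ code-injective)))
    where
    instance
      c-nonZero : ℕ.NonZero c
      c-nonZero = ℕ.>-nonZero 0<c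
    from-injective : ∀ {i j} → from i ≡ from j → i ≡ j
    from-injective {i} {j} e = trans (sym (to-from i)) (trans (cong to e) (to-from j))
      where
      to-from : ∀ i → to (from i) ≡ i
      to-from = Inverse.strictlyInverseˡ enum
    log : ∀ {x} → x ≢ 0# → ℕ
    log ne = proj₁ (isPrimitive _ ne)
    ω^log : ∀ {x} (ne : x ≢ 0#) → ω ^ (log ne ℕ.% c) ≡ x
    ω^log ne = trans (sym (ω^-period e (log ne ℕ.% c) (log ne ℕ./ c)))
      (trans (cong (ω ^_) (sym (m≡m%n+[m/n]*n (log ne) c))) (proj₂ (isPrimitive _ ne)))
    code : Carrier → Fin (suc c)
    code x with x ≟ 0#
    ... | yes _ = Fin.zero
    ... | no ne = Fin.suc (Fin.fromℕ< (m%n<n (log ne) c))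
    code-injective : ∀ {x y} → code x ≡ code y → x ≡ y
    code-injective {x} {y} e with x ≟ 0# | y ≟ 0#
    ... | yes x≡0 | yes y≡0 = trans x≡0 (sym y≡0)
    ... | no nx | no ny = trans (sym (ω^log nx)) (trans (cong (ω ^_) (Fin.fromℕ<-injective _ _ _ _ (Fin.suc-injective e))) (ω^log ny))

  ω^κ : ω ^ κ ≡ 1#
  ω^κ with pigeonhole-avoiding q≡ (to 0#) (λ i → to (ω ^ i)) (λ i e → ^-nonzero i ω≢0 (to-injective e))
  ... | i , c , 0<c , c≤κ , e = subst (λ c → ω ^ c ≡ 1#) (ℕ.≤-antisym c≤κ (order-≥ c 0<c ω^c)) ω^c
    where
    ω^c : ω ^ c ≡ 1#
    ω^c = *-cancelˡ (ω ^ i) (^-nonzero i ω≢0) (begin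
      ω ^ i * ω ^ c     ≡⟨ *-comm _ _ ⟩
      ω ^ c * ω ^ i     ≡⟨ ^-+ ω c i ⟨
      ω ^ (c ℕ.+ i)     ≡⟨ to-injective e ⟩
      ω ^ i             ≡⟨ *-identityʳ _ ⟨
      ω ^ i * 1# ∎)

  ω^≡1⇒κ∣ : ∀ a → ω ^ a ≡ 1# → κ ∣ a
  ω^≡1⇒κ∣ a e = m%n≡0⇒n∣m a κ (small (a ℕ.% κ) (m%n<n a κ)
    (trans (sym (ω^-period ω^κ (a ℕ.% κ) (a ℕ./ κ))) (trans (cong (ω ^_) (sym (m≡m%n+[m/n]*n a κ))) e)))
    where
    small : ∀ r → r ℕ.< κ → ω ^ r ≡ 1# → r ≡ 0
    small zero _ _ = refl
    small (suc r) r<κ e = contradiction (order-≥ (suc r) ℕ.z<s e) (ℕ.<⇒≱ r<κ)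

  x^κ : ∀ {x} → x ≢ 0# → x ^ κ ≡ 1#
  x^κ {x} ne with isPrimitive x ne
  ... | j , refl = trans (sym (^-assoc′ ω j κ)) (trans (^-assoc ω j κ) (trans (cong (_^ j) ω^κ) (1^ j)))

  x^κ+δ : ∀ x → x ^ κ + δ x ≡ 1#
  x^κ+δ x with x ≟ 0#
  ... | yes refl = trans (cong (_+ 1#) (0^ 0<κ)) (+-identityˡ _)
  ... | no ne = trans (+-identityʳ _) (x^κ ne)

  powerSum : ℕ → Carrier
  powerSum a = ΣF (_^ a)

  -- Multiplication by ω permutes the field and scales the sum by ω^a, which is not 1.
  powerSum-∤ : ∀ {a} → κ ∤ a → powerSum a ≡ 0#
  powerSum-∤ {a} κ∤a with powerSum a ≟ 0#
  ... | yes e = e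
  ... | no ne = contradiction (ω^≡1⇒κ∣ a (*-cancelˡ (powerSum a) ne (begin
      powerSum a * ω ^ a             ≡⟨ *-comm _ _ ⟩
      ω ^ a * powerSum a             ≡⟨ ΣF-*ˡ (ω ^ a) (_^ a) ⟩
      ΣF (λ x → ω ^ a * x ^ a)       ≡⟨ ΣF-cong (λ x → sym (^-*-distrib ω x a)) ⟩
      ΣF (λ x → (ω * x) ^ a)         ≡⟨ ΣF-perm′ (ω *_) (ω⁻¹ *_) (inv ωω⁻¹) (inv (trans (*-comm _ _) ωω⁻¹)) (_^ a) ⟨
      powerSum a                     ≡⟨ *-identityʳ _ ⟨
      powerSum a * 1# ∎))) κ∤a
    where
    ω⁻¹ = proj₁ (inverse ω ω≢0)
    ωω⁻¹ = proj₂ (inverse ω ω≢0)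
    inv : ∀ {a b} → a * b ≡ 1# → ∀ x → a * (b * x) ≡ x
    inv e x = trans (sym (*-assoc _ _ x)) (trans (cong (_* x) e) (*-identityˡ x))

  powerSum-0 : powerSum 0 ≡ 0#
  powerSum-0 = ΣF-1

  powerSum-κ : powerSum κ ≡ - 1#
  powerSum-κ = neg-uniqueˡ _ _ (begin
    powerSum κ + 1#                  ≡⟨ cong (powerSum κ +_) (trans (ΣF-single δ 0# (λ y → δ-≢)) δ-0) ⟨
    powerSum κ + ΣF δ                ≡⟨ ΣF-+ (_^ κ) δ ⟨
    ΣF (λ x → x ^ κ + δ x)           ≡⟨ ΣF-cong x^κ+δ ⟩
    ΣF (λ _ → 1#)                    ≡⟨ ΣF-1 ⟩
    0# ∎)

  -- The multiples of κ below 2κ are 0 and κ, and the exponent 0 gives q · 1 = 0.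
  powerSum≢0 : ∀ {a} → a ℕ.< 2 ℕ.* κ → powerSum a ≢ 0# → a ≡ κ
  powerSum≢0 {a} a<2κ ne with κ ∣? a
  ... | no κ∤a = contradiction (powerSum-∤ κ∤a) ne
  ... | yes (divides 0 refl) = contradiction powerSum-0 ne
  ... | yes (divides 1 refl) = ℕ.*-identityˡ κ
  ... | yes (divides (suc (suc j)) refl) = contradiction (ℕ.*-cancelʳ-< κ (2 ℕ.+ j) 2 a<2κ) (ℕ.m+n≮m 2 j)

  moment : ℕ → (Carrier → Carrier) → Carrier
  moment a φ = ΣF (λ x → φ x * x ^ a)

  moment-cong : ∀ a {φ ψ : Carrier → Carrier} → (∀ x → φ x ≡ ψ x) → moment a φ ≡ moment a ψ
  moment-cong a e = ΣF-cong λ x → cong (_* x ^ a) (e x)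

  -- Lagrange interpolation: φ x is the sum of φ y δ(y - x), and δ z = 1 - z^κ is expanded by the
  -- binomial theorem. The constant 1 accounts for the separate `moment 0 φ`.
  interpolation : ∀ φ x → φ x ≡ moment 0 φ - Σ< (suc κ) (λ k → binom κ k * (moment k φ * (- x) ^ (κ ℕ.∸ k)))
  interpolation φ x = begin
    φ x
      ≡⟨ *-identityʳ (φ x) ⟨
    φ x * 1#
      ≡⟨ cong (φ x *_) (trans (cong δ (-‿inverseʳ x)) δ-0) ⟨
    φ x * δ (x - x)
      ≡⟨ ΣF-single (λ y → φ y * δ (y - x)) x (λ y ne → trans (cong (φ y *_) (δ-≢ (ne ∘ -≡0⇒≡ y x))) (zeroʳ _)) ⟨
    ΣF (λ y → φ y * δ (y - x))
      ≡⟨ +--cancel _ P ⟨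
    ΣF (λ y → φ y * δ (y - x)) + P - P
      ≡⟨ cong (_- P) (ΣF-+ (λ y → φ y * δ (y - x)) (λ y → φ y * (y - x) ^ κ)) ⟨
    ΣF (λ y → φ y * δ (y - x) + φ y * (y - x) ^ κ) - P
      ≡⟨ cong (_- P) (ΣF-cong λ y → trans (sym (distribˡ _ _ _)) (cong (φ y *_) (trans (+-comm _ _) (x^κ+δ (y - x))))) ⟩
    moment 0 φ - P
      ≡⟨ cong (λ z → moment 0 φ - z) expand ⟩
    moment 0 φ - Σ< (suc κ) (λ k → binom κ k * (moment k φ * (- x) ^ (κ ℕ.∸ k))) ∎
    where
    P = ΣF (λ y → φ y * (y - x) ^ κ)
    e : Carrier → ℕ → Carrier
    e y k = φ y * (binom κ k * (y ^ k * (- x) ^ (κ ℕ.∸ k)))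
    expand : P ≡ Σ< (suc κ) (λ k → binom κ k * (moment k φ * (- x) ^ (κ ℕ.∸ k)))
    expand = begin
      P
        ≡⟨ ΣF-cong (λ y → trans (cong (φ y *_) (binomial-theorem κ y (- x))) (Σ<-* (suc κ) (φ y) _)) ⟩
      ΣF (λ y → Σ< (suc κ) (e y))
        ≡⟨ ΣF-Σ< (suc κ) e ⟩
      Σ< (suc κ) (λ k → ΣF (λ y → e y k))
        ≡⟨ Σ<-cong (suc κ) {λ k → ΣF (λ y → e y k)} (λ k _ → begin
          ΣF (λ y → e y k)
            ≡⟨ ΣF-cong (λ y → solve 4 (λ f b z w → f :* (b :* (z :* w)) := b :* (f :* z :* w)) refl (φ y) (binom κ k) (y ^ k) ((- x) ^ (κ ℕ.∸ k))) ⟩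
          ΣF (λ y → binom κ k * (φ y * y ^ k * (- x) ^ (κ ℕ.∸ k)))
            ≡⟨ ΣF-*ˡ (binom κ k) _ ⟨
          binom κ k * ΣF (λ y → φ y * y ^ k * (- x) ^ (κ ℕ.∸ k))
            ≡⟨ cong (binom κ k *_) (sym (ΣF-*ʳ ((- x) ^ (κ ℕ.∸ k)) (λ y → φ y * y ^ k))) ⟩
          binom κ k * (moment k φ * (- x) ^ (κ ℕ.∸ k)) ∎) ⟩
      Σ< (suc κ) (λ k → binom κ k * (moment k φ * (- x) ^ (κ ℕ.∸ k))) ∎

  moments≡0⇒≡0 : ∀ φ → (∀ a → a ℕ.≤ κ → moment a φ ≡ 0#) → ∀ x → φ x ≡ 0#
  moments≡0⇒≡0 φ z x = begin
    φ x              ≡⟨ interpolation φ x ⟩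
    moment 0 φ - _   ≡⟨ cong₂ _-_ (z 0 ℕ.z≤n) (Σ<-zero (suc κ) (λ k → binom κ k * (moment k φ * (- x) ^ (κ ℕ.∸ k)))
                          (λ k k≤κ → trans (cong (λ m → binom κ k * (m * (- x) ^ (κ ℕ.∸ k))) (z k (ℕ.s≤s⁻¹ k≤κ)))
                            (trans (cong (binom κ k *_) (zeroˡ _)) (zeroʳ _)))) ⟩
    0# - 0#          ≡⟨ -‿inverseʳ 0# ⟩
    0# ∎

  Even : (Carrier → Carrier) → Set
  Even G = ∀ x y → G (x - y) ≡ G (y - x)

  T : (Carrier → Carrier) → (Carrier → Carrier) → Carrier → Carrier
  T G φ x = ΣF (λ y → G (y - x) * φ y)

  T-power : ∀ G j x → T G (_^ j) x ≡ Σ< (suc j) (λ k → binom j k * (moment k G * x ^ (j ℕ.∸ k)))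
  T-power G j x = begin
    ΣF (λ y → G (y - x) * y ^ j)
      ≡⟨ ΣF-shift x (λ y → G (y - x) * y ^ j) ⟩
    ΣF (λ z → G (z + x - x) * (z + x) ^ j)
      ≡⟨ ΣF-cong (λ z → trans (cong₂ _*_ (cong G (+--cancel z x)) (binomial-theorem j z x)) (Σ<-* (suc j) (G z) _)) ⟩
    ΣF (λ z → Σ< (suc j) (e z))
      ≡⟨ ΣF-Σ< (suc j) e ⟩
    Σ< (suc j) (λ k → ΣF (λ z → e z k))
      ≡⟨ Σ<-cong (suc j) {λ k → ΣF (λ z → e z k)} (λ k _ → begin
          ΣF (λ z → e z k)
            ≡⟨ ΣF-cong (λ z → solve 4 (λ f b z w → f :* (b :* (z :* w)) := b :* (f :* z :* w)) refl (G z) (binom j k) (z ^ k) (x ^ (j ℕ.∸ k))) ⟩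
          ΣF (λ z → binom j k * (G z * z ^ k * x ^ (j ℕ.∸ k)))
            ≡⟨ ΣF-*ˡ (binom j k) _ ⟨
          binom j k * ΣF (λ z → G z * z ^ k * x ^ (j ℕ.∸ k))
            ≡⟨ cong (binom j k *_) (sym (ΣF-*ʳ (x ^ (j ℕ.∸ k)) (λ z → G z * z ^ k))) ⟩
          binom j k * (moment k G * x ^ (j ℕ.∸ k)) ∎) ⟩
    Σ< (suc j) (λ k → binom j k * (moment k G * x ^ (j ℕ.∸ k))) ∎
    where
    e : Carrier → ℕ → Carrier
    e z k = G z * (binom j k * (z ^ k * x ^ (j ℕ.∸ k)))

  -- On moments, convolution is multiplication in a divided power algebra.
  moment-T : ∀ {G} → Even G → ∀ φ a →
    moment a (T G φ) ≡ Σ< (suc a) (λ k → binom a k * (moment k G * moment (a ℕ.∸ k) φ))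
  moment-T {G} even φ a = begin
    ΣF (λ x → T G φ x * x ^ a)
      ≡⟨ ΣF-cong (λ x → ΣF-*ʳ (x ^ a) _) ⟩
    ΣF (λ x → ΣF (λ y → G (y - x) * φ y * x ^ a))
      ≡⟨ ΣF-swap (λ x y → G (y - x) * φ y * x ^ a) ⟩
    ΣF (λ y → ΣF (λ x → G (y - x) * φ y * x ^ a))
      -- Evenness makes `T G` self-adjoint, which moves it from φ onto the power x^a.
      ≡⟨ ΣF-cong (λ y → trans (ΣF-cong (λ x → trans (cong (λ g → g * φ y * x ^ a) (even y x))
           (solve 3 (λ g f z → g :* f :* z := f :* (g :* z)) refl (G (x - y)) (φ y) (x ^ a)))) (sym (ΣF-*ˡ (φ y) _))) ⟩
    ΣF (λ y → φ y * T G (_^ a) y)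
      ≡⟨ ΣF-cong (λ y → trans (cong (φ y *_) (T-power G a y)) (Σ<-* (suc a) (φ y) _)) ⟩
    ΣF (λ y → Σ< (suc a) (λ k → φ y * (binom a k * (moment k G * y ^ (a ℕ.∸ k)))))
      ≡⟨ ΣF-Σ< (suc a) e ⟩
    Σ< (suc a) (λ k → ΣF (λ y → φ y * (binom a k * (moment k G * y ^ (a ℕ.∸ k)))))
      ≡⟨ Σ<-cong (suc a) {λ k → ΣF (λ y → e y k)} (λ k _ → begin
          ΣF (λ y → φ y * (binom a k * (moment k G * y ^ (a ℕ.∸ k))))
            ≡⟨ ΣF-cong (λ y → solve 4 (λ f b g z → f :* (b :* (g :* z)) := b :* g :* (f :* z)) refl (φ y) (binom a k) (moment k G) (y ^ (a ℕ.∸ k))) ⟩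
          ΣF (λ y → binom a k * moment k G * (φ y * y ^ (a ℕ.∸ k)))
            ≡⟨ ΣF-*ˡ (binom a k * moment k G) _ ⟨
          binom a k * moment k G * moment (a ℕ.∸ k) φ
            ≡⟨ *-assoc _ _ _ ⟩
          binom a k * (moment k G * moment (a ℕ.∸ k) φ) ∎) ⟩
    Σ< (suc a) (λ k → binom a k * (moment k G * moment (a ℕ.∸ k) φ)) ∎
    where
    e : Carrier → ℕ → Carrier
    e y k = φ y * (binom a k * (moment k G * y ^ (a ℕ.∸ k)))

-- The kernels of the two graphs and their moments

module Kernels {q : ℕ} (F : FiniteField q) (κ : ℕ) (q≡ : q ≡ suc κ) (1<κ : 1 ℕ.< κ)
  (2≢0 : FiniteField._+_ F (FiniteField.1# F) (FiniteField.1# F) ≢ FiniteField.0# F)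
  (ω : FiniteField.Carrier F) (isPrimitive : FiniteField.IsPrimitive F ω)
  (h′ m₂ : ℕ) (κ≡ : κ ≡ 4 ℕ.* suc h′ ℕ.* (m₂ ℕ.* 2)) where

  open Arithmetic
  open FieldSums F
  open Moments F κ q≡ 1<κ 2≢0 ω isPrimitive

  h m L : ℕ
  h = suc h′
  m = m₂ ℕ.* 2
  L = ℕ.pred (4 ℕ.* h)

  instance
    m-nonZero : ℕ.NonZero m
    m-nonZero = ℕ.≢-nonZero λ e → ℕ.n≮0 (subst (0 ℕ.<_) (trans κ≡ (trans (cong (4 ℕ.* h ℕ.*_) e) (ℕ.*-zeroʳ (4 ℕ.* h)))) 0<κ)

  0<m : 0 ℕ.< m
  0<m = ℕ.>-nonZero⁻¹ m

  -- On 4h-th roots of unity this is 4h - 1 at 1 and -1 elsewhere, that is, 4h times the indicator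
  -- of 1, minus 1.
  geometric : Carrier → Carrier
  geometric u = Σ< L (λ i → u ^ suc i)

  geometric-telescope : ∀ u n → u * (1# + Σ< n (λ i → u ^ suc i)) ≡ Σ< n (λ i → u ^ suc i) + u ^ suc n
  geometric-telescope u zero = begin
    u * (1# + Σ< 0 (λ i → u ^ suc i))     ≡⟨ cong (λ z → u * (1# + z)) (Σ<-zero 0 (λ i → u ^ suc i) λ _ ()) ⟩
    u * (1# + 0#)                         ≡⟨ solve 1 (λ u → u :* (con 1 :+ con 0) := con 0 :+ u :* con 1) refl u ⟩
    0# + u ^ 1                            ≡⟨ cong (_+ u ^ 1) (Σ<-zero 0 (λ i → u ^ suc i) λ _ ()) ⟨
    Σ< 0 (λ i → u ^ suc i) + u ^ 1 ∎
  geometric-telescope u (suc n) = begin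
    u * (1# + Σ< (suc n) p)               ≡⟨ cong (λ z → u * (1# + z)) (Σ<-last n p) ⟩
    u * (1# + (Σ< n p + p n))             ≡⟨ solve 3 (λ u s z → u :* (con 1 :+ (s :+ z)) := u :* (con 1 :+ s) :+ u :* z) refl u (Σ< n p) (p n) ⟩
    u * (1# + Σ< n p) + p (suc n)         ≡⟨ cong (_+ p (suc n)) (geometric-telescope u n) ⟩
    Σ< n p + p n + p (suc n)              ≡⟨ cong (_+ p (suc n)) (Σ<-last n p) ⟨
    Σ< (suc n) p + p (suc n) ∎
    where
    p : ℕ → Carrier
    p i = u ^ suc i

  geometric-1 : geometric 1# ≡ ι L
  geometric-1 = go L
    where
    go : ∀ n → Σ< n (λ i → 1# ^ suc i) ≡ ι n
    go zero = Σ<-zero 0 (λ i → 1# ^ suc i) λ _ ()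
    go (suc n) = trans (Σ<-last n (λ i → 1# ^ suc i)) (trans (cong₂ _+_ (go n) (1^ (suc n))) (+-comm _ _))

  geometric-root : ∀ {u} → u ^ (4 ℕ.* h) ≡ 1# → u ≢ 1# → geometric u ≡ - 1#
  geometric-root {u} root u≢1 with (geometric u + 1#) ≟ 0#
  ... | yes e = neg-uniqueˡ _ _ e
  ... | no ne = contradiction (*-cancelˡ (geometric u + 1#) ne (begin
      (geometric u + 1#) * u              ≡⟨ trans (*-comm _ _) (cong (u *_) (+-comm _ _)) ⟩
      u * (1# + geometric u)              ≡⟨ geometric-telescope u L ⟩
      geometric u + u ^ (4 ℕ.* h)         ≡⟨ cong (geometric u +_) root ⟩
      geometric u + 1#                    ≡⟨ *-identityʳ _ ⟨
      (geometric u + 1#) * 1# ∎)) u≢1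

  -- The condition z^m = 1 describes the subgroup S₀ generated by ω^(4h). The second coset is ω^(2h)
  -- S₀ for s = 2h, and ω^(3h) S₀ for s = h, because ω^h ω^(3h) lies in S₀.
  Member : ℕ → Carrier → Set
  Member s z = z ^ m ≡ 1# ⊎ (ω ^ s * z) ^ m ≡ 1#

  member? : ∀ s z → Dec (Member s z)
  member? s z = (z ^ m ≟ 1#) ⊎-dec ((ω ^ s * z) ^ m ≟ 1#)

  -- Up to the additive constant −2 and the value at 0, this is 4h times the indicator function of Member s.
  kernel : ℕ → Carrier → Carrier
  kernel s z = geometric (z ^ m) + geometric ((ω ^ s * z) ^ m)

  -- As m is even, -1 lies in S₀; hence both connection sets are symmetric.
  ^m-neg : ∀ z → (- z) ^ m ≡ z ^ m
  ^m-neg z = -1^even z m₂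

  *-neg-^m : ∀ s z → (ω ^ s * - z) ^ m ≡ (ω ^ s * z) ^ m
  *-neg-^m s z = trans (cong (_^ m) (sym (-‿distribʳ-* (ω ^ s) z))) (^m-neg (ω ^ s * z))

  member-neg : ∀ s z → Member s (- z) → Member s z
  member-neg s z = [ (λ e → inj₁ (trans (sym (^m-neg z)) e)) , (λ e → inj₂ (trans (sym (*-neg-^m s z)) e)) ]′

  member-swap : ∀ s x y → Member s (y - x) → Member s (x - y)
  member-swap s x y = member-neg s (x - y) ∘ subst (Member s) (sym (-‿swap x y))

  kernel-even : ∀ s → Even (kernel s)
  kernel-even s x y = sym (trans (cong (kernel s) (sym (-‿swap x y)))
    (cong₂ (λ u v → geometric u + geometric v) (^m-neg (x - y)) (*-neg-^m s (x - y))))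

  kernel-0 : ∀ s → kernel s 0# ≡ 0#
  kernel-0 s = trans (cong₂ _+_ (zero^ (0^ 0<m)) (zero^ (trans (cong (_^ m) (zeroʳ _)) (0^ 0<m)))) (+-identityˡ _)
    where
    zero^ : ∀ {u} → u ≡ 0# → geometric u ≡ 0#
    zero^ refl = Σ<-zero L (λ i → 0# ^ suc i) λ i _ → 0^ {suc i} ℕ.z<s

  ^m-root : ∀ {z} → z ≢ 0# → (z ^ m) ^ (4 ℕ.* h) ≡ 1#
  ^m-root {z} ne = trans (sym (^-assoc z (4 ℕ.* h) m)) (trans (cong (z ^_) (sym κ≡)) (x^κ ne))

  ω*-nonzero : ∀ s {z} → z ≢ 0# → ω ^ s * z ≢ 0#
  ω*-nonzero s ne = *-nonzero (^-nonzero s ω≢0) ne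

  kernel-outside : ∀ s {z} → z ≢ 0# → ¬ Member s z → kernel s z ≡ - 1# + - 1#
  kernel-outside s ne ¬mem = cong₂ _+_ (geometric-root (^m-root ne) (¬mem ∘ inj₁))
    (geometric-root (^m-root (ω*-nonzero s ne)) (¬mem ∘ inj₂))

  ^m≡1⇒≢0 : ∀ {z} → z ^ m ≡ 1# → z ≢ 0#
  ^m≡1⇒≢0 e refl = 1≢0 (trans (sym e) (0^ 0<m))

  member⇒≢0 : ∀ s {z} → Member s z → z ≢ 0#
  member⇒≢0 s (inj₁ e) = ^m≡1⇒≢0 e
  member⇒≢0 s (inj₂ e) z≡0 = ^m≡1⇒≢0 e (trans (cong (ω ^ s *_) z≡0) (zeroʳ _))

  4h∣⇒^m≡1 : ∀ {a} → 4 ℕ.* h ∣ a → (ω ^ a) ^ m ≡ 1#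
  4h∣⇒^m≡1 (divides b refl) = begin
    (ω ^ (b ℕ.* (4 ℕ.* h))) ^ m     ≡⟨ ^-assoc′ ω (b ℕ.* (4 ℕ.* h)) m ⟨
    ω ^ (b ℕ.* (4 ℕ.* h) ℕ.* m)     ≡⟨ cong (ω ^_) (trans (ℕ.*-assoc b (4 ℕ.* h) m) (cong (b ℕ.*_) (sym κ≡))) ⟩
    ω ^ (b ℕ.* κ)                   ≡⟨ ^-assoc ω b κ ⟩
    (ω ^ κ) ^ b                     ≡⟨ cong (_^ b) ω^κ ⟩
    1# ^ b                          ≡⟨ 1^ b ⟩
    1# ∎

  ^m≡1⇒4h∣ : ∀ {a} → (ω ^ a) ^ m ≡ 1# → 4 ℕ.* h ∣ a
  ^m≡1⇒4h∣ {a} e = *-cancelʳ-∣ m (subst (_∣ a ℕ.* m) κ≡ (ω^≡1⇒κ∣ (a ℕ.* m) (trans (^-assoc′ ω a m) e)))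

  -- The two cosets of `Member s` are then distinct, so that at most one of the two `geometric`
  -- terms takes its exceptional value.
  Twist : ℕ → Set
  Twist s = (ω ^ s) ^ m ≢ 1#

  kernel-inside : ∀ {s} → Twist s → ∀ {z} → Member s z → kernel s z ≡ ι L + - 1#
  kernel-inside {s} twist {z} (inj₁ e) = cong₂ _+_ (trans (cong geometric e) geometric-1)
    (geometric-root (^m-root (ω*-nonzero s (^m≡1⇒≢0 e)))
      λ e′ → twist (trans (sym (trans (^-*-distrib (ω ^ s) z m) (trans (cong ((ω ^ s) ^ m *_) e) (*-identityʳ _)))) e′))
  kernel-inside {s} twist {z} (inj₂ e) = trans (cong₂ _+_
    (geometric-root (^m-root (member⇒≢0 s {z} (inj₂ e)))
      λ e′ → twist (trans (sym (trans (^-*-distrib (ω ^ s) z m) (trans (cong ((ω ^ s) ^ m *_) e′) (*-identityʳ _)))) e))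
    (trans (cong geometric e) geometric-1)) (+-comm _ _)

  ζ : ℕ → Carrier
  ζ s = (ω ^ s) ^ m

  -- The coefficient of z^(m i) is 1 + ζ^i. For s = 2h one has ζ = -1, which removes the odd i; for
  -- s = h one has ζ² = -1, which removes i ≡ 2 mod 4.
  kernel-expand : ∀ s z → kernel s z ≡ Σ< L (λ i → (1# + ζ s ^ suc i) * z ^ (suc i ℕ.* m))
  kernel-expand s z = trans (sym (Σ<-+ L _ _)) (Σ<-cong L {λ i → (z ^ m) ^ suc i + ((ω ^ s * z) ^ m) ^ suc i} λ i _ → begin
    (z ^ m) ^ suc i + ((ω ^ s * z) ^ m) ^ suc i
      ≡⟨ cong (λ w → (z ^ m) ^ suc i + w ^ suc i) (^-*-distrib (ω ^ s) z m) ⟩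
    (z ^ m) ^ suc i + (ζ s * z ^ m) ^ suc i
      ≡⟨ cong ((z ^ m) ^ suc i +_) (^-*-distrib (ζ s) (z ^ m) (suc i)) ⟩
    (z ^ m) ^ suc i + ζ s ^ suc i * (z ^ m) ^ suc i
      ≡⟨ solve 2 (λ a b → a :+ b :* a := (con 1 :+ b) :* a) refl ((z ^ m) ^ suc i) (ζ s ^ suc i) ⟩
    (1# + ζ s ^ suc i) * (z ^ m) ^ suc i
      ≡⟨ cong ((1# + ζ s ^ suc i) *_) (^-assoc z (suc i) m) ⟨
    (1# + ζ s ^ suc i) * z ^ (suc i ℕ.* m) ∎)

  moment-kernel : ∀ s k → moment k (kernel s) ≡ Σ< L (λ i → (1# + ζ s ^ suc i) * powerSum (suc i ℕ.* m ℕ.+ k))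
  moment-kernel s k = begin
    ΣF (λ z → kernel s z * z ^ k)
      ≡⟨ ΣF-cong (λ z → trans (cong (_* z ^ k) (kernel-expand s z)) (trans (*-comm _ _) (Σ<-* L (z ^ k) (term z)))) ⟩
    ΣF (λ z → Σ< L (λ i → z ^ k * term z i))
      ≡⟨ ΣF-Σ< L (λ z i → z ^ k * term z i) ⟩
    Σ< L (λ i → ΣF (λ z → z ^ k * term z i))
      ≡⟨ Σ<-cong L {λ i → ΣF (λ z → z ^ k * term z i)} (λ i _ → trans (ΣF-cong (λ z → trans
           (solve 3 (λ a b c → a :* (b :* c) := b :* (c :* a)) refl (z ^ k) (1# + ζ s ^ suc i) (z ^ (suc i ℕ.* m)))
           (cong ((1# + ζ s ^ suc i) *_) (sym (^-+ z (suc i ℕ.* m) k)))))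
         (sym (ΣF-*ˡ (1# + ζ s ^ suc i) (_^ (suc i ℕ.* m ℕ.+ k))))) ⟩
    Σ< L (λ i → (1# + ζ s ^ suc i) * powerSum (suc i ℕ.* m ℕ.+ k)) ∎
    where
    term : Carrier → ℕ → Carrier
    term z i = (1# + ζ s ^ suc i) * z ^ (suc i ℕ.* m)

  sum-exponent : ∀ {i k} → i ℕ.< L → k ℕ.≤ κ → powerSum (suc i ℕ.* m ℕ.+ k) ≢ 0# → suc i ℕ.* m ℕ.+ k ≡ κ
  sum-exponent {i} {k} i<L k≤κ = powerSum≢0 (subst (suc i ℕ.* m ℕ.+ k ℕ.<_) (cong (κ ℕ.+_) (sym (ℕ.+-identityʳ κ)))
    (ℕ.+-mono-<-≤ (subst (suc i ℕ.* m ℕ.<_) (sym κ≡) (ℕ.*-monoˡ-< m (ℕ.s≤s i<L))) k≤κ))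

  Σ<-nonzero : ∀ n a → Σ< n a ≢ 0# → ∃ λ i → i ℕ.< n × a i ≢ 0#
  Σ<-nonzero zero a ne = contradiction (Σ<-zero 0 a λ _ ()) ne
  Σ<-nonzero (suc n) a ne with a n ≟ 0#
  ... | no an≢0 = n , ℕ.n<1+n n , an≢0
  ... | yes an≡0 with Σ<-nonzero n a (λ e → ne (trans (Σ<-last n a) (trans (cong₂ _+_ e an≡0) (+-identityˡ _))))
  ...   | i , i<n , ai≢0 = i , ℕ.m<n⇒m<1+n i<n , ai≢0

  -- Power sums leave only the monomial whose exponent adds up with k to κ = 4h m, so the moment of
  -- order i m reads the coefficient of index j = 4h - i.
  moment-kernel-support : ∀ s k → k ℕ.≤ κ → moment k (kernel s) ≢ 0# →
    ∃₂ λ i j → 0 ℕ.< i × 0 ℕ.< j × i ℕ.+ j ≡ 4 ℕ.* h × k ≡ i ℕ.* m × 1# + ζ s ^ j ≢ 0#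
  moment-kernel-support s k k≤κ ne = locate (Σ<-nonzero L _ (λ e → ne (trans (moment-kernel s k) e)))
    where
    i+j : ∀ {i} → i ℕ.< L → L ℕ.∸ i ℕ.+ suc i ≡ 4 ℕ.* h
    i+j {i} i<L = trans (ℕ.+-suc (L ℕ.∸ i) i) (cong suc (ℕ.m∸n+n≡m (ℕ.<⇒≤ i<L)))
    k≡ : ∀ {i} → i ℕ.< L → suc i ℕ.* m ℕ.+ k ≡ κ → k ≡ (L ℕ.∸ i) ℕ.* m
    k≡ {i} i<L e = ℕ.+-cancelˡ-≡ (suc i ℕ.* m) _ _ (begin
      suc i ℕ.* m ℕ.+ k                         ≡⟨ e ⟩
      κ                                         ≡⟨ κ≡ ⟩
      4 ℕ.* h ℕ.* m                             ≡⟨ cong (ℕ._* m) (i+j i<L) ⟨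
      (L ℕ.∸ i ℕ.+ suc i) ℕ.* m                 ≡⟨ cong (ℕ._* m) (ℕ.+-comm (L ℕ.∸ i) (suc i)) ⟩
      (suc i ℕ.+ (L ℕ.∸ i)) ℕ.* m               ≡⟨ ℕ.*-distribʳ-+ m (suc i) (L ℕ.∸ i) ⟩
      suc i ℕ.* m ℕ.+ (L ℕ.∸ i) ℕ.* m ∎)
    locate : (∃ λ i → i ℕ.< L × (1# + ζ s ^ suc i) * powerSum (suc i ℕ.* m ℕ.+ k) ≢ 0#) →
      ∃₂ λ i j → 0 ℕ.< i × 0 ℕ.< j × i ℕ.+ j ≡ 4 ℕ.* h × k ≡ i ℕ.* m × 1# + ζ s ^ j ≢ 0#
    locate (i , i<L , t≢0) = L ℕ.∸ i , suc i , ℕ.m<n⇒0<n∸m i<L , ℕ.z<s , i+j i<L ,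
      k≡ i<L (sum-exponent i<L k≤κ (*≢0⇒ʳ t≢0)) , *≢0⇒ˡ t≢0

  moment-kernel-value : ∀ s i j → 0 ℕ.< i → suc i ℕ.+ j ≡ 4 ℕ.* h →
    moment (i ℕ.* m) (kernel s) ≡ (1# + ζ s ^ suc j) * - 1#
  moment-kernel-value s i j 0<i e = begin
    moment (i ℕ.* m) (kernel s)
      ≡⟨ moment-kernel s (i ℕ.* m) ⟩
    Σ< L t
      ≡⟨ Σ<-single L t j j<L others ⟩
    (1# + ζ s ^ suc j) * powerSum (suc j ℕ.* m ℕ.+ i ℕ.* m)
      ≡⟨ cong (λ a → (1# + ζ s ^ suc j) * powerSum a) total ⟩
    (1# + ζ s ^ suc j) * powerSum κ
      ≡⟨ cong ((1# + ζ s ^ suc j) *_) powerSum-κ ⟩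
    (1# + ζ s ^ suc j) * - 1# ∎
    where
    t : ℕ → Carrier
    t j = (1# + ζ s ^ suc j) * powerSum (suc j ℕ.* m ℕ.+ i ℕ.* m)
    i+j≡L : i ℕ.+ j ≡ L
    i+j≡L = cong ℕ.pred e
    j<L : j ℕ.< L
    j<L = subst (j ℕ.<_) i+j≡L (ℕ.m<n+m j 0<i)
    total : suc j ℕ.* m ℕ.+ i ℕ.* m ≡ κ
    total = trans (sym (ℕ.*-distribʳ-+ m (suc j) i)) (trans (cong (ℕ._* m) (trans (cong suc (ℕ.+-comm j i)) e)) (sym κ≡))
    im≤κ : i ℕ.* m ℕ.≤ κ
    im≤κ = subst (i ℕ.* m ℕ.≤_) total (ℕ.m≤n+m _ _)
    others : ∀ l → l ℕ.< L → l ≢ j → t l ≡ 0#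
    others l l<L l≢j with powerSum (suc l ℕ.* m ℕ.+ i ℕ.* m) ≟ 0#
    ... | yes z = trans (cong ((1# + ζ s ^ suc l) *_) z) (zeroʳ _)
    ... | no nz = contradiction (ℕ.suc-injective (ℕ.*-cancelʳ-≡ (suc l) (suc j) m
                    (ℕ.+-cancelʳ-≡ (i ℕ.* m) _ _ (trans (sum-exponent l<L im≤κ nz) (sym total))))) l≢j

  GPaley⇒member : ∀ {z} → GPaleySet ω (2 ℕ.* h) z → Member (2 ℕ.* h) z
  GPaley⇒member (j , refl) = split (even⊎odd j)
    where
    arith : ∀ b h → b ℕ.* 2 ℕ.* (2 ℕ.* h) ≡ b ℕ.* (4 ℕ.* h)
    arith = solve-∀
    split : (∃ λ b → j ≡ b ℕ.* 2 ⊎ j ≡ suc (b ℕ.* 2)) → Member (2 ℕ.* h) (ω ^ (j ℕ.* (2 ℕ.* h)))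
    split (b , inj₁ j≡) = inj₁ (4h∣⇒^m≡1 (divides b (trans (cong (ℕ._* (2 ℕ.* h)) j≡) (arith b h))))
    split (b , inj₂ j≡) = inj₂ (trans (cong (_^ m) (sym (^-+ ω (2 ℕ.* h) (j ℕ.* (2 ℕ.* h)))))
      (4h∣⇒^m≡1 (divides (suc b) (trans (cong (λ j → suc j ℕ.* (2 ℕ.* h)) j≡) (arith (suc b) h)))))

  4h∣⇒2h∣ : ∀ {a} → 4 ℕ.* h ∣ a → 2 ℕ.* h ∣ a
  4h∣⇒2h∣ (divides b a≡) = divides (b ℕ.* 2) (trans a≡ (arith b h))
    where
    arith : ∀ b h → b ℕ.* (4 ℕ.* h) ≡ b ℕ.* 2 ℕ.* (2 ℕ.* h)
    arith = solve-∀

  member⇒GPaley : ∀ {z} → Member (2 ℕ.* h) z → GPaleySet ω (2 ℕ.* h) z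
  member⇒GPaley {z} mem = power (isPrimitive z (member⇒≢0 (2 ℕ.* h) mem))
    where
    multiple : ∀ {a} → 2 ℕ.* h ∣ a → ω ^ a ≡ z → GPaleySet ω (2 ℕ.* h) z
    multiple (divides b a≡) e = b , trans (cong (ω ^_) (sym a≡)) e
    divisible : ∀ {a} → ω ^ a ≡ z → Member (2 ℕ.* h) z → 2 ℕ.* h ∣ a
    divisible {a} e (inj₁ e′) = 4h∣⇒2h∣ (^m≡1⇒4h∣ {a} (trans (cong (_^ m) e) e′))
    divisible {a} e (inj₂ e′) = ∣m+n∣m⇒∣n {2 ℕ.* h} {2 ℕ.* h} (4h∣⇒2h∣ (^m≡1⇒4h∣ {2 ℕ.* h ℕ.+ a}
      (trans (cong (_^ m) (trans (^-+ ω (2 ℕ.* h) a) (cong (ω ^ (2 ℕ.* h) *_) e))) e′))) ∣-refl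
    power : (∃ λ a → ω ^ a ≡ z) → GPaleySet ω (2 ℕ.* h) z
    power (a , e) = multiple (divisible {a} e mem) e

  TGPaley⇒member : ∀ {z} → TGPaleySet ω h z → Member h z
  TGPaley⇒member (inj₁ (j , refl)) = inj₁ (4h∣⇒^m≡1 (divides j refl))
  TGPaley⇒member (inj₂ (j , refl)) = inj₂ (trans (cong (_^ m) (begin
      ω ^ h * (ω ^ (3 ℕ.* h) * ω ^ (j ℕ.* (4 ℕ.* h)))     ≡⟨ cong (ω ^ h *_) (^-+ ω (3 ℕ.* h) (j ℕ.* (4 ℕ.* h))) ⟨
      ω ^ h * ω ^ (3 ℕ.* h ℕ.+ j ℕ.* (4 ℕ.* h))           ≡⟨ ^-+ ω h _ ⟨
      ω ^ (h ℕ.+ (3 ℕ.* h ℕ.+ j ℕ.* (4 ℕ.* h))) ∎))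
    (4h∣⇒^m≡1 (divides (suc j) (arith j h))))
    where
    arith : ∀ j h → h ℕ.+ (3 ℕ.* h ℕ.+ j ℕ.* (4 ℕ.* h)) ≡ suc j ℕ.* (4 ℕ.* h)
    arith = solve-∀

  member⇒TGPaley : ∀ {z} → Member h z → TGPaleySet ω h z
  member⇒TGPaley {z} mem = power (isPrimitive z (member⇒≢0 h mem))
    where
    untwisted : ∀ {a} → 4 ℕ.* h ∣ a → ω ^ a ≡ z → TGPaleySet ω h z
    untwisted (divides b a≡) e = inj₁ (b , trans (cong (ω ^_) (sym a≡)) e)
    twisted : ∀ {a} → 4 ℕ.* h ∣ h ℕ.+ a → ω ^ a ≡ z → TGPaleySet ω h z
    twisted {a} (divides (suc b) h+a≡) e = inj₂ (b , trans (sym (^-+ ω (3 ℕ.* h) (b ℕ.* (4 ℕ.* h))))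
      (trans (cong (ω ^_) (sym (ℕ.+-cancelˡ-≡ h _ _ (trans h+a≡ (arith b h))))) e))
      where
      arith : ∀ b h → suc b ℕ.* (4 ℕ.* h) ≡ h ℕ.+ (3 ℕ.* h ℕ.+ b ℕ.* (4 ℕ.* h))
      arith = solve-∀
    classify : ∀ {a} → ω ^ a ≡ z → Member h z → TGPaleySet ω h z
    classify {a} e (inj₁ e′) = untwisted (^m≡1⇒4h∣ {a} (trans (cong (_^ m) e) e′)) e
    classify {a} e (inj₂ e′) = twisted {a} (^m≡1⇒4h∣ {h ℕ.+ a} (trans (cong (_^ m) (trans (^-+ ω h a) (cong (ω ^ h *_) e))) e′)) e
    power : (∃ λ a → ω ^ a ≡ z) → TGPaleySet ω h z
    power (a , e) = classify {a} e mem

  twist : ∀ {s} → 0 ℕ.< s → s ℕ.< 4 ℕ.* h → Twist s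
  twist {s} 0<s s<4h e = ℕ.<⇒≱ s<4h (∣⇒≤ ⦃ ℕ.>-nonZero 0<s ⦄ (^m≡1⇒4h∣ e))

  twist-2h : Twist (2 ℕ.* h)
  twist-2h = twist ℕ.z<s (ℕ.*-monoˡ-< h {2} {4} (ℕ.s≤s (ℕ.s≤s (ℕ.s≤s ℕ.z≤n))))

  twist-h : Twist h
  twist-h = twist ℕ.z<s (subst (ℕ._< 4 ℕ.* h) (ℕ.*-identityˡ h) (ℕ.*-monoˡ-< h {1} {4} (ℕ.s≤s (ℕ.s≤s ℕ.z≤n))))

  sq-one : ∀ {x} → x * x ≡ 1# → x ≢ 1# → x ≡ - 1#
  sq-one {x} e ne with (x + 1#) ≟ 0#
  ... | yes z = neg-uniqueˡ _ _ z
  ... | no nz = contradiction (*-cancelˡ (x + 1#) nz (begin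
      (x + 1#) * x      ≡⟨ solve 1 (λ x → (x :+ con 1) :* x := x :* x :+ x) refl x ⟩
      x * x + x         ≡⟨ cong (_+ x) e ⟩
      1# + x            ≡⟨ solve 1 (λ x → con 1 :+ x := (x :+ con 1) :* con 1) refl x ⟩
      (x + 1#) * 1# ∎)) ne

  ζ-2h : ζ (2 ℕ.* h) ≡ - 1#
  ζ-2h = sq-one (begin
      ζ (2 ℕ.* h) * ζ (2 ℕ.* h)                   ≡⟨ ^-*-distrib _ _ m ⟨
      (ω ^ (2 ℕ.* h) * ω ^ (2 ℕ.* h)) ^ m         ≡⟨ cong (_^ m) (^-+ ω (2 ℕ.* h) (2 ℕ.* h)) ⟨
      (ω ^ (2 ℕ.* h ℕ.+ 2 ℕ.* h)) ^ m             ≡⟨ 4h∣⇒^m≡1 (divides 1 (arith h)) ⟩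
      1# ∎) twist-2h
    where
    arith : ∀ h → 2 ℕ.* h ℕ.+ 2 ℕ.* h ≡ 1 ℕ.* (4 ℕ.* h)
    arith = solve-∀

  ζ-h : ζ h * ζ h ≡ - 1#
  ζ-h = trans (sym (^-*-distrib _ _ m)) (trans (cong (_^ m) (sym (^-+ ω h h)))
    (trans (cong (λ s → (ω ^ s) ^ m) (cong (h ℕ.+_) (sym (ℕ.+-identityʳ h)))) ζ-2h))

  -- The values on and off the connection set differ by 4h.
  inside≢outside : ι (4 ℕ.* h) ≢ 0# → ι L + - 1# ≢ - 1# + - 1#
  inside≢outside 4h≢0 e = 4h≢0 (trans (+-comm _ _) (trans (cong (_+ 1#) (+-cancelʳ _ _ _ e)) (-‿inverseˡ 1#)))

  module Isomorphism (iso : GraphIso (GPaleyAdj ω (2 ℕ.* h)) (TGPaleyAdj ω h)) where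
    open GraphIso iso using (bij; preserves; reflects) renaming (to to f)

    -- A kernel has one value at 0, one on the connection set and one elsewhere, and these three
    -- values agree for the two graphs.
    kernel-iso : ∀ x y → kernel (2 ℕ.* h) (x - y) ≡ kernel h (f x - f y)
    kernel-iso x y with x ≟ y
    ... | yes refl = trans (cong (kernel (2 ℕ.* h)) (-‿inverseʳ x)) (trans (kernel-0 (2 ℕ.* h))
                       (sym (trans (cong (kernel h) (-‿inverseʳ (f x))) (kernel-0 h))))
    ... | no x≢y with member? (2 ℕ.* h) (x - y)
    ...   | yes mem = trans (kernel-inside {2 ℕ.* h} twist-2h mem) (sym (kernel-inside {h} twist-h (image (preserves y x (inj₁ (member⇒GPaley mem))))))
      where
      image : TGPaleyAdj ω h (f y) (f x) → Member h (f x - f y)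
      image (inj₁ a) = TGPaley⇒member a
      image (inj₂ a) = member-swap h (f x) (f y) (TGPaley⇒member a)
    ...   | no ¬mem = trans (kernel-outside (2 ℕ.* h) (x≢y ∘ -≡0⇒≡ x y) ¬mem)
                        (sym (kernel-outside h (x≢y ∘ f-injective ∘ -≡0⇒≡ (f x) (f y))
                          λ mem → ¬mem (preimage (reflects y x (inj₁ (member⇒TGPaley mem))))))
      where
      f-injective : ∀ {x y} → f x ≡ f y → x ≡ y
      f-injective {x} {y} e = trans (sym (Inverse.strictlyInverseʳ bij x)) (trans (cong (Inverse.from bij) e) (Inverse.strictlyInverseʳ bij y))
      preimage : GPaleyAdj ω (2 ℕ.* h) y x → Member (2 ℕ.* h) (x - y)
      preimage (inj₁ a) = GPaley⇒member a
      preimage (inj₂ a) = member-swap (2 ℕ.* h) x y (GPaley⇒member a)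

-- Isomorphisms as intertwiners of convolutions, and the case h ≥ 3

module Convolution {q : ℕ} (F : FiniteField q) (p : ℕ) (p-prime : Prime p) (h′ d′ u n : ℕ)
  (p≡ : p ≡ suc (2 ℕ.* (suc h′ ℕ.* suc d′))) (1+p≡ : suc p ≡ 4 ℕ.* u) (q≡p^R : q ≡ p ℕ.^ (suc n ℕ.* 2))
  (ω : FiniteField.Carrier F) (isPrimitive : FiniteField.IsPrimitive F ω) where

  open Arithmetic
  open FieldSums F
  open Binomials F p (suc n ℕ.* 2) p-prime q≡p^R

  d : ℕ
  d = suc d′

  opaque
    m₂ κ : ℕ
    m₂ = u ℕ.* d ℕ.* repunit (p ℕ.* p) (suc n)
    κ = 4 ℕ.* suc h′ ℕ.* (m₂ ℕ.* 2)

    m₂≡ : m₂ ≡ u ℕ.* d ℕ.* repunit (p ℕ.* p) (suc n)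
    m₂≡ = refl

    κ≡ : κ ≡ 4 ℕ.* suc h′ ℕ.* (m₂ ℕ.* 2)
    κ≡ = refl

  instance
    p-nonZero : ℕ.NonZero p
    p-nonZero = prime⇒nonZero p-prime

  open Digits p
  open Parameters (suc h′) d u p p≡ 1+p≡ hiding (κ≡)

  m≡ : m₂ ℕ.* 2 ≡ M ℕ.* repunit (p ℕ.* p) (suc n)
  m≡ = trans (cong (ℕ._* 2) m₂≡) (arith (u ℕ.* d) (repunit (p ℕ.* p) (suc n)))
    where
    arith : ∀ a b → a ℕ.* b ℕ.* 2 ≡ 2 ℕ.* a ℕ.* b
    arith = solve-∀

  q≡ : q ≡ suc κ
  q≡ = trans q≡p^R (sym (trans (cong suc κ≡) (trans (cong (λ x → suc (4 ℕ.* suc h′ ℕ.* x)) m≡) (Parameters.κ≡ (suc h′) d u p p≡ 1+p≡ (suc n)))))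

  2<p : 2 ℕ.< p
  2<p = subst (2 ℕ.<_) (sym p≡) (ℕ.s≤s (ℕ.*-monoʳ-≤ 2 (ℕ.s≤s ℕ.z≤n)))

  1<κ : 1 ℕ.< κ
  1<κ = ℕ.s<s⁻¹ (ℕ.<-≤-trans 2<p (subst (p ℕ.≤_) (trans (sym q≡p^R) q≡) (ℕ.m≤m*n p (p ℕ.^ suc (n ℕ.* 2)) ⦃ ℕ.m^n≢0 p (suc (n ℕ.* 2)) ⦄)))

  2≢0 : 1# + 1# ≢ 0#
  2≢0 e = ι-nonzero {2} ℕ.z<s 2<p (trans (cong (1# +_) (+-identityʳ 1#)) e)

  open Moments F κ q≡ 1<κ 2≢0 ω isPrimitive
  open Kernels F κ q≡ 1<κ 2≢0 ω isPrimitive h′ m₂ κ≡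

  2m : ℕ
  2m = 2 ℕ.* m

  2m≡ : 2m ≡ d ℕ.* repunit p (suc n ℕ.* 2)
  2m≡ = trans (cong (2 ℕ.*_) m≡) (2m≡d*repunit (suc n))

  2h*2m≡κ : 2 ℕ.* h ℕ.* 2m ≡ κ
  2h*2m≡κ = trans (arith h m) (sym κ≡)
    where
    arith : ∀ h m → 2 ℕ.* h ℕ.* (2 ℕ.* m) ≡ 4 ℕ.* h ℕ.* m
    arith = solve-∀

  -- Both factors of 2 · 2h lie strictly between 0 and p.
  4h≢0 : ι (4 ℕ.* h) ≢ 0#
  4h≢0 e = *-nonzero (ι-nonzero {2} ℕ.z<s 2<p) (ι-nonzero {2 ℕ.* h} ℕ.z<s
      (subst (2 ℕ.* h ℕ.<_) (sym p≡) (ℕ.s≤s (ℕ.*-monoʳ-≤ 2 (ℕ.m≤m*n h d)))))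
    (trans (sym (ι-* 2 (2 ℕ.* h))) (trans (cong ι (arith h)) e))
    where
    arith : ∀ h → 2 ℕ.* (2 ℕ.* h) ≡ 4 ℕ.* h
    arith = solve-∀

  lucas-p : ∀ {r s} a b → r ℕ.< p → s ℕ.< p → binom (r ℕ.+ a ℕ.* p) (s ℕ.+ b ℕ.* p) ≡ binom r s * binom a b
  lucas-p = lucas frobeniusExponent-p

  G G′ : Carrier → Carrier
  G = kernel (2 ℕ.* h)
  G′ = kernel h

  even^ : ∀ b → (- 1#) ^ (b ℕ.* 2) ≡ 1#
  even^ b = trans (-1^even 1# b) (1^ (b ℕ.* 2))

  odd^ : ∀ b → (- 1#) ^ suc (b ℕ.* 2) ≡ - 1#
  odd^ b = trans (cong (- 1# *_) (even^ b)) (*-identityʳ _)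

  1+odd^ : ∀ b → 1# + (- 1#) ^ suc (b ℕ.* 2) ≡ 0#
  1+odd^ b = trans (cong (1# +_) (odd^ b)) (-‿inverseʳ 1#)

  neg-even : ∀ {z} b → z ≡ - 1# → z ^ (b ℕ.* 2) ≡ 1#
  neg-even b refl = even^ b

  neg-odd : ∀ {z} b → z ≡ - 1# → 1# + z ^ suc (b ℕ.* 2) ≡ 0#
  neg-odd b refl = 1+odd^ b

  4h≡2h*2 : 4 ℕ.* h ≡ 2 ℕ.* h ℕ.* 2
  4h≡2h*2 = arith h
    where
    arith : ∀ h → 4 ℕ.* h ≡ 2 ℕ.* h ℕ.* 2
    arith = solve-∀

  even-complement : ∀ {i b s} → i ℕ.+ b ℕ.* 2 ≡ s ℕ.* 2 → ∃ λ c → i ≡ c ℕ.* 2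
  even-complement {i} {b} {s} e with even⊎odd i
  ... | c , inj₁ i≡ = c , i≡
  ... | c , inj₂ refl = contradiction (trans (cong suc (ℕ.*-distribʳ-+ 2 c b)) e) (odd≢even (c ℕ.+ b) s)

  odd-complement : ∀ {i b s} → i ℕ.+ suc (b ℕ.* 2) ≡ s ℕ.* 2 → ∃ λ c → i ≡ suc (c ℕ.* 2)
  odd-complement {i} {b} {s} e with even⊎odd i
  ... | c , inj₂ i≡ = c , i≡
  ... | c , inj₁ refl = contradiction (trans (cong suc (ℕ.*-distribʳ-+ 2 c b)) (trans (sym (ℕ.+-suc (c ℕ.* 2) (b ℕ.* 2))) e)) (odd≢even (c ℕ.+ b) s)

  G-support : ∀ k → k ℕ.≤ κ → moment k G ≢ 0# → ∃ λ c → 0 ℕ.< c × c ℕ.< 2 ℕ.* h × k ≡ c ℕ.* 2m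
  G-support k k≤κ ne = classify (moment-kernel-support (2 ℕ.* h) k k≤κ ne)
    where
    classify : (∃₂ λ i j → 0 ℕ.< i × 0 ℕ.< j × i ℕ.+ j ≡ 4 ℕ.* h × k ≡ i ℕ.* m × 1# + ζ (2 ℕ.* h) ^ j ≢ 0#) →
      ∃ λ c → 0 ℕ.< c × c ℕ.< 2 ℕ.* h × k ≡ c ℕ.* 2m
    classify (i , j , 0<i , 0<j , i+j≡ , k≡ , nz) = go (even⊎odd j)
      where
      even-i : (∃ λ c → i ≡ c ℕ.* 2) → ∃ λ c → 0 ℕ.< c × c ℕ.< 2 ℕ.* h × k ≡ c ℕ.* 2m
      even-i (zero , i≡) = contradiction (subst (0 ℕ.<_) i≡ 0<i) ℕ.n≮0
      even-i (suc c , i≡) = suc c , ℕ.z<s , ℕ.*-cancelʳ-< 2 (suc c) (2 ℕ.* h) (subst₂ ℕ._<_ i≡ (trans i+j≡ 4h≡2h*2) (ℕ.m<m+n i 0<j)) , trans k≡ (trans (cong (ℕ._* m) i≡) (ℕ.*-assoc (suc c) 2 m))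
      go : (∃ λ b → j ≡ b ℕ.* 2 ⊎ j ≡ suc (b ℕ.* 2)) → ∃ λ c → 0 ℕ.< c × c ℕ.< 2 ℕ.* h × k ≡ c ℕ.* 2m
      go (b , inj₂ j≡) = contradiction (trans (cong (λ j → 1# + ζ (2 ℕ.* h) ^ j) j≡) (neg-odd b ζ-2h)) nz
      go (b , inj₁ j≡) = even-i (even-complement {i} {b} {2 ℕ.* h} (trans (cong (i ℕ.+_) (sym j≡)) (trans i+j≡ 4h≡2h*2)))

  positive-multiple-≥ : ∀ {k y} x → (∃ λ c → 0 ℕ.< c × c ℕ.< y × k ≡ c ℕ.* x) → x ℕ.≤ k
  positive-multiple-≥ x (suc c , _ , _ , refl) = ℕ.m≤m+n x (c ℕ.* x)

  G-support-≥ : ∀ k → k ℕ.≤ κ → moment k G ≢ 0# → 2m ℕ.≤ k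
  G-support-≥ k k≤κ ne = positive-multiple-≥ 2m (G-support k k≤κ ne)

  -- The index 2 is complementary to 4h - 2, which is even, so the coefficient is 1 + 1.
  moment-2m : moment 2m G ≢ 0#
  moment-2m e = *-nonzero 2≢0 (-‿nonzero 1≢0) (trans (sym (trans
      (moment-kernel-value (2 ℕ.* h) 2 (suc (h′ ℕ.* 2 ℕ.* 2)) ℕ.z<s (arith h′))
      (cong (λ z → (1# + z) * - 1#) (neg-even (suc (h′ ℕ.* 2)) ζ-2h)))) e)
    where
    arith : ∀ h′ → 3 ℕ.+ suc (h′ ℕ.* 2 ℕ.* 2) ≡ 4 ℕ.* suc h′
    arith = solve-∀

  -- These are the indices not congruent to 2 modulo 4, split into the two shapes whose digits are
  -- computed separately.
  G′-Index : ℕ → Set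
  G′-Index i = (∃ λ c → i ≡ c ℕ.* 4) ⊎ (∃ λ c → i ≡ suc (c ℕ.* 2))

  G′-support : ∀ k → k ℕ.≤ κ → moment k G′ ≢ 0# → ∃ λ i → 0 ℕ.< i × i ℕ.< 4 ℕ.* h × k ≡ i ℕ.* m × G′-Index i
  G′-support k k≤κ ne = classify (moment-kernel-support h k k≤κ ne)
    where
    classify : (∃₂ λ i j → 0 ℕ.< i × 0 ℕ.< j × i ℕ.+ j ≡ 4 ℕ.* h × k ≡ i ℕ.* m × 1# + ζ h ^ j ≢ 0#) →
      ∃ λ i → 0 ℕ.< i × i ℕ.< 4 ℕ.* h × k ≡ i ℕ.* m × G′-Index i
    classify (i , j , 0<i , 0<j , i+j≡ , k≡ , nz) = i , 0<i , subst (i ℕ.<_) i+j≡ (ℕ.m<m+n i 0<j) , k≡ , index (even⊎odd j)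
      where
      ζ^4b+2 : ∀ b → j ≡ suc (b ℕ.* 2) ℕ.* 2 → 1# + ζ h ^ j ≡ 0#
      ζ^4b+2 b j≡ = trans (cong (λ j → 1# + ζ h ^ j) j≡) (trans (cong (1# +_) (^-assoc (ζ h) (suc (b ℕ.* 2)) 2))
        (neg-odd b (trans (cong (ζ h *_) (*-identityʳ (ζ h))) ζ-h)))
      4∣i : ∀ b → j ≡ b ℕ.* 2 ℕ.* 2 → 4 ∣ i
      4∣i b j≡ = ∣m+n∣m⇒∣n (subst (4 ∣_) (sym (trans (ℕ.+-comm j i) i+j≡)) (m∣m*n h)) (divides b (trans j≡ (ℕ.*-assoc b 2 2)))
      multiple : 4 ∣ i → ∃ λ c → i ≡ c ℕ.* 4
      multiple (divides c i≡) = c , i≡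
      index-even : ∀ b → j ≡ b ℕ.* 2 → (∃ λ c → b ≡ c ℕ.* 2 ⊎ b ≡ suc (c ℕ.* 2)) → G′-Index i
      index-even b j≡ (b′ , inj₂ b≡) = contradiction (ζ^4b+2 b′ (trans j≡ (cong (ℕ._* 2) b≡))) nz
      index-even b j≡ (b′ , inj₁ b≡) = inj₁ (multiple (4∣i b′ (trans j≡ (cong (ℕ._* 2) b≡))))
      index : (∃ λ b → j ≡ b ℕ.* 2 ⊎ j ≡ suc (b ℕ.* 2)) → G′-Index i
      index (b , inj₂ j≡) = inj₂ (odd-complement {i} {b} {2 ℕ.* h} (trans (cong (i ℕ.+_) (sym j≡)) (trans i+j≡ 4h≡2h*2)))
      index (b , inj₁ j≡) = index-even b j≡ (even⊎odd b)

  T-cong : ∀ g {φ ψ : Carrier → Carrier} → (∀ x → φ x ≡ ψ x) → ∀ x → T g φ x ≡ T g ψ x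
  T-cong g e x = ΣF-cong λ y → cong (g (y - x) *_) (e y)

  -- Only transport of the kernels is kept, not adjacency: `compose-frobenius` can then produce a
  -- second such map without returning to graphs.
  record KernelIso : Set where
    field
      π : Carrier ↔ Carrier
    open Inverse π public using () renaming (to to f)
    field
      f-0 : f 0# ≡ 0#
      kernel-f : ∀ x y → G (x - y) ≡ G′ (f x - f y)

    f-injective : ∀ {x y} → f x ≡ f y → x ≡ y
    f-injective {x} {y} e = trans (sym (Inverse.strictlyInverseʳ π x)) (trans (cong (Inverse.from π) e) (Inverse.strictlyInverseʳ π y))

    -- Reindexing the sum by the bijection shows that composition with f intertwines the two
    -- convolutions.
    T-f : ∀ ψ x → T G (ψ ∘ f) x ≡ T G′ ψ (f x)
    T-f ψ x = trans (ΣF-cong λ y → cong (_* ψ (f y)) (kernel-f y x)) (sym (ΣF-perm π (λ y → G′ (y - f x) * ψ y)))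

    δ-f : ∀ x → δ x ≡ δ (f x)
    δ-f x with x ≟ 0#
    ... | yes refl = sym (trans (cong δ f-0) δ-0)
    ... | no ne = sym (δ-≢ λ e → ne (f-injective (trans e (sym f-0))))

  normalise : GraphIso (GPaleyAdj ω (2 ℕ.* h)) (TGPaleyAdj ω h) → KernelIso
  normalise iso = record
    { π = mk↔ₛ′ (λ x → to′ x - c) (λ y → from′ (y + c))
            (λ y → trans (cong (_- c) (Inverse.strictlyInverseˡ bij (y + c))) (+--cancel y c))
            (λ x → trans (cong from′ (-+-cancel (to′ x) c)) (Inverse.strictlyInverseʳ bij x))
    ; f-0 = -‿inverseʳ c
    ; kernel-f = λ x y → trans (kernel-iso x y) (cong G′ (sym (shift (to′ x) (to′ y))))
    }
    where
    open GraphIso iso using (bij)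
    open Isomorphism iso
    to′ = Inverse.to bij
    from′ = Inverse.from bij
    c = to′ 0#
    shift : ∀ a b → (a - c) - (b - c) ≡ a - b
    shift a b = begin
      (a - c) - (b - c)       ≡⟨ cong (a - c +_) (-‿swap b c) ⟩
      (a - c) + (c - b)       ≡⟨ +-assoc (a - c) c (- b) ⟨
      (a - c) + c - b         ≡⟨ cong (_- b) (-+-cancel a c) ⟩
      a - b ∎

  iterate : (Carrier → Carrier) → ℕ → Carrier → Carrier
  iterate g zero = δ
  iterate g (suc t) = T g (iterate g t)

  -- The digits are s d over d, without carries since s d < p, so Lucas' theorem gives a product of
  -- nonzero factors. As 2hd = p - 1, this covers every s ≤ 2h.
  binom-multiple : ∀ s N → 0 ℕ.< s → s ℕ.* d ℕ.< p → binom (s ℕ.* (d ℕ.* repunit p N)) (d ℕ.* repunit p N) ≢ 0#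
  binom-multiple s zero _ _ = subst (λ k → binom (s ℕ.* (d ℕ.* 0)) k ≢ 0#) (sym (ℕ.*-zeroʳ d)) 1≢0
  binom-multiple s@(suc s′) (suc N) 0<s sd<p e = *-nonzero (binom-nonzero {s ℕ.* d} {d} d≤sd sd<p) (binom-multiple s N 0<s sd<p)
    (trans (sym (lucas-p (s ℕ.* (d ℕ.* repunit p N)) (d ℕ.* repunit p N) sd<p (ℕ.≤-<-trans d≤sd sd<p)))
      (trans (cong₂ binom (arith s d (repunit p N) p) (arith′ d (repunit p N) p)) e))
    where
    d≤sd : d ℕ.≤ s ℕ.* d
    d≤sd = ℕ.m≤m+n d (s′ ℕ.* d)
    arith : ∀ s d r p → s ℕ.* d ℕ.+ s ℕ.* (d ℕ.* r) ℕ.* p ≡ s ℕ.* (d ℕ.* (1 ℕ.+ r ℕ.* p))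
    arith = solve-∀
    arith′ : ∀ d r p → d ℕ.+ d ℕ.* r ℕ.* p ≡ d ℕ.* (1 ℕ.+ r ℕ.* p)
    arith′ = solve-∀

  -- Each convolution uses up at least 2m of the order, the smallest order at which `G` has a
  -- nonzero moment.
  GPaley-moment-low : ∀ t → t ℕ.≤ 2 ℕ.* h → ∀ a → a ℕ.< t ℕ.* 2m → moment a (iterate G t) ≡ 0#
  GPaley-moment-low (suc t) t<2h a a< = trans (moment-T (kernel-even (2 ℕ.* h)) (iterate G t) a) (Σ<-zero (suc a) _ λ k k≤a → term k (ℕ.s≤s⁻¹ k≤a))
    where
    a≤κ : a ℕ.≤ κ
    a≤κ = ℕ.≤-trans (ℕ.<⇒≤ a<) (subst (suc t ℕ.* 2m ℕ.≤_) 2h*2m≡κ (ℕ.*-monoˡ-≤ 2m t<2h))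
    term : ∀ k → k ℕ.≤ a → binom a k * (moment k G * moment (a ℕ.∸ k) (iterate G t)) ≡ 0#
    term k k≤a = *-*-zero λ _ nz → GPaley-moment-low t (ℕ.<⇒≤ t<2h) (a ℕ.∸ k)
      (ℕ.+-cancelˡ-< k _ _ (subst (ℕ._< k ℕ.+ t ℕ.* 2m) (sym (ℕ.m+[n∸m]≡n k≤a))
        (ℕ.<-≤-trans a< (ℕ.+-monoˡ-≤ (t ℕ.* 2m) (G-support-≥ k (ℕ.≤-trans k≤a a≤κ) nz)))))

  -- In order t · 2m every step has to use exactly 2m, which leaves a single product of nonzero
  -- factors.
  GPaley-moment-lead : ∀ t → t ℕ.≤ 2 ℕ.* h → moment (t ℕ.* 2m) (iterate G t) ≢ 0#
  GPaley-moment-lead zero _ e = 1≢0 (trans (sym (trans (ΣF-single (λ x → δ x * 1#) 0# (λ y ne → trans (*-identityʳ _) (δ-≢ ne))) (trans (*-identityʳ _) δ-0))) e)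
  GPaley-moment-lead (suc t) t<2h e = *-nonzero binom≢0 (*-nonzero moment-2m (GPaley-moment-lead t (ℕ.<⇒≤ t<2h))) (trans (sym (begin
      moment a (iterate G (suc t))
        ≡⟨ moment-T (kernel-even (2 ℕ.* h)) (iterate G t) a ⟩
      Σ< (suc a) term
        ≡⟨ Σ<-single (suc a) term 2m (ℕ.s≤s (ℕ.m≤m+n 2m (t ℕ.* 2m))) (λ k k≤a k≢2m → others k (ℕ.s≤s⁻¹ k≤a) k≢2m) ⟩
      term 2m
        ≡⟨ cong (λ z → binom a 2m * (moment 2m G * moment z (iterate G t))) (ℕ.m+n∸m≡n 2m (t ℕ.* 2m)) ⟩
      binom a 2m * (moment 2m G * moment (t ℕ.* 2m) (iterate G t)) ∎)) e)
    where
    a = suc t ℕ.* 2m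
    term : ℕ → Carrier
    term k = binom a k * (moment k G * moment (a ℕ.∸ k) (iterate G t))
    a≤κ : a ℕ.≤ κ
    a≤κ = subst (suc t ℕ.* 2m ℕ.≤_) 2h*2m≡κ (ℕ.*-monoˡ-≤ 2m t<2h)
    binom≢0 : binom a 2m ≢ 0#
    binom≢0 = subst (λ k → binom (suc t ℕ.* k) k ≢ 0#) (sym 2m≡) (binom-multiple (suc t) (suc n ℕ.* 2) ℕ.z<s
      (subst (suc t ℕ.* d ℕ.<_) (sym p≡) (ℕ.s≤s (ℕ.≤-trans (ℕ.*-monoˡ-≤ d t<2h) (ℕ.≤-reflexive (ℕ.*-assoc 2 h d))))))
    others : ∀ k → k ℕ.≤ a → k ≢ 2m → term k ≡ 0#
    others k k≤a k≢2m = *-*-zero λ _ nz → GPaley-moment-low t (ℕ.<⇒≤ t<2h) (a ℕ.∸ k)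
      (ℕ.+-cancelˡ-< k _ _ (subst (ℕ._< k ℕ.+ t ℕ.* 2m) (sym (ℕ.m+[n∸m]≡n k≤a))
        (ℕ.+-monoˡ-< (t ℕ.* 2m) (ℕ.≤∧≢⇒< (G-support-≥ k (ℕ.≤-trans k≤a a≤κ) nz) (k≢2m ∘ sym)))))

  binom-digits : ∀ {a k} → binom a k ≢ 0# → k ℕ.% p ℕ.≤ a ℕ.% p × binom (a ℕ./ p) (k ℕ./ p) ≢ 0#
  binom-digits {a} {k} ne = binom≢0⇒≤ (*≢0⇒ˡ split) , *≢0⇒ʳ split
    where
    split : binom (a ℕ.% p) (k ℕ.% p) * binom (a ℕ./ p) (k ℕ./ p) ≢ 0#
    split e = ne (trans (cong₂ binom (m≡m%n+[m/n]*n a p) (m≡m%n+[m/n]*n k p))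
      (trans (lucas-p (a ℕ./ p) (k ℕ./ p) (m%n<n a p) (m%n<n k p)) e))

  -- By Lucas' theorem, applied twice, the two lowest digits of k are bounded by those of a.
  weight-binom : ∀ {a k} → binom a k ≢ 0# → weight a ≡ weight k ℕ.+ weight (a ℕ.∸ k)
  weight-binom {a} {k} ne = weight-∸ (proj₁ low) (binom≢0⇒≤ (proj₂ low)) (proj₁ high) (binom≢0⇒≤ (proj₂ high))
    where
    low = binom-digits {a} {k} ne
    high = binom-digits {a ℕ./ p} {k ℕ./ p} (proj₂ low)

  -- Each step of the twisted convolution raises the digit weight by at least 4d, twice the step of the untwisted one.
  module _ (3≤h : 3 ℕ.≤ h) where

    G′-support-weight : ∀ k → k ℕ.≤ κ → moment k G′ ≢ 0# → 4 ℕ.* d ℕ.≤ weight k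
    G′-support-weight k k≤κ ne = bound (G′-support k k≤κ ne)
      where
      even-bound : ∀ {i} c → 0 ℕ.< i → i ℕ.< 4 ℕ.* h → i ≡ c ℕ.* 4 → 4 ℕ.* d ℕ.≤ weight (i ℕ.* (M ℕ.* repunit (p ℕ.* p) (suc n)))
      even-bound (suc c) 0<i i<4h refl = weight-multiple-even 3≤h (suc c) n ℕ.z<s i<4h
      odd-bound : ∀ {i} c → i ℕ.< 4 ℕ.* h → i ≡ suc (c ℕ.* 2) → 4 ℕ.* d ℕ.≤ weight (i ℕ.* (M ℕ.* repunit (p ℕ.* p) (suc n)))
      odd-bound c i<4h refl = weight-multiple-odd 3≤h c n i<4h
      bound : (∃ λ i → 0 ℕ.< i × i ℕ.< 4 ℕ.* h × k ≡ i ℕ.* m × G′-Index i) → 4 ℕ.* d ℕ.≤ weight k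
      bound (i , 0<i , i<4h , k≡ , index) = subst (λ z → 4 ℕ.* d ℕ.≤ weight z) (sym (trans k≡ (cong (i ℕ.*_) m≡)))
        ([ (λ (c , i≡) → even-bound c 0<i i<4h i≡) , (λ (c , i≡) → odd-bound c i<4h i≡) ]′ index)

    TGPaley-moment-low : ∀ t a → a ℕ.≤ κ → weight a ℕ.< t ℕ.* (4 ℕ.* d) → moment a (iterate G′ t) ≡ 0#
    TGPaley-moment-low (suc t) a a≤κ w< = trans (moment-T (kernel-even h) (iterate G′ t) a) (Σ<-zero (suc a) _ λ k k≤a → term k (ℕ.s≤s⁻¹ k≤a))
      where
      term : ∀ k → k ℕ.≤ a → binom a k * (moment k G′ * moment (a ℕ.∸ k) (iterate G′ t)) ≡ 0#
      term k k≤a = *-*-zero λ nb nz → TGPaley-moment-low t (a ℕ.∸ k) (ℕ.≤-trans (ℕ.m∸n≤m a k) a≤κ)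
        (ℕ.+-cancelˡ-< (weight k) _ _ (subst (ℕ._< weight k ℕ.+ t ℕ.* (4 ℕ.* d)) (weight-binom {a} {k} nb)
          (ℕ.<-≤-trans w< (ℕ.+-monoˡ-≤ (t ℕ.* (4 ℕ.* d)) (G′-support-weight k (ℕ.≤-trans k≤a a≤κ) nz)))))

    no-iso-3≤h : ¬ KernelIso
    no-iso-3≤h iso = GPaley-moment-lead (suc h) (subst (suc h ℕ.≤_) (cong (h ℕ.+_) (sym (ℕ.+-identityʳ h))) (ℕ.m<m+n h ℕ.z<s))
      (trans (moment-cong (suc h ℕ.* 2m) λ x → trans (iterate-f (suc h) x) (moments≡0⇒≡0 (iterate G′ (suc h)) vanish (f x)))
        (trans (ΣF-cong λ x → zeroˡ (x ^ (suc h ℕ.* 2m))) (ΣF-zero)))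
      where
      open KernelIso iso
      ΣF-zero : ΣF (λ _ → 0#) ≡ 0#
      ΣF-zero = ΣF-single (λ _ → 0#) 0# λ _ _ → refl
      iterate-f : ∀ t x → iterate G t x ≡ iterate G′ t (f x)
      iterate-f zero x = δ-f x
      iterate-f (suc t) x = trans (T-cong G (iterate-f t) x) (T-f (iterate G′ t) x)
      vanish : ∀ a → a ℕ.≤ κ → moment a (iterate G′ (suc h)) ≡ 0#
      -- The weight is at most 2p - 1 = 4hd + 1, which is below (h + 1) · 4d.
      vanish a a≤κ = TGPaley-moment-low (suc h) a a≤κ (ℕ.≤-trans (weight-≤ a) (subst (ℕ._≤ suc h ℕ.* (4 ℕ.* d))
        (trans (arith (h ℕ.* d)) (cong₂ ℕ._+_ (sym p≡) (sym p≡)))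
        (subst (2 ℕ.+ 4 ℕ.* (h ℕ.* d) ℕ.≤_) (arith′ h d) (ℕ.+-monoˡ-≤ (4 ℕ.* (h ℕ.* d)) (ℕ.≤-trans (ℕ.m≤m*n 2 d) (ℕ.*-monoˡ-≤ d {2} {4} (ℕ.s≤s (ℕ.s≤s ℕ.z≤n))))))))
        where
        arith : ∀ x → 2 ℕ.+ 4 ℕ.* x ≡ suc (2 ℕ.* x) ℕ.+ suc (2 ℕ.* x)
        arith = solve-∀
        arith′ : ∀ h d → 4 ℕ.* d ℕ.+ 4 ℕ.* (h ℕ.* d) ≡ suc h ℕ.* (4 ℕ.* d)
        arith′ = solve-∀

-- The case h = 1: powers of an isomorphism lie in the code of GPaley

module Code {q : ℕ} (F : FiniteField q) (p : ℕ) (p-prime : Prime p) (d′ u₁ n : ℕ)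
  (p≡ : p ≡ suc (2 ℕ.* (1 ℕ.* suc d′))) (1+p≡ : suc p ≡ 4 ℕ.* suc u₁) (q≡p^R : q ≡ p ℕ.^ (suc n ℕ.* 2))
  (ω : FiniteField.Carrier F) (isPrimitive : FiniteField.IsPrimitive F ω) where

  open Arithmetic
  open FieldSums F
  open Binomials F p (suc n ℕ.* 2) p-prime q≡p^R
  open Convolution F p p-prime 0 d′ (suc u₁) n p≡ 1+p≡ q≡p^R ω isPrimitive
  open Moments F κ q≡ 1<κ 2≢0 ω isPrimitive
  open Kernels F κ q≡ 1<κ 2≢0 ω isPrimitive 0 m₂ κ≡
  open Parameters 1 d (suc u₁) p p≡ 1+p≡ hiding (κ≡)

  p≡2d+1 : p ≡ suc (d ℕ.+ d)
  p≡2d+1 = trans p≡ (arith d)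
    where
    arith : ∀ d → suc (2 ℕ.* (1 ℕ.* d)) ≡ suc (d ℕ.+ d)
    arith = solve-∀

  p≡4u₁+3 : p ≡ 3 ℕ.+ 4 ℕ.* u₁
  p≡4u₁+3 = cong ℕ.pred (trans 1+p≡ (arith u₁))
    where
    arith : ∀ u₁ → 4 ℕ.* suc u₁ ≡ 4 ℕ.+ 4 ℕ.* u₁
    arith = solve-∀

  d≡2u₁+1 : d ≡ 1 ℕ.+ 2 ℕ.* u₁
  d≡2u₁+1 = ℕ.*-cancelˡ-≡ _ _ 2 (ℕ.suc-injective (trans (trans (arith d) (sym p≡2d+1)) (trans p≡4u₁+3 (arith′ u₁))))
    where
    arith : ∀ d → suc (2 ℕ.* d) ≡ suc (d ℕ.+ d)
    arith = solve-∀
    arith′ : ∀ u₁ → 3 ℕ.+ 4 ℕ.* u₁ ≡ suc (2 ℕ.* (1 ℕ.+ 2 ℕ.* u₁))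
    arith′ = solve-∀

  κ≡2m+2m : κ ≡ 2m ℕ.+ 2m
  κ≡2m+2m = trans κ≡ (arith m)
    where
    arith : ∀ m → 4 ℕ.* 1 ℕ.* m ≡ 2 ℕ.* m ℕ.+ 2 ℕ.* m
    arith = solve-∀

  κ≡3m+m : κ ≡ 3 ℕ.* m ℕ.+ m
  κ≡3m+m = trans κ≡ (arith m)
    where
    arith : ∀ m → 4 ℕ.* 1 ℕ.* m ≡ 3 ℕ.* m ℕ.+ m
    arith = solve-∀

  2m<κ : 2m ℕ.< κ
  2m<κ = subst (2m ℕ.<_) (sym κ≡2m+2m) (ℕ.m<m+n 2m (ℕ.*-monoʳ-< 2 0<m))

  -- The digits of M, lowest first, are (3p - 1)/4 and (p - 3)/4; those of 3M are the same in
  -- reverse order.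
  M≡ : M ≡ (2 ℕ.+ 3 ℕ.* u₁) ℕ.+ u₁ ℕ.* p
  M≡ = trans (cong (λ d → 2 ℕ.* (suc u₁ ℕ.* d)) d≡2u₁+1) (trans (arith u₁) (cong (λ p → (2 ℕ.+ 3 ℕ.* u₁) ℕ.+ u₁ ℕ.* p) (sym p≡4u₁+3)))
    where
    arith : ∀ u₁ → 2 ℕ.* (suc u₁ ℕ.* (1 ℕ.+ 2 ℕ.* u₁)) ≡ (2 ℕ.+ 3 ℕ.* u₁) ℕ.+ u₁ ℕ.* (3 ℕ.+ 4 ℕ.* u₁)
    arith = solve-∀

  3M≡ : 3 ℕ.* M ≡ u₁ ℕ.+ (2 ℕ.+ 3 ℕ.* u₁) ℕ.* p
  3M≡ = trans (cong (λ d → 3 ℕ.* (2 ℕ.* (suc u₁ ℕ.* d))) d≡2u₁+1) (trans (arith u₁) (cong (λ p → u₁ ℕ.+ (2 ℕ.+ 3 ℕ.* u₁) ℕ.* p) (sym p≡4u₁+3)))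
    where
    arith : ∀ u₁ → 3 ℕ.* (2 ℕ.* (suc u₁ ℕ.* (1 ℕ.+ 2 ℕ.* u₁))) ≡ u₁ ℕ.+ (2 ℕ.+ 3 ℕ.* u₁) ℕ.* (3 ℕ.+ 4 ℕ.* u₁)
    arith = solve-∀

  u₁<p : u₁ ℕ.< p
  u₁<p = subst (u₁ ℕ.<_) (sym p≡4u₁+3) (ℕ.s≤s (ℕ.≤-trans (ℕ.m≤m+n u₁ (3 ℕ.* u₁)) (ℕ.m≤n+m _ 2)))

  3u₁+2<p : 2 ℕ.+ 3 ℕ.* u₁ ℕ.< p
  3u₁+2<p = subst (2 ℕ.+ 3 ℕ.* u₁ ℕ.<_) (sym p≡4u₁+3) (ℕ.+-monoʳ-≤ 3 (ℕ.*-monoˡ-≤ u₁ {3} {4} (ℕ.s≤s (ℕ.s≤s (ℕ.s≤s ℕ.z≤n)))))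

  u₁<3u₁+2 : u₁ ℕ.< 2 ℕ.+ 3 ℕ.* u₁
  u₁<3u₁+2 = ℕ.s≤s (ℕ.≤-trans (ℕ.m≤m+n u₁ (2 ℕ.* u₁)) (ℕ.n≤1+n _))

  ρ : ℕ → ℕ
  ρ = repunit (p ℕ.* p)

  binom-3Mρ-Mρ : ∀ N → 0 ℕ.< N → binom (3 ℕ.* (M ℕ.* ρ N)) (M ℕ.* ρ N) ≡ 0#
  binom-3Mρ-Mρ (suc N) _ = begin
    binom (3 ℕ.* (M ℕ.* ρ (suc N))) (M ℕ.* ρ (suc N))
      ≡⟨ cong₂ binom (multiple-digits 3 u₁ s₃ N 3M≡) (trans (sym (ℕ.*-identityˡ _)) (multiple-digits 1 r₁ u₁ N (trans (ℕ.*-identityˡ M) M≡))) ⟩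
    binom (u₁ ℕ.+ A ℕ.* p) (r₁ ℕ.+ B ℕ.* p)
      ≡⟨ lucas-p A B u₁<p 3u₁+2<p ⟩
    binom u₁ r₁ * binom A B
      ≡⟨ cong (_* binom A B) (binom-> u₁<3u₁+2) ⟩
    0# * binom A B
      ≡⟨ zeroˡ _ ⟩
    0# ∎
    where
    r₁ = 2 ℕ.+ 3 ℕ.* u₁
    s₃ = 2 ℕ.+ 3 ℕ.* u₁
    A = s₃ ℕ.+ 3 ℕ.* M ℕ.* ρ N ℕ.* p
    B = u₁ ℕ.+ 1 ℕ.* M ℕ.* ρ N ℕ.* p

  -- The exponent j is made so that T′ Y^j is a multiple of the single power Y^k: of the moments m
  -- and 3m of the TGPaley function, the first must be killed by Lucas' theorem and the second must
  -- survive. The bounds on k₀ and k₁ exclude carries in 3m + k, and `cond` supplies a digit of j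
  -- smaller than that of m: the lowest one if k₀ ≤ d, the third one, which k does not touch, if 0 <
  -- n.
  module PowerExponent (k₀ k₁ : ℕ) (k₀≤ : k₀ ℕ.≤ 2 ℕ.+ 3 ℕ.* u₁) (k₁≤ : k₁ ℕ.≤ u₁)
    (cond : k₀ ℕ.≤ d ⊎ 0 ℕ.< n) where

    k j : ℕ
    k = k₀ ℕ.+ k₁ ℕ.* p
    j = 3 ℕ.* m ℕ.+ k

    private
      r₁ s₃ A₃ A₁ : ℕ
      r₁ = 2 ℕ.+ 3 ℕ.* u₁
      s₃ = 2 ℕ.+ 3 ℕ.* u₁
      A₃ = 3 ℕ.* (M ℕ.* ρ n)
      A₁ = M ℕ.* ρ n

    3m≡ : 3 ℕ.* m ≡ u₁ ℕ.+ (s₃ ℕ.+ A₃ ℕ.* p) ℕ.* p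
    3m≡ = trans (cong (3 ℕ.*_) m≡) (trans (multiple-digits 3 u₁ s₃ n 3M≡)
      (cong (λ x → u₁ ℕ.+ (s₃ ℕ.+ x ℕ.* p) ℕ.* p) (ℕ.*-assoc 3 M (ρ n))))

    m≡digits : m ≡ r₁ ℕ.+ (u₁ ℕ.+ A₁ ℕ.* p) ℕ.* p
    m≡digits = trans m≡ (trans (sym (ℕ.*-identityˡ _)) (trans (multiple-digits 1 r₁ u₁ n (trans (ℕ.*-identityˡ M) M≡))
      (cong (λ x → r₁ ℕ.+ (u₁ ℕ.+ x ℕ.* ρ n ℕ.* p) ℕ.* p) (ℕ.*-identityˡ M))))

    j≡ : j ≡ (u₁ ℕ.+ k₀) ℕ.+ ((s₃ ℕ.+ k₁) ℕ.+ A₃ ℕ.* p) ℕ.* p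
    j≡ = trans (cong (ℕ._+ k) 3m≡) (arith u₁ s₃ A₃ p k₀ k₁)
      where
      arith : ∀ u s A p k₀ k₁ → u ℕ.+ (s ℕ.+ A ℕ.* p) ℕ.* p ℕ.+ (k₀ ℕ.+ k₁ ℕ.* p) ≡ (u ℕ.+ k₀) ℕ.+ ((s ℕ.+ k₁) ℕ.+ A ℕ.* p) ℕ.* p
      arith = solve-∀

    low<p : u₁ ℕ.+ k₀ ℕ.< p
    low<p = subst (u₁ ℕ.+ k₀ ℕ.<_) (trans (arith u₁) (sym p≡4u₁+3)) (ℕ.s≤s (ℕ.+-monoʳ-≤ u₁ k₀≤))
      where
      arith : ∀ u₁ → suc (u₁ ℕ.+ (2 ℕ.+ 3 ℕ.* u₁)) ≡ 3 ℕ.+ 4 ℕ.* u₁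
      arith = solve-∀

    high<p : s₃ ℕ.+ k₁ ℕ.< p
    high<p = subst (s₃ ℕ.+ k₁ ℕ.<_) (trans (arith u₁) (sym p≡4u₁+3)) (ℕ.s≤s (ℕ.+-monoʳ-≤ s₃ k₁≤))
      where
      arith : ∀ u₁ → suc (2 ℕ.+ 3 ℕ.* u₁ ℕ.+ u₁) ≡ 3 ℕ.+ 4 ℕ.* u₁
      arith = solve-∀

    k≤m : k ℕ.≤ m
    k≤m = subst (k ℕ.≤_) (sym m≡digits) (ℕ.+-mono-≤ k₀≤ (ℕ.*-monoˡ-≤ p (ℕ.≤-trans k₁≤ (ℕ.m≤m+n u₁ (A₁ ℕ.* p)))))

    j≤κ : j ℕ.≤ κ
    j≤κ = subst (j ℕ.≤_) (sym κ≡3m+m) (ℕ.+-monoʳ-≤ (3 ℕ.* m) k≤m)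

    binom-j-m : binom j m ≡ 0#
    binom-j-m = begin
      binom j m
        ≡⟨ cong₂ binom j≡ m≡digits ⟩
      binom (u₁ ℕ.+ k₀ ℕ.+ (s₃ ℕ.+ k₁ ℕ.+ A₃ ℕ.* p) ℕ.* p) (r₁ ℕ.+ (u₁ ℕ.+ A₁ ℕ.* p) ℕ.* p)
        ≡⟨ lucas-p (s₃ ℕ.+ k₁ ℕ.+ A₃ ℕ.* p) (u₁ ℕ.+ A₁ ℕ.* p) low<p 3u₁+2<p ⟩
      binom (u₁ ℕ.+ k₀) r₁ * binom (s₃ ℕ.+ k₁ ℕ.+ A₃ ℕ.* p) (u₁ ℕ.+ A₁ ℕ.* p)
        ≡⟨ cong (binom (u₁ ℕ.+ k₀) r₁ *_) (lucas-p A₃ A₁ high<p u₁<p) ⟩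
      binom (u₁ ℕ.+ k₀) r₁ * (binom (s₃ ℕ.+ k₁) u₁ * binom A₃ A₁)
        ≡⟨ vanish cond ⟩
      0# ∎
      where
      arith : ∀ u₁ → suc (u₁ ℕ.+ (1 ℕ.+ 2 ℕ.* u₁)) ≡ 2 ℕ.+ 3 ℕ.* u₁
      arith = solve-∀
      vanish : k₀ ℕ.≤ d ⊎ 0 ℕ.< n → binom (u₁ ℕ.+ k₀) r₁ * (binom (s₃ ℕ.+ k₁) u₁ * binom A₃ A₁) ≡ 0#
      -- Here u₁ + d = 3u₁ + 1, one less than the lowest digit of m.
      vanish (inj₁ k₀≤d) = trans (cong (_* (binom (s₃ ℕ.+ k₁) u₁ * binom A₃ A₁))
        (binom-> (subst (u₁ ℕ.+ k₀ ℕ.<_) (arith u₁) (ℕ.s≤s (ℕ.+-monoʳ-≤ u₁ (subst (k₀ ℕ.≤_) d≡2u₁+1 k₀≤d)))))) (zeroˡ _)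
      vanish (inj₂ 0<n) = trans (cong (λ x → binom (u₁ ℕ.+ k₀) r₁ * (binom (s₃ ℕ.+ k₁) u₁ * x)) (binom-3Mρ-Mρ n 0<n))
        (trans (cong (binom (u₁ ℕ.+ k₀) r₁ *_) (zeroʳ _)) (zeroʳ _))

    binom-j-3m : binom j (3 ℕ.* m) ≢ 0#
    binom-j-3m e = *-nonzero (binom-nonzero (ℕ.m≤m+n u₁ k₀) low<p)
      (*-nonzero (binom-nonzero (ℕ.m≤m+n s₃ k₁) high<p) (λ e′ → 1≢0 (trans (sym (binom-diag A₃)) e′)))
      (trans (sym (trans (cong₂ binom j≡ 3m≡) (trans (lucas-p (s₃ ℕ.+ k₁ ℕ.+ A₃ ℕ.* p) (s₃ ℕ.+ A₃ ℕ.* p) low<p u₁<p)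
        (cong (binom (u₁ ℕ.+ k₀) u₁ *_) (lucas-p A₃ A₃ high<p 3u₁+2<p))))) e)

  G-support-2m : ∀ k → k ℕ.≤ κ → moment k G ≢ 0# → k ≡ 2m
  G-support-2m k k≤κ ne = only (G-support k k≤κ ne)
    where
    only : (∃ λ c → 0 ℕ.< c × c ℕ.< 2 × k ≡ c ℕ.* 2m) → k ≡ 2m
    only (1 , _ , _ , e) = trans e (ℕ.*-identityˡ 2m)
    only (suc (suc c) , _ , ℕ.s≤s (ℕ.s≤s ()) , _)

  G′-support-m-3m : ∀ k → k ℕ.≤ κ → moment k G′ ≢ 0# → k ≡ m ⊎ k ≡ 3 ℕ.* m
  G′-support-m-3m k k≤κ ne = only (G′-support k k≤κ ne)
    where
    only : (∃ λ i → 0 ℕ.< i × i ℕ.< 4 × k ≡ i ℕ.* m × G′-Index i) → k ≡ m ⊎ k ≡ 3 ℕ.* m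
    only (1 , _ , _ , e , _) = inj₁ (trans e (ℕ.*-identityˡ m))
    only (2 , _ , _ , _ , inj₁ (suc c , ()))
    only (2 , _ , _ , _ , inj₂ (suc zero , ()))
    only (2 , _ , _ , _ , inj₂ (suc (suc c) , ()))
    only (3 , _ , _ , e , _) = inj₂ e
    only (suc (suc (suc (suc i))) , _ , ℕ.s≤s (ℕ.s≤s (ℕ.s≤s (ℕ.s≤s ()))) , _)

  ζh≢-1 : ζ h ≢ - 1#
  ζh≢-1 e = -1≢1 (trans (sym ζ-h) (trans (cong₂ _*_ e e) -1*-1))

  moment-3m : moment (3 ℕ.* m) G′ ≢ 0#
  moment-3m e = *-nonzero 1+ζ≢0 (-‿nonzero 1≢0) (trans (sym (trans (moment-kernel-value h 3 0 ℕ.z<s refl) (cong (λ z → (1# + z) * - 1#) (*-identityʳ (ζ h))))) e)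
    where
    1+ζ≢0 : 1# + ζ h ≢ 0#
    1+ζ≢0 e = ζh≢-1 (neg-uniqueˡ _ _ (trans (+-comm _ _) e))

  -- The code of GPaley: functions all of whose monomials x^D satisfy D ≼ 2m digitwise, in terms of a = κ − D.
  InCode : (Carrier → Carrier) → Set
  InCode φ = ∀ a → a ℕ.≤ κ → moment a φ ≢ 0# → binom a 2m ≢ 0#

  -- For h = 1 the only nonzero moment of `G` is that of order 2m, so every moment of a convolution
  -- carries the factor `binom a 2m`.
  T-InCode : ∀ φ → InCode (T G φ)
  T-InCode φ a a≤κ ne e = ne (trans (moment-T (kernel-even (2 ℕ.* h)) φ a)
    (Σ<-zero (suc a) _ λ k k≤a → *-*-zero λ nb nz →
      contradiction (trans (cong (binom a) (G-support-2m k (ℕ.≤-trans (ℕ.s≤s⁻¹ k≤a) a≤κ) nz)) e) nb))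

  module _ (k₀ k₁ : ℕ) (k₀≤ : k₀ ℕ.≤ 2 ℕ.+ 3 ℕ.* u₁) (k₁≤ : k₁ ℕ.≤ u₁) (cond : k₀ ℕ.≤ d ⊎ 0 ℕ.< n) where
    open PowerExponent k₀ k₁ k₀≤ k₁≤ cond

    private
      c : Carrier
      c = binom j (3 ℕ.* m) * moment (3 ℕ.* m) G′

    T-G′-power : ∀ y → T G′ (_^ j) y ≡ c * y ^ k
    T-G′-power y = begin
      T G′ (_^ j) y
        ≡⟨ T-power G′ j y ⟩
      Σ< (suc j) t
        ≡⟨ Σ<-single (suc j) t (3 ℕ.* m) (ℕ.s≤s (ℕ.m≤m+n (3 ℕ.* m) k)) (λ i i≤j i≢3m → *-*-zero λ nb nz →
             [ (λ i≡m → contradiction (trans (cong (binom j) i≡m) binom-j-m) nb) , (λ i≡3m → contradiction i≡3m i≢3m) ]′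
               (G′-support-m-3m i (ℕ.≤-trans (ℕ.s≤s⁻¹ i≤j) j≤κ) nz)) ⟩
      binom j (3 ℕ.* m) * (moment (3 ℕ.* m) G′ * y ^ (j ℕ.∸ 3 ℕ.* m))
        ≡⟨ *-assoc _ _ _ ⟨
      c * y ^ (j ℕ.∸ 3 ℕ.* m)
        ≡⟨ cong (λ x → c * y ^ x) (ℕ.m+n∸m≡n (3 ℕ.* m) k) ⟩
      c * y ^ k ∎
      where
      t : ℕ → Carrier
      t i = binom j i * (moment i G′ * y ^ (j ℕ.∸ i))

    power-InCode : ∀ (iso : KernelIso) → InCode (λ x → KernelIso.f iso x ^ k)
    power-InCode iso a a≤κ ne = T-InCode (λ x → f x ^ j) a a≤κ λ e → *-nonzero c≢0 ne (begin
      c * moment a (λ x → f x ^ k)           ≡⟨ ΣF-*ˡ c _ ⟩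
      ΣF (λ x → c * (f x ^ k * x ^ a))       ≡⟨ ΣF-cong (λ x → trans (sym (*-assoc c _ _)) (cong (_* x ^ a) (sym (T-G′-power (f x))))) ⟩
      moment a (λ x → T G′ (_^ j) (f x))     ≡⟨ moment-cong a (λ x → sym (T-f (_^ j) x)) ⟩
      moment a (T G (λ x → f x ^ j))         ≡⟨ e ⟩
      0# ∎)
      where
      open KernelIso iso
      c≢0 : c ≢ 0#
      c≢0 = *-nonzero binom-j-3m moment-3m

-- Degrees of powers and the digits of multiples of a degree

module Degrees {q : ℕ} (F : FiniteField q) (p : ℕ) (p-prime : Prime p) (d′ u₁ n : ℕ)
  (p≡ : p ≡ suc (2 ℕ.* (1 ℕ.* suc d′))) (1+p≡ : suc p ≡ 4 ℕ.* suc u₁) (q≡p^R : q ≡ p ℕ.^ (suc n ℕ.* 2))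
  (ω : FiniteField.Carrier F) (isPrimitive : FiniteField.IsPrimitive F ω) where

  open Arithmetic
  open FieldSums F
  open Binomials F p (suc n ℕ.* 2) p-prime q≡p^R
  open Convolution F p p-prime 0 d′ (suc u₁) n p≡ 1+p≡ q≡p^R ω isPrimitive
  open Moments F κ q≡ 1<κ 2≢0 ω isPrimitive
  open Kernels F κ q≡ 1<κ 2≢0 ω isPrimitive 0 m₂ κ≡
  open Parameters 1 d (suc u₁) p p≡ 1+p≡ hiding (κ≡)
  open Code F p p-prime d′ u₁ n p≡ 1+p≡ q≡p^R ω isPrimitive

  _^^_ : (Carrier → Carrier) → ℕ → Carrier → Carrier
  (φ ^^ k) x = φ x ^ k

  _·_ : (Carrier → Carrier) → (Carrier → Carrier) → Carrier → Carrier
  (φ · ψ) x = φ x * ψ x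

  -- Interpolating φ makes the moments of a product bilinear in those of the factors. The orders a +
  -- (κ - k) above κ are where reduction modulo x^q - x is hidden.
  moment-product : ∀ φ ψ a → moment a (φ · ψ) ≡
    moment 0 φ * moment a ψ - Σ< (suc κ) (λ k → binom κ k * (moment k φ * ((- 1#) ^ (κ ℕ.∸ k) * moment (a ℕ.+ (κ ℕ.∸ k)) ψ)))
  moment-product φ ψ a = begin
    ΣF (λ x → φ x * ψ x * x ^ a)
      ≡⟨ +--cancel _ _ ⟨
    ΣF (λ x → φ x * ψ x * x ^ a) + S - S
      ≡⟨ cong (_- S) (cong (ΣF (λ x → φ x * ψ x * x ^ a) +_) S≡) ⟩
    ΣF (λ x → φ x * ψ x * x ^ a) + ΣF (λ x → P x * (ψ x * x ^ a)) - S
      ≡⟨ cong (_- S) (ΣF-+ (λ x → φ x * ψ x * x ^ a) (λ x → P x * (ψ x * x ^ a))) ⟨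
    ΣF (λ x → φ x * ψ x * x ^ a + P x * (ψ x * x ^ a)) - S
      ≡⟨ cong (_- S) (ΣF-cong λ x → trans (solve 4 (λ f g z p → f :* g :* z :+ p :* (g :* z) := (f :+ p) :* (g :* z)) refl (φ x) (ψ x) (x ^ a) (P x))
           (cong (_* (ψ x * x ^ a)) (trans (cong (_+ P x) (interpolation φ x)) (-+-cancel (moment 0 φ) (P x))))) ⟩
    ΣF (λ x → moment 0 φ * (ψ x * x ^ a)) - S
      ≡⟨ cong (_- S) (ΣF-*ˡ (moment 0 φ) (λ x → ψ x * x ^ a)) ⟨
    moment 0 φ * moment a ψ - S ∎
    where
    P : Carrier → Carrier
    P x = Σ< (suc κ) (λ k → binom κ k * (moment k φ * (- x) ^ (κ ℕ.∸ k)))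
    t : ℕ → Carrier
    t k = binom κ k * (moment k φ * ((- 1#) ^ (κ ℕ.∸ k) * moment (a ℕ.+ (κ ℕ.∸ k)) ψ))
    S : Carrier
    S = Σ< (suc κ) t
    e : Carrier → ℕ → Carrier
    e x k = (ψ x * x ^ a) * (binom κ k * (moment k φ * (- x) ^ (κ ℕ.∸ k)))
    neg^ : ∀ x i → (- x) ^ i ≡ (- 1#) ^ i * x ^ i
    neg^ x i = trans (cong (_^ i) (sym (-1*x≈-x x))) (^-*-distrib (- 1#) x i)
    S≡ : S ≡ ΣF (λ x → P x * (ψ x * x ^ a))
    S≡ = sym (begin
      ΣF (λ x → P x * (ψ x * x ^ a))
        ≡⟨ ΣF-cong (λ x → trans (*-comm _ _) (Σ<-* (suc κ) (ψ x * x ^ a) _)) ⟩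
      ΣF (λ x → Σ< (suc κ) (e x))
        ≡⟨ ΣF-Σ< (suc κ) e ⟩
      Σ< (suc κ) (λ k → ΣF (λ x → e x k))
        ≡⟨ Σ<-cong (suc κ) {λ k → ΣF (λ x → e x k)} (λ k _ → trans (ΣF-cong (λ x → point x k))
             (trans (sym (ΣF-*ˡ (binom κ k * (moment k φ * (- 1#) ^ (κ ℕ.∸ k))) _))
               (solve 4 (λ b m s w → b :* (m :* s) :* w := b :* (m :* (s :* w))) refl (binom κ k) (moment k φ) ((- 1#) ^ (κ ℕ.∸ k)) (moment (a ℕ.+ (κ ℕ.∸ k)) ψ)))) ⟩
      Σ< (suc κ) t ∎)
      where
      point : ∀ x k → e x k ≡ binom κ k * (moment k φ * (- 1#) ^ (κ ℕ.∸ k)) * (ψ x * x ^ (a ℕ.+ (κ ℕ.∸ k)))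
      point x k = begin
        (ψ x * x ^ a) * (binom κ k * (moment k φ * (- x) ^ i))
          ≡⟨ cong (λ z → (ψ x * x ^ a) * (binom κ k * (moment k φ * z))) (neg^ x i) ⟩
        (ψ x * x ^ a) * (binom κ k * (moment k φ * ((- 1#) ^ i * x ^ i)))
          ≡⟨ solve 6 (λ g z b m s w → (g :* z) :* (b :* (m :* (s :* w))) := b :* (m :* s) :* (g :* (z :* w))) refl (ψ x) (x ^ a) (binom κ k) (moment k φ) ((- 1#) ^ i) (x ^ i) ⟩
        binom κ k * (moment k φ * (- 1#) ^ i) * (ψ x * (x ^ a * x ^ i))
          ≡⟨ cong (λ z → binom κ k * (moment k φ * (- 1#) ^ i) * (ψ x * z)) (^-+ x a i) ⟨
        binom κ k * (moment k φ * (- 1#) ^ i) * (ψ x * x ^ (a ℕ.+ i)) ∎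
        where
        i = κ ℕ.∸ k

  -- φ is given by a polynomial of degree exactly D; the moment of order κ − D is, up to sign, its leading coefficient.
  record Degree (φ : Carrier → Carrier) (D : ℕ) : Set where
    field
      D≤κ : D ℕ.≤ κ
      above : ∀ a → a ℕ.+ D ℕ.< κ → moment a φ ≡ 0#
      leading : ∀ a → a ℕ.+ D ≡ κ → moment a φ ≢ 0#
  open Degree

  degree-cong : ∀ {φ ψ : Carrier → Carrier} {D} → (∀ x → φ x ≡ ψ x) → Degree φ D → Degree ψ D
  degree-cong e deg = record
    { D≤κ = D≤κ deg
    ; above = λ a lt → trans (sym (moment-cong a e)) (above deg a lt)
    ; leading = λ a eq z → leading deg a eq (trans (moment-cong a e) z)
    }

  -- D < κ makes `moment 0 φ` vanish, and D + E ≤ κ prevents wrapping around. Only k = κ - D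
  -- contributes to the leading moment, with a nonzero binomial coefficient.
  degree-* : ∀ {φ ψ D E} → Degree φ D → Degree ψ E → D ℕ.< κ → D ℕ.+ E ℕ.≤ κ → Degree (φ · ψ) (D ℕ.+ E)
  degree-* {φ} {ψ} {D} {E} degφ degψ D<κ D+E≤κ = record { D≤κ = D+E≤κ ; above = above′ ; leading = leading′ }
    where
    t : ℕ → ℕ → Carrier
    t a k = binom κ k * (moment k φ * ((- 1#) ^ (κ ℕ.∸ k) * moment (a ℕ.+ (κ ℕ.∸ k)) ψ))
    reduce : ∀ a → moment a (φ · ψ) ≡ - Σ< (suc κ) (t a)
    reduce a = trans (moment-product φ ψ a) (trans (cong (_- Σ< (suc κ) (t a)) (trans (cong (_* moment a ψ) (above degφ 0 D<κ)) (zeroˡ _))) (+-identityˡ _))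
    k₀ : ℕ
    k₀ = κ ℕ.∸ D
    k₀+D : k₀ ℕ.+ D ≡ κ
    k₀+D = ℕ.m∸n+n≡m (ℕ.<⇒≤ D<κ)
    off : ∀ a → a ℕ.+ (D ℕ.+ E) ℕ.≤ κ → ∀ k → k ℕ.≤ κ → k ≢ k₀ → t a k ≡ 0#
    off a le k k≤κ k≢k₀ = *-*-zero λ _ nz → trans (cong ((- 1#) ^ (κ ℕ.∸ k) *_) (above degψ (a ℕ.+ (κ ℕ.∸ k)) (small nz))) (zeroʳ _)
      where
      small : moment k φ ≢ 0# → a ℕ.+ (κ ℕ.∸ k) ℕ.+ E ℕ.< κ
      small nz = ℕ.<-≤-trans (subst (ℕ._< a ℕ.+ (D ℕ.+ E)) (sym (ℕ.+-assoc a (κ ℕ.∸ k) E)) (ℕ.+-monoʳ-< a (ℕ.+-monoˡ-< E κ∸k<D))) le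
        where
        κ≤k+D : κ ℕ.≤ k ℕ.+ D
        κ≤k+D = ℕ.≮⇒≥ λ lt → nz (above degφ k lt)
        κ<k+D : κ ℕ.< k ℕ.+ D
        κ<k+D = ℕ.≤∧≢⇒< κ≤k+D λ e → k≢k₀ (ℕ.+-cancelʳ-≡ D k k₀ (trans (sym e) (sym k₀+D)))
        κ∸k<D : κ ℕ.∸ k ℕ.< D
        κ∸k<D = ℕ.+-cancelˡ-< k _ _ (subst (ℕ._< k ℕ.+ D) (sym (ℕ.m+[n∸m]≡n k≤κ)) κ<k+D)
    single : ∀ a → a ℕ.+ (D ℕ.+ E) ℕ.≤ κ → Σ< (suc κ) (t a) ≡ t a k₀
    single a le = Σ<-single (suc κ) (t a) k₀ (ℕ.s≤s (ℕ.m∸n≤m κ D)) (λ k k≤κ → off a le k (ℕ.s≤s⁻¹ k≤κ))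
    a+κ∸k₀+E : ∀ a → a ℕ.+ (κ ℕ.∸ k₀) ℕ.+ E ≡ a ℕ.+ (D ℕ.+ E)
    a+κ∸k₀+E a = trans (ℕ.+-assoc a (κ ℕ.∸ k₀) E) (cong (λ z → a ℕ.+ (z ℕ.+ E)) (ℕ.m∸[m∸n]≡n (ℕ.<⇒≤ D<κ)))
    above′ : ∀ a → a ℕ.+ (D ℕ.+ E) ℕ.< κ → moment a (φ · ψ) ≡ 0#
    above′ a lt = trans (reduce a) (trans (cong -_ (trans (single a (ℕ.<⇒≤ lt)) (*-*-zero λ _ _ →
      trans (cong ((- 1#) ^ (κ ℕ.∸ k₀) *_) (above degψ (a ℕ.+ (κ ℕ.∸ k₀)) (subst (ℕ._< κ) (sym (a+κ∸k₀+E a)) lt))) (zeroʳ _)))) -0#≈0#)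
    leading′ : ∀ a → a ℕ.+ (D ℕ.+ E) ≡ κ → moment a (φ · ψ) ≢ 0#
    leading′ a eq z = -‿nonzero (*-nonzero (binom-κ-nonzero q≡ k₀ (ℕ.m∸n≤m κ D)) (*-nonzero (leading degφ k₀ k₀+D)
        (*-nonzero (^-nonzero (κ ℕ.∸ k₀) (-‿nonzero 1≢0)) (leading degψ (a ℕ.+ (κ ℕ.∸ k₀)) (trans (a+κ∸k₀+E a) eq)))))
      (trans (sym (trans (reduce a) (cong -_ (single a (ℕ.≤-reflexive eq))))) z)

  first-nonzero : ∀ (a : ℕ → Carrier) N → (∀ i → i ℕ.< N → a i ≡ 0#) ⊎ ∃ λ j → j ℕ.< N × a j ≢ 0# × (∀ i → i ℕ.< j → a i ≡ 0#)
  first-nonzero a zero = inj₁ λ _ ()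
  first-nonzero a (suc N) = step (first-nonzero a N) (a N ≟ 0#)
    where
    step : (∀ i → i ℕ.< N → a i ≡ 0#) ⊎ (∃ λ j → j ℕ.< N × a j ≢ 0# × (∀ i → i ℕ.< j → a i ≡ 0#)) → Dec (a N ≡ 0#) →
      (∀ i → i ℕ.< suc N → a i ≡ 0#) ⊎ ∃ λ j → j ℕ.< suc N × a j ≢ 0# × (∀ i → i ℕ.< j → a i ≡ 0#)
    step (inj₂ (j , j<N , nz , z)) _ = inj₂ (j , ℕ.m<n⇒m<1+n j<N , nz , z)
    step (inj₁ z) (no nz) = inj₂ (N , ℕ.n<1+n N , nz , z)
    step (inj₁ z) (yes e) = inj₁ λ i i<1+N → [ z i , (λ { refl → e }) ]′ (ℕ.m<1+n⇒m<n∨m≡n i<1+N)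

  degree-exists : ∀ φ {x} → φ x ≢ 0# → ∃ (Degree φ)
  degree-exists φ {x} φx≢0 = [ (λ z → contradiction (moments≡0⇒≡0 φ (λ a a≤κ → z a (ℕ.s≤s a≤κ)) x) φx≢0) , found ]′
      (first-nonzero (λ a → moment a φ) (suc κ))
    where
    found : (∃ λ j → j ℕ.< suc κ × moment j φ ≢ 0# × (∀ i → i ℕ.< j → moment i φ ≡ 0#)) → ∃ (Degree φ)
    found (j , j<1+κ , nz , z) = κ ℕ.∸ j , record
      { D≤κ = ℕ.m∸n≤m κ j
      ; above = λ a lt → z a (ℕ.+-cancelʳ-< (κ ℕ.∸ j) a j (subst (a ℕ.+ (κ ℕ.∸ j) ℕ.<_) (sym j+κ∸j) lt))
      ; leading = λ a eq e → nz (trans (cong (λ i → moment i φ) (ℕ.+-cancelʳ-≡ (κ ℕ.∸ j) j a (trans j+κ∸j (sym eq)))) e)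
      }
      where
      j+κ∸j : j ℕ.+ (κ ℕ.∸ j) ≡ κ
      j+κ∸j = ℕ.m+[n∸m]≡n (ℕ.s≤s⁻¹ j<1+κ)

  code-degree-binom : ∀ {φ D} → InCode φ → Degree φ D → ∀ a → a ℕ.+ D ≡ κ → binom a 2m ≢ 0#
  code-degree-binom {D = D} code deg a eq = code a (subst (a ℕ.≤_) eq (ℕ.m≤m+n a D)) (leading deg a eq)

  -- The order complementary to D is at least 2m because its binomial coefficient over 2m is
  -- nonzero, and κ = 4m.
  code-degree-≤ : ∀ {φ D} → InCode φ → Degree φ D → D ℕ.≤ 2m
  code-degree-≤ {D = D} code deg = ℕ.+-cancelˡ-≤ 2m D 2m (subst (2m ℕ.+ D ℕ.≤_) κ≡2m+2m (subst (2m ℕ.+ D ℕ.≤_) a+D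
      (ℕ.+-monoˡ-≤ D (binom≢0⇒≤ (code-degree-binom code deg (κ ℕ.∸ D) a+D)))))
    where
    a+D : κ ℕ.∸ D ℕ.+ D ≡ κ
    a+D = ℕ.m∸n+n≡m (D≤κ deg)

  -- Membership in the code bounds the degree of each power by 2m, so that one more factor stays
  -- within κ = 4m and degrees add. Both facts are used in turn along the induction.
  degree-^ : ∀ {φ D} K → (∀ k → 0 ℕ.< k → k ℕ.≤ K → InCode (φ ^^ k)) → Degree φ D →
    ∀ k → k ℕ.< K → Degree (φ ^^ suc k) (suc k ℕ.* D)
  degree-^ {φ} {D} K code deg zero _ = subst (Degree (φ ^^ 1)) (sym (ℕ.*-identityˡ D)) (degree-cong (λ x → sym (*-identityʳ (φ x))) deg)
  degree-^ {φ} {D} K code deg (suc k) k<K = degree-* deg IH (ℕ.≤-<-trans D≤2m 2m<κ)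
      (subst (D ℕ.+ suc k ℕ.* D ℕ.≤_) (sym κ≡2m+2m) (ℕ.+-mono-≤ D≤2m (code-degree-≤ (code (suc k) ℕ.z<s (ℕ.<⇒≤ k<K)) IH)))
    where
    IH : Degree (φ ^^ suc k) (suc k ℕ.* D)
    IH = degree-^ K code deg k (ℕ.<⇒≤ k<K)
    D≤2m : D ℕ.≤ 2m
    D≤2m = code-degree-≤ (code 1 ℕ.z<s (ℕ.≤-trans ℕ.z<s k<K)) (degree-cong (λ x → sym (*-identityʳ (φ x))) deg)

  -- k D ≼ 2m digitwise for 1 ≤ k ≤ K, where 2m has N digits, all equal to d = (p − 1)/2
  Multiples : ℕ → ℕ → ℕ → Set
  Multiples K N D = ∀ k → 0 ℕ.< k → k ℕ.≤ K → k ℕ.* D ℕ.≤ d ℕ.* repunit p N ×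
    (∀ a → a ℕ.+ k ℕ.* D ≡ (d ℕ.+ d) ℕ.* repunit p N → binom a (d ℕ.* repunit p N) ≢ 0#)

  d<p : d ℕ.< p
  d<p = subst (d ℕ.<_) (sym p≡2d+1) (ℕ.s≤s (ℕ.m≤m+n d d))

  2d<p : d ℕ.+ d ℕ.< p
  2d<p = subst (d ℕ.+ d ℕ.<_) (sym p≡2d+1) (ℕ.n<1+n _)

  d*repunit-suc : ∀ N → d ℕ.* repunit p (suc N) ≡ d ℕ.+ (d ℕ.* repunit p N) ℕ.* p
  d*repunit-suc N = arith d (repunit p N) p
    where
    arith : ∀ d r p → d ℕ.* (1 ℕ.+ r ℕ.* p) ≡ d ℕ.+ d ℕ.* r ℕ.* p
    arith = solve-∀

  high-digits-≤ : ∀ {r X Y s} → s ℕ.< p → r ℕ.+ X ℕ.* p ℕ.≤ s ℕ.+ Y ℕ.* p → X ℕ.≤ Y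
  high-digits-≤ {r} {X} {Y} {s} s<p le = ℕ.s≤s⁻¹ (ℕ.*-cancelʳ-< p X (suc Y) (ℕ.≤-<-trans (ℕ.≤-trans (ℕ.m≤n+m (X ℕ.* p) r) le) (ℕ.+-monoˡ-< (Y ℕ.* p) s<p)))

  -- If d < k r ≤ 2d, then k r is the lowest digit of k D, and the complementary order has lowest
  -- digit 2d - k r < d, so its binomial coefficient vanishes by Lucas' theorem.
  low-digit-contradiction : ∀ {K} N r D′ → 0 ℕ.< r → r ℕ.< p → (∀ k → d ℕ.< k ℕ.* r → k ℕ.* r ℕ.≤ d ℕ.+ d → 0 ℕ.< k → k ℕ.≤ K → ¬ Multiples K (suc N) (r ℕ.+ D′ ℕ.* p))
  low-digit-contradiction {K} N r D′ 0<r r<p k d<kr kr≤2d 0<k k≤K mult = proj₂ (mult k 0<k k≤K) a a+kD≡ (begin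
      binom a (d ℕ.* repunit p (suc N))
        ≡⟨ cong (binom a) (d*repunit-suc N) ⟩
      binom a (d ℕ.+ (d ℕ.* repunit p N) ℕ.* p)
        ≡⟨ lucas-p A (d ℕ.* repunit p N) (ℕ.<-trans low<d d<p) d<p ⟩
      binom (d ℕ.+ d ℕ.∸ k ℕ.* r) d * binom A (d ℕ.* repunit p N)
        ≡⟨ cong (_* binom A (d ℕ.* repunit p N)) (binom-> low<d) ⟩
      0# * binom A (d ℕ.* repunit p N)
        ≡⟨ zeroˡ _ ⟩
      0# ∎)
    where
    ρN A a : ℕ
    ρN = repunit p N
    A = (d ℕ.+ d) ℕ.* ρN ℕ.∸ k ℕ.* D′
    a = (d ℕ.+ d ℕ.∸ k ℕ.* r) ℕ.+ A ℕ.* p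
    low<d : d ℕ.+ d ℕ.∸ k ℕ.* r ℕ.< d
    low<d = ℕ.+-cancelˡ-< (k ℕ.* r) _ d (subst (ℕ._< k ℕ.* r ℕ.+ d) (sym (ℕ.m+[n∸m]≡n kr≤2d)) (ℕ.+-monoˡ-< d d<kr))
    kD≡ : k ℕ.* (r ℕ.+ D′ ℕ.* p) ≡ k ℕ.* r ℕ.+ (k ℕ.* D′) ℕ.* p
    kD≡ = arith k r D′ p
      where
      arith : ∀ k r D p → k ℕ.* (r ℕ.+ D ℕ.* p) ≡ k ℕ.* r ℕ.+ (k ℕ.* D) ℕ.* p
      arith = solve-∀
    kD′≤ : k ℕ.* D′ ℕ.≤ (d ℕ.+ d) ℕ.* ρN
    kD′≤ = ℕ.≤-trans (high-digits-≤ {k ℕ.* r} {k ℕ.* D′} {d ℕ.* ρN} {d} d<p (subst₂ ℕ._≤_ kD≡ (d*repunit-suc N) (proj₁ (mult k 0<k k≤K)))) (ℕ.*-monoˡ-≤ ρN (ℕ.m≤m+n d d))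
    a+kD≡ : a ℕ.+ k ℕ.* (r ℕ.+ D′ ℕ.* p) ≡ (d ℕ.+ d) ℕ.* repunit p (suc N)
    a+kD≡ = begin
      a ℕ.+ k ℕ.* (r ℕ.+ D′ ℕ.* p)
        ≡⟨ cong (a ℕ.+_) kD≡ ⟩
      (d ℕ.+ d ℕ.∸ k ℕ.* r) ℕ.+ A ℕ.* p ℕ.+ (k ℕ.* r ℕ.+ (k ℕ.* D′) ℕ.* p)
        ≡⟨ arith (d ℕ.+ d ℕ.∸ k ℕ.* r) A p (k ℕ.* r) (k ℕ.* D′) ⟩
      ((d ℕ.+ d ℕ.∸ k ℕ.* r) ℕ.+ k ℕ.* r) ℕ.+ (A ℕ.+ k ℕ.* D′) ℕ.* p
        ≡⟨ cong₂ (λ x y → x ℕ.+ y ℕ.* p) (ℕ.m∸n+n≡m kr≤2d) (ℕ.m∸n+n≡m kD′≤) ⟩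
      (d ℕ.+ d) ℕ.+ ((d ℕ.+ d) ℕ.* ρN) ℕ.* p
        ≡⟨ arith′ (d ℕ.+ d) ρN p ⟩
      (d ℕ.+ d) ℕ.* (1 ℕ.+ ρN ℕ.* p) ∎
      where
      arith : ∀ x A p y z → x ℕ.+ A ℕ.* p ℕ.+ (y ℕ.+ z ℕ.* p) ≡ (x ℕ.+ y) ℕ.+ (A ℕ.+ z) ℕ.* p
      arith = solve-∀
      arith′ : ∀ x r p → x ℕ.+ x ℕ.* r ℕ.* p ≡ x ℕ.* (1 ℕ.+ r ℕ.* p)
      arith′ = solve-∀

  module _ (r′ : ℕ) where
    private
      r = suc r′

    -- The least k with k r > d; the overshoot is at most r, so that k r ≤ 2d as well.
    digit-multiplier : ℕ
    digit-multiplier = suc (d ℕ./ r)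

    digit-multiplier-lower : d ℕ.< digit-multiplier ℕ.* r
    digit-multiplier-lower = subst (ℕ._< digit-multiplier ℕ.* r) (sym (m≡m%n+[m/n]*n d r)) (ℕ.+-monoˡ-< (d ℕ./ r ℕ.* r) (m%n<n d r))

    digit-multiplier-upper : r ℕ.≤ d ℕ.+ d → digit-multiplier ℕ.* r ℕ.≤ d ℕ.+ d
    digit-multiplier-upper r≤2d = [ (λ r≤d → ℕ.+-mono-≤ r≤d (m/n*n≤m d r)) , (λ d<r → subst (ℕ._≤ d ℕ.+ d)
        (sym (trans (cong (λ z → suc z ℕ.* r) (m<n⇒m/n≡0 d<r)) (ℕ.*-identityˡ r))) r≤2d) ]′ (ℕ.≤-<-connex r d)

  -- The multiplier ⌊d/r⌋ + 1 is at most d for r > 1, whereas the digit 1 needs d + 1.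
  low-digit : ∀ {K} N r D′ → 0 ℕ.< r → r ℕ.< p → suc d ℕ.≤ K ⊎ (1 ℕ.< r × d ℕ.≤ K) → ¬ Multiples K (suc N) (r ℕ.+ D′ ℕ.* p)
  low-digit {K} N r@(suc r′) D′ 0<r r<p bound = low-digit-contradiction N r D′ 0<r r<p (digit-multiplier r′)
      (digit-multiplier-lower r′) (digit-multiplier-upper r′ (ℕ.s≤s⁻¹ (subst (r ℕ.<_) p≡2d+1 r<p))) ℕ.z<s (small bound)
    where
    small : suc d ℕ.≤ K ⊎ (1 ℕ.< r × d ℕ.≤ K) → digit-multiplier r′ ℕ.≤ K
    small (inj₁ d<K) = ℕ.≤-trans (ℕ.s≤s (m/n≤m d r)) d<K
    small (inj₂ (1<r , d≤K)) = ℕ.≤-trans (m/n<m d r 1<r) d≤K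

  -- Zero low digits are stripped one at a time, the conditions being inherited by D / p, until
  -- `low-digit` refutes the first nonzero one.
  no-multiples : ∀ N D → 0 ℕ.< D → ¬ Multiples (suc d) N D
  no-multiples zero D 0<D mult = ℕ.<⇒≱ 0<D (subst₂ ℕ._≤_ (ℕ.*-identityˡ D) (ℕ.*-zeroʳ d) (proj₁ (mult 1 ℕ.z<s (ℕ.s≤s ℕ.z≤n))))
  no-multiples (suc N) D 0<D mult = split (D ℕ.% p) (D ℕ./ p) (m%n<n D p) (m≡m%n+[m/n]*n D p)
    where
    split : ∀ r D′ → r ℕ.< p → D ≡ r ℕ.+ D′ ℕ.* p → ⊥
    split r@(suc _) D′ r<p D≡ = low-digit N r D′ ℕ.z<s r<p (inj₁ ℕ.≤-refl) (subst (Multiples (suc d) (suc N)) D≡ mult)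
    split zero D′ _ D≡ = no-multiples N D′ (ℕ.n≢0⇒n>0 λ D′≡0 → ℕ.<⇒≢ 0<D (sym (trans D≡ (cong (ℕ._* p) D′≡0)))) λ k 0<k k≤ →
      high-digits-≤ {0} {k ℕ.* D′} {d ℕ.* repunit p N} {d} d<p (subst₂ ℕ._≤_ (kD≡ k) (d*repunit-suc N) (proj₁ (mult k 0<k k≤))) ,
      -- A lowest digit 0 of k D has complement 2d, which contributes the factor `binom (d + d) d`
      -- only.
      λ a a+ → λ e → proj₂ (mult k 0<k k≤) ((d ℕ.+ d) ℕ.+ a ℕ.* p) (total k a a+) (begin
        binom (d ℕ.+ d ℕ.+ a ℕ.* p) (d ℕ.* repunit p (suc N))           ≡⟨ cong (binom (d ℕ.+ d ℕ.+ a ℕ.* p)) (d*repunit-suc N) ⟩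
        binom (d ℕ.+ d ℕ.+ a ℕ.* p) (d ℕ.+ (d ℕ.* repunit p N) ℕ.* p)   ≡⟨ lucas-p a (d ℕ.* repunit p N) 2d<p d<p ⟩
        binom (d ℕ.+ d) d * binom a (d ℕ.* repunit p N)                 ≡⟨ cong (binom (d ℕ.+ d) d *_) e ⟩
        binom (d ℕ.+ d) d * 0#                                          ≡⟨ zeroʳ _ ⟩
        0# ∎)
      where
      kD≡ : ∀ k → k ℕ.* D ≡ (k ℕ.* D′) ℕ.* p
      kD≡ k = trans (cong (k ℕ.*_) D≡) (sym (ℕ.*-assoc k D′ p))
      total : ∀ k a → a ℕ.+ k ℕ.* D′ ≡ (d ℕ.+ d) ℕ.* repunit p N → (d ℕ.+ d) ℕ.+ a ℕ.* p ℕ.+ k ℕ.* D ≡ (d ℕ.+ d) ℕ.* repunit p (suc N)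
      total k a a+ = begin
        (d ℕ.+ d) ℕ.+ a ℕ.* p ℕ.+ k ℕ.* D                   ≡⟨ cong ((d ℕ.+ d) ℕ.+ a ℕ.* p ℕ.+_) (kD≡ k) ⟩
        (d ℕ.+ d) ℕ.+ a ℕ.* p ℕ.+ (k ℕ.* D′) ℕ.* p          ≡⟨ arith (d ℕ.+ d) a p (k ℕ.* D′) ⟩
        (d ℕ.+ d) ℕ.+ (a ℕ.+ k ℕ.* D′) ℕ.* p                ≡⟨ cong (λ x → (d ℕ.+ d) ℕ.+ x ℕ.* p) a+ ⟩
        (d ℕ.+ d) ℕ.+ (d ℕ.+ d) ℕ.* repunit p N ℕ.* p       ≡⟨ arith′ (d ℕ.+ d) (repunit p N) p ⟩
        (d ℕ.+ d) ℕ.* repunit p (suc N) ∎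
        where
        arith : ∀ x a p y → x ℕ.+ a ℕ.* p ℕ.+ y ℕ.* p ≡ x ℕ.+ (a ℕ.+ y) ℕ.* p
        arith = solve-∀
        arith′ : ∀ x r p → x ℕ.+ x ℕ.* r ℕ.* p ≡ x ℕ.* (1 ℕ.+ r ℕ.* p)
        arith′ = solve-∀

  code-multiples : ∀ {φ D} K → (∀ k → 0 ℕ.< k → k ℕ.≤ K → InCode (φ ^^ k)) → Degree φ D → Multiples K (suc n ℕ.* 2) D
  code-multiples {φ} {D} K code deg (suc k′) 0<k k≤K = subst (k ℕ.* D ℕ.≤_) 2m≡ (code-degree-≤ (code k 0<k k≤K) deg-k) ,
      λ a a+ → subst (λ z → binom a z ≢ 0#) 2m≡ (code-degree-binom (code k 0<k k≤K) deg-k a (trans a+ κ≡rep))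
    where
    k = suc k′
    deg-k = degree-^ K code deg k′ k≤K
    κ≡rep : (d ℕ.+ d) ℕ.* repunit p (suc n ℕ.* 2) ≡ κ
    κ≡rep = trans (ℕ.*-distribʳ-+ (repunit p (suc n ℕ.* 2)) d d) (trans (sym (cong₂ ℕ._+_ 2m≡ 2m≡)) (sym κ≡2m+2m))

-- Excluding isomorphisms for h = 1

module IndexTwo {q : ℕ} (F : FiniteField q) (p : ℕ) (p-prime : Prime p) (d′ u₁ n : ℕ)
  (p≡ : p ≡ suc (2 ℕ.* (1 ℕ.* suc d′))) (1+p≡ : suc p ≡ 4 ℕ.* suc u₁) (q≡p^R : q ≡ p ℕ.^ (suc n ℕ.* 2))
  (ω : FiniteField.Carrier F) (isPrimitive : FiniteField.IsPrimitive F ω) where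

  open Arithmetic
  open FieldSums F
  open Binomials F p (suc n ℕ.* 2) p-prime q≡p^R
  open Convolution F p p-prime 0 d′ (suc u₁) n p≡ 1+p≡ q≡p^R ω isPrimitive
  open Moments F κ q≡ 1<κ 2≢0 ω isPrimitive
  open Kernels F κ q≡ 1<κ 2≢0 ω isPrimitive 0 m₂ κ≡
  open Parameters 1 d (suc u₁) p p≡ 1+p≡ hiding (κ≡)
  open Code F p p-prime d′ u₁ n p≡ 1+p≡ q≡p^R ω isPrimitive
  open Degrees F p p-prime d′ u₁ n p≡ 1+p≡ q≡p^R ω isPrimitive
  open Degree

  by-zero : ∀ {A : Set} x → (x ≡ 0# → A) → (x ≢ 0# → A) → A
  by-zero x z nz with x ≟ 0#
  ... | yes e = z e
  ... | no ne = nz ne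

  -- As f permutes the field and fixes 0, this is the sum of all field elements. It excludes degree
  -- 0 and removes the constant term in `degree-1⇒linear`.
  moment-κ-f : ∀ (iso : KernelIso) → moment κ (KernelIso.f iso) ≡ 0#
  moment-κ-f iso = begin
    ΣF (λ x → f x * x ^ κ)     ≡⟨ ΣF-cong (λ x → by-zero x (at-0 x) (λ ne → trans (cong (f x *_) (x^κ ne)) (*-identityʳ (f x)))) ⟩
    ΣF f                       ≡⟨ ΣF-perm π (λ x → x) ⟨
    ΣF (λ x → x)               ≡⟨ ΣF-cong (λ x → sym (*-identityʳ x)) ⟩
    powerSum 1                 ≡⟨ powerSum-∤ (λ κ∣1 → ℕ.<⇒≱ 1<κ (∣⇒≤ κ∣1)) ⟩
    0# ∎
    where
    open KernelIso iso
    at-0 : ∀ x → x ≡ 0# → f x * x ^ κ ≡ f x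
    at-0 x e = trans (cong (_* x ^ κ) fx≡0) (trans (zeroˡ _) (sym fx≡0))
      where
      fx≡0 : f x ≡ 0#
      fx≡0 = trans (cong f e) f-0

  iso-degree : ∀ (iso : KernelIso) → ∃ λ D → 0 ℕ.< D × Degree (KernelIso.f iso) D
  iso-degree iso = positive (degree-exists f {1#} (λ e → 1≢0 (f-injective (trans e (sym f-0)))))
    where
    open KernelIso iso
    positive : ∃ (Degree f) → ∃ λ D → 0 ℕ.< D × Degree f D
    positive (zero , deg) = contradiction (moment-κ-f iso) (leading deg κ (ℕ.+-identityʳ κ))
    positive (suc D , deg) = suc D , ℕ.z<s , deg

  iso-power-InCode : ∀ (iso : KernelIso) k → k ℕ.≤ 2 ℕ.+ 3 ℕ.* u₁ → k ℕ.≤ d ⊎ 0 ℕ.< n → InCode (KernelIso.f iso ^^ k)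
  iso-power-InCode iso k k≤ cond = subst (λ i → InCode (KernelIso.f iso ^^ i)) (ℕ.+-identityʳ k) (power-InCode k 0 k≤ ℕ.z≤n cond iso)

  1+d≤3u₁+2 : suc d ℕ.≤ 2 ℕ.+ 3 ℕ.* u₁
  1+d≤3u₁+2 = subst (ℕ._≤ 2 ℕ.+ 3 ℕ.* u₁) (cong suc (sym d≡2u₁+1)) (ℕ.+-monoʳ-≤ 2 (ℕ.*-monoˡ-≤ u₁ {2} {3} (ℕ.s≤s (ℕ.s≤s ℕ.z≤n))))

  -- For R ≥ 4 the power d + 1 is available too, which excludes the digit 1 along with all others.
  no-iso-0<n : 0 ℕ.< n → ¬ KernelIso
  no-iso-0<n 0<n iso = contra (iso-degree iso)
    where
    open KernelIso iso
    contra : ¬ (∃ λ D → 0 ℕ.< D × Degree f D)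
    contra (D , 0<D , deg) = no-multiples (suc n ℕ.* 2) D 0<D (code-multiples (suc d)
      (λ k _ k≤ → iso-power-InCode iso k (ℕ.≤-trans k≤ 1+d≤3u₁+2) (inj₂ 0<n)) deg)

  member-f : ∀ (iso : KernelIso) {x} → Member (2 ℕ.* h) x → Member h (KernelIso.f iso x)
  member-f iso {x} mem = decide (member? h (f x))
    where
    open KernelIso iso
    -0≡ : ∀ y → y - 0# ≡ y
    -0≡ y = trans (cong (y +_) -0#≈0#) (+-identityʳ y)
    G-f : G x ≡ G′ (f x)
    G-f = trans (cong G (sym (-0≡ x))) (trans (kernel-f x 0#) (cong G′ (trans (cong (λ z → f x - z) f-0) (-0≡ (f x)))))
    fx≢0 : f x ≢ 0#
    fx≢0 e = member⇒≢0 (2 ℕ.* h) mem (f-injective (trans e (sym f-0)))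
    decide : Dec (Member h (f x)) → Member h (f x)
    decide (yes mem′) = mem′
    decide (no ¬mem) = contradiction (trans (sym (kernel-inside {2 ℕ.* h} twist-2h mem)) (trans G-f (kernel-outside h fx≢0 ¬mem))) (inside≢outside 4h≢0)

  -- Both 1 and ω² are adjacent to 0 in GPaley, and their images c and c ω² have opposite m-th
  -- powers t and -t. On the TGPaley set m-th powers are 1 or the inverse of s, where s² = -1, and
  -- no two of these are opposite.
  no-linear-iso : ∀ (iso : KernelIso) c → ¬ (∀ x → KernelIso.f iso x ≡ c * x)
  no-linear-iso iso c linear = cases (member-c) (member-cω²)
    where
    open KernelIso iso
    t s : Carrier
    t = c ^ m
    s = ζ h
    member-c : t ≡ 1# ⊎ s * t ≡ 1#
    member-c = [ (λ e → inj₁ (trans (cong (_^ m) (sym f1)) e)) , (λ e → inj₂ (trans (sym (^-*-distrib (ω ^ h) c m)) (trans (cong (λ y → (ω ^ h * y) ^ m) (sym f1)) e))) ]′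
        (member-f iso {1#} (inj₁ (1^ m)))
      where
      f1 : f 1# ≡ c
      f1 = trans (linear 1#) (*-identityʳ c)
    ω² : Carrier
    ω² = ω ^ (2 ℕ.* h)
    fω²^m : f ω² ^ m ≡ - t
    fω²^m = begin
      f ω² ^ m            ≡⟨ cong (_^ m) (linear ω²) ⟩
      (c * ω²) ^ m        ≡⟨ ^-*-distrib c ω² m ⟩
      t * ζ (2 ℕ.* h)     ≡⟨ cong (t *_) ζ-2h ⟩
      t * - 1#            ≡⟨ *-comm t (- 1#) ⟩
      - 1# * t            ≡⟨ -1*x≈-x t ⟩
      - t ∎
    member-cω² : - t ≡ 1# ⊎ s * - t ≡ 1#
    member-cω² = [ (λ e → inj₁ (trans (sym fω²^m) e)) , (λ e → inj₂ (trans (cong (s *_) (sym fω²^m)) (trans (sym (^-*-distrib (ω ^ h) (f ω²) m)) e))) ]′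
      (member-f iso {ω²} (inj₂ (trans (^-*-distrib ω² ω² m) (trans (cong₂ _*_ ζ-2h ζ-2h) -1*-1))))
    s≢-1 : s ≢ - 1#
    s≢-1 = ζh≢-1
    cases : t ≡ 1# ⊎ s * t ≡ 1# → - t ≡ 1# ⊎ s * - t ≡ 1# → ⊥
    cases (inj₁ t≡1) (inj₁ -t≡1) = -1≢1 (trans (cong -_ (sym t≡1)) -t≡1)
    cases (inj₁ t≡1) (inj₂ s-t≡1) = s≢-1 (trans (sym (-‿involutive s)) (cong -_ (trans (cong -_ (sym (trans (cong (s *_) t≡1) (*-identityʳ s)))) (trans (-‿distribʳ-* s t) s-t≡1))))
    cases (inj₂ st≡1) (inj₁ -t≡1) = s≢-1 (trans (sym (-‿involutive s)) (cong -_ (trans (sym (*-identityʳ (- s))) (trans (cong (λ z → - s * z) (sym -t≡1)) (trans (neg-neg s t) st≡1)))))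
      where
      neg-neg : ∀ s t → - s * - t ≡ s * t
      neg-neg s t = trans (-‿*ˡ s (- t)) (trans (cong -_ (sym (-‿distribʳ-* s t))) (-‿involutive (s * t)))
    cases (inj₂ st≡1) (inj₂ s-t≡1) = -1≢1 (trans (cong -_ (sym st≡1)) (trans (-‿distribʳ-* s t) s-t≡1))

  degree-1⇒linear : ∀ (iso : KernelIso) → Degree (KernelIso.f iso) 1 → ∃ λ c → ∀ x → KernelIso.f iso x ≡ c * x
  degree-1⇒linear iso deg = binom κ κ₁ * moment κ₁ f , λ x → begin
      f x
        ≡⟨ interpolation f x ⟩
      moment 0 f - Σ< (suc κ) (t x)
        ≡⟨ cong₂ _-_ (above deg 0 1<κ) (Σ<-single (suc κ) (t x) κ₁ (ℕ.s≤s (ℕ.m∸n≤m κ 1)) (λ k k≤κ → others x k (ℕ.s≤s⁻¹ k≤κ))) ⟩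
      0# - t x κ₁
        ≡⟨ +-identityˡ _ ⟩
      - (binom κ κ₁ * (moment κ₁ f * (- x) ^ (κ ℕ.∸ κ₁)))
        ≡⟨ cong (λ i → - (binom κ κ₁ * (moment κ₁ f * (- x) ^ i))) (ℕ.m∸[m∸n]≡n (ℕ.<⇒≤ 1<κ)) ⟩
      - (binom κ κ₁ * (moment κ₁ f * (- x * 1#)))
        ≡⟨ cong -_ (solve 3 (λ b m x → b :* (m :* (x :* con 1)) := b :* m :* x) refl (binom κ κ₁) (moment κ₁ f) (- x)) ⟩
      - (binom κ κ₁ * moment κ₁ f * - x)
        ≡⟨ cong -_ (sym (-‿distribʳ-* (binom κ κ₁ * moment κ₁ f) x)) ⟩
      - - (binom κ κ₁ * moment κ₁ f * x)
        ≡⟨ -‿involutive _ ⟩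
      binom κ κ₁ * moment κ₁ f * x ∎
    where
    open KernelIso iso
    κ₁ : ℕ
    κ₁ = κ ℕ.∸ 1
    κ₁+1 : κ₁ ℕ.+ 1 ≡ κ
    κ₁+1 = ℕ.m∸n+n≡m (ℕ.<⇒≤ 1<κ)
    t : Carrier → ℕ → Carrier
    t x k = binom κ k * (moment k f * (- x) ^ (κ ℕ.∸ k))
    others : ∀ x k → k ℕ.≤ κ → k ≢ κ₁ → t x k ≡ 0#
    others x k k≤κ k≢κ₁ = trans (cong (λ y → binom κ k * (y * (- x) ^ (κ ℕ.∸ k))) moment≡0) (trans (cong (binom κ k *_) (zeroˡ _)) (zeroʳ _))
      where
      moment≡0 : moment k f ≡ 0#
      moment≡0 = [ (λ k<κ → above deg k (ℕ.≤∧≢⇒< (subst (ℕ._≤ κ) (ℕ.+-comm 1 k) k<κ) (λ e → k≢κ₁ (ℕ.+-cancelʳ-≡ 1 k κ₁ (trans e (sym κ₁+1)))))) ,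
                   (λ k≡κ → trans (cong (λ k → moment k f) k≡κ) (moment-κ-f iso)) ]′ (ℕ.m≤n⇒m<n∨m≡n k≤κ)

  -- A degree below p is a single digit, and the powers up to d force that digit to be 1.
  no-iso-low-degree : ∀ (iso : KernelIso) {D} → Degree (KernelIso.f iso) D → 0 ℕ.< D → ¬ (D ℕ.< p)
  no-iso-low-degree iso {D} deg 0<D D<p = [ large , (λ 1≡D → linear (degree-1⇒linear iso (subst (Degree f) (sym 1≡D) deg))) ]′ (ℕ.m≤n⇒m<n∨m≡n 0<D)
    where
    open KernelIso iso
    linear : ¬ (∃ λ c → ∀ x → f x ≡ c * x)
    linear (c , e) = no-linear-iso iso c e
    large : ¬ (1 ℕ.< D)
    large 1<D = low-digit {d} (suc (n ℕ.* 2)) D 0 0<D D<p (inj₂ (1<D , ℕ.≤-refl)) (subst (Multiples d (suc n ℕ.* 2)) (sym (ℕ.+-identityʳ D))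
      (code-multiples d (λ k _ k≤d → iso-power-InCode iso k (ℕ.≤-trans k≤d (ℕ.≤-trans (ℕ.n≤1+n d) 1+d≤3u₁+2)) (inj₁ k≤d)) deg))

  0<p : 0 ℕ.< p
  0<p = ℕ.<-trans ℕ.z<s 2<p

  ^p-- : ∀ x y → (x - y) ^ p ≡ x ^ p - y ^ p
  ^p-- x y = begin
    (x - y) ^ p                      ≡⟨ +--cancel _ (y ^ p) ⟨
    (x - y) ^ p + y ^ p - y ^ p      ≡⟨ cong (_- y ^ p) (frobenius-additive 0<p frobeniusExponent-p (x - y) y) ⟨
    (x - y + y) ^ p - y ^ p          ≡⟨ cong (λ z → z ^ p - y ^ p) (-+-cancel x y) ⟩
    x ^ p - y ^ p ∎

  ^-comm : ∀ x i j → (x ^ i) ^ j ≡ (x ^ j) ^ i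
  ^-comm x i j = trans (sym (^-assoc′ x i j)) (^-assoc x i j)

  member⇒square : ∀ {z} → Member (2 ℕ.* h) z → z ^ m * z ^ m ≡ 1#
  member⇒square {z} (inj₁ e) = trans (cong₂ _*_ e e) (*-identityʳ 1#)
  member⇒square {z} (inj₂ e) = trans (cong₂ _*_ z^m z^m) -1*-1
    where
    z^m : z ^ m ≡ - 1#
    z^m = trans (sym (-‿involutive (z ^ m))) (cong -_ (trans (sym (-1*x≈-x (z ^ m))) (trans (cong (_* z ^ m) (sym ζ-2h)) (trans (sym (^-*-distrib (ω ^ (2 ℕ.* h)) z m)) e))))

  square⇒member : ∀ {z} → z ^ m * z ^ m ≡ 1# → Member (2 ℕ.* h) z
  square⇒member {z} e = decide (z ^ m ≟ 1#)
    where
    decide : Dec (z ^ m ≡ 1#) → Member (2 ℕ.* h) z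
    decide (yes z^m≡1) = inj₁ z^m≡1
    decide (no z^m≢1) = inj₂ (trans (^-*-distrib (ω ^ (2 ℕ.* h)) z m) (trans (cong₂ _*_ ζ-2h (sq-one e z^m≢1)) -1*-1))

  involution-^p : ∀ {w} → w * w ≡ 1# → w ^ p ≡ w
  involution-^p {w} e = begin
    w ^ p                ≡⟨ cong (w ^_) p≡2d+1 ⟩
    w * w ^ (d ℕ.+ d)    ≡⟨ cong (w *_) (^-+ w d d) ⟩
    w * (w ^ d * w ^ d)  ≡⟨ cong (w *_) (^-*-distrib w w d) ⟨
    w * (w * w) ^ d      ≡⟨ cong (w *_) (trans (cong (_^ d) e) (1^ d)) ⟩
    w * 1#               ≡⟨ *-identityʳ w ⟩
    w ∎

  square-^p : ∀ {z} → z ≢ 0# → (z ^ p) ^ m * (z ^ p) ^ m ≡ z ^ m * z ^ m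
  square-^p {z} ne = begin
    (z ^ p) ^ m * (z ^ p) ^ m     ≡⟨ cong₂ _*_ (^-comm z p m) (^-comm z p m) ⟩
    (z ^ m) ^ p * (z ^ m) ^ p     ≡⟨ ^-*-distrib (z ^ m) (z ^ m) p ⟨
    (z ^ m * z ^ m) ^ p           ≡⟨ involution-^p w²≡1 ⟩
    z ^ m * z ^ m ∎
    where
    w²≡1 : z ^ m * z ^ m * (z ^ m * z ^ m) ≡ 1#
    w²≡1 = trans (solve 1 (λ a → a :* a :* (a :* a) := a :* (a :* (a :* (a :* con 1)))) refl (z ^ m)) (^m-root ne)

  -- For h = 1 the GPaley set consists of the nonzero squares, given by z^(2m) = 1, and the p-th
  -- power fixes z^(2m) = ±1.
  G-^p : ∀ z → G (z ^ p) ≡ G z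
  G-^p z = by-zero z (λ e → cong G (trans (cong (_^ p) e) (trans (0^ 0<p) (sym e)))) λ ne → decide ne (member? (2 ℕ.* h) z)
    where
    decide : z ≢ 0# → Dec (Member (2 ℕ.* h) z) → G (z ^ p) ≡ G z
    decide ne (yes mem) = trans (kernel-inside {2 ℕ.* h} twist-2h (square⇒member (trans (square-^p ne) (member⇒square mem))))
      (sym (kernel-inside {2 ℕ.* h} twist-2h mem))
    decide ne (no ¬mem) = trans (kernel-outside (2 ℕ.* h) (^-nonzero p ne) (λ mem → ¬mem (square⇒member (trans (sym (square-^p ne)) (member⇒square mem)))))
      (sym (kernel-outside (2 ℕ.* h) ne ¬mem))

  module QuadraticExtension (n≡0 : n ≡ 0) where

    ^p^p : ∀ x → (x ^ p) ^ p ≡ x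
    ^p^p x = trans (sym (^-assoc x p p)) (trans (cong (x ^_) p²≡1+κ) (by-zero x (λ e → trans (cong (_* x ^ κ) e) (trans (zeroˡ _) (sym e))) (λ ne → trans (cong (x *_) (x^κ ne)) (*-identityʳ x))))
      where
      p²≡1+κ : p ℕ.* p ≡ suc κ
      p²≡1+κ = trans (cong (p ℕ.*_) (sym (ℕ.*-identityʳ p))) (trans (cong (λ n → p ℕ.^ (suc n ℕ.* 2)) (sym n≡0)) (trans (sym q≡p^R) q≡))

    compose-frobenius : KernelIso → KernelIso
    compose-frobenius iso = record
      { π = mk↔ₛ′ (λ x → f (x ^ p)) (λ y → Inverse.from π y ^ p)
              (λ y → trans (cong f (^p^p _)) (Inverse.strictlyInverseˡ π y))
              (λ x → trans (cong (_^ p) (Inverse.strictlyInverseʳ π (x ^ p))) (^p^p x))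
      ; f-0 = trans (cong f (0^ 0<p)) f-0
      ; kernel-f = λ x y → trans (sym (G-^p (x - y))) (trans (cong G (^p-- x y)) (kernel-f (x ^ p) (y ^ p)))
      }
      where open KernelIso iso

    -- Substitute x^p for x and pull the p-th power out of the sum. Thus f^p has the degree of
    -- f(x^p), to which the results on a `KernelIso` apply again.
    moment-^p : ∀ (φ : Carrier → Carrier) a → moment a (φ ^^ p) ≡ moment a (λ x → φ (x ^ p)) ^ p
    moment-^p φ a = begin
      ΣF (λ x → φ x ^ p * x ^ a)                       ≡⟨ ΣF-perm′ (_^ p) (_^ p) ^p^p ^p^p (λ x → φ x ^ p * x ^ a) ⟩
      ΣF (λ x → φ (x ^ p) ^ p * (x ^ p) ^ a)           ≡⟨ ΣF-cong (λ x → trans (cong (φ (x ^ p) ^ p *_) (^-comm x p a)) (sym (^-*-distrib (φ (x ^ p)) (x ^ a) p))) ⟩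
      ΣF (λ x → (φ (x ^ p) * x ^ a) ^ p)               ≡⟨ frobenius-Σ 0<p frobeniusExponent-p (λ x → φ (x ^ p) * x ^ a) ⟨
      moment a (λ x → φ (x ^ p)) ^ p ∎

    degree-^p : ∀ {φ D} → Degree (λ x → φ (x ^ p)) D → Degree (φ ^^ p) D
    degree-^p {φ} deg = record
      { D≤κ = D≤κ deg
      ; above = λ a lt → trans (moment-^p φ a) (trans (cong (_^ p) (above deg a lt)) (0^ 0<p))
      ; leading = λ a eq e → ^-nonzero p (leading deg a eq) (trans (sym (moment-^p φ a)) e)
      }

    -- Both f and f(x^p) have degree at least p, so f^d f^p has degree at least d p + p. But f^(d +
    -- p) lies in the code, as the second digit 1 of d + p is at most u₁, and so its degree is at
    -- most 2m = d p + d.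
    no-iso-0<u₁ : 0 ℕ.< u₁ → ¬ KernelIso
    no-iso-0<u₁ 0<u₁ iso = contra (iso-degree iso) (iso-degree iso′)
      where
      iso′ = compose-frobenius iso
      open KernelIso iso
      open KernelIso iso′ using () renaming (f to f′)
      d≤3u₁+2 : d ℕ.≤ 2 ℕ.+ 3 ℕ.* u₁
      d≤3u₁+2 = ℕ.≤-trans (ℕ.n≤1+n d) 1+d≤3u₁+2
      InCode-f : ∀ (iso : KernelIso) k → k ℕ.≤ d → InCode (KernelIso.f iso ^^ k)
      InCode-f iso k k≤d = iso-power-InCode iso k (ℕ.≤-trans k≤d d≤3u₁+2) (inj₁ k≤d)
      contra : (∃ λ D → 0 ℕ.< D × Degree f D) → (∃ λ D → 0 ℕ.< D × Degree f′ D) → ⊥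
      contra (D , 0<D , deg) (D′ , 0<D′ , deg′) = ℕ.<⇒≱ d<p p≤d
        where
        p≤D : p ℕ.≤ D
        p≤D = ℕ.≮⇒≥ (no-iso-low-degree iso deg 0<D)
        p≤D′ : p ℕ.≤ D′
        p≤D′ = ℕ.≮⇒≥ (no-iso-low-degree iso′ deg′ 0<D′)
        deg-d : Degree (f ^^ d) (d ℕ.* D)
        deg-d = degree-^ d (λ k _ k≤d → InCode-f iso k k≤d) deg d′ ℕ.≤-refl
        dD≤2m : d ℕ.* D ℕ.≤ 2m
        dD≤2m = code-degree-≤ (InCode-f iso d ℕ.≤-refl) deg-d
        D′≤2m : D′ ℕ.≤ 2m
        D′≤2m = code-degree-≤ (InCode-f iso′ 1 (ℕ.s≤s ℕ.z≤n)) (degree-cong (λ x → sym (*-identityʳ (f′ x))) deg′)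
        deg-total : Degree ((f ^^ d) · (f ^^ p)) (d ℕ.* D ℕ.+ D′)
        deg-total = degree-* deg-d (degree-^p {f} deg′) (ℕ.≤-<-trans dD≤2m 2m<κ) (subst (d ℕ.* D ℕ.+ D′ ℕ.≤_) (sym κ≡2m+2m) (ℕ.+-mono-≤ dD≤2m D′≤2m))
        total≤2m : d ℕ.* D ℕ.+ D′ ℕ.≤ 2m
        total≤2m = code-degree-≤ (power-InCode d 1 d≤3u₁+2 0<u₁ (inj₁ ℕ.≤-refl) iso)
          (degree-cong (λ x → trans (sym (^-+ (f x) d p)) (cong (λ i → f x ^ (d ℕ.+ i)) (sym (ℕ.*-identityˡ p)))) deg-total)
        p≤d : p ℕ.≤ d
        p≤d = ℕ.+-cancelˡ-≤ (d ℕ.* p) p d (ℕ.≤-trans (ℕ.+-mono-≤ (ℕ.*-monoʳ-≤ d p≤D) p≤D′)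
          (subst (d ℕ.* D ℕ.+ D′ ℕ.≤_) (trans 2m≡ (trans (cong (λ n → d ℕ.* repunit p (suc n ℕ.* 2)) n≡0) (arith d p))) total≤2m))
          where
          arith : ∀ d p → d ℕ.* (1 ℕ.+ (1 ℕ.+ 0 ℕ.* p) ℕ.* p) ≡ d ℕ.* p ℕ.+ d
          arith = solve-∀

-- The exceptional isomorphism over the field with nine elements

module Nine (p-prime : Prime 3) (F : FiniteField (3 ℕ.^ 2)) (ω : FiniteField.Carrier F) (isPrimitive : FiniteField.IsPrimitive F ω) where

  open FieldSums F
  open Binomials F 3 2 p-prime refl
  open Convolution F 3 p-prime 0 0 1 0 refl refl refl ω isPrimitive
  open Moments F κ q≡ 1<κ 2≢0 ω isPrimitive
  open Kernels F κ q≡ 1<κ 2≢0 ω isPrimitive 0 m₂ κ≡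
  open IndexTwo F 3 p-prime 0 0 0 refl refl refl ω isPrimitive using (0<p; module QuadraticExtension)
  open QuadraticExtension refl using (^p^p)

  m≡2 : m ≡ 2
  m≡2 = cong (ℕ._* 2) m₂≡

  triple : ∀ x → x + (x + x) ≡ 0#
  triple x = trans (solve 1 (λ x → x :+ (x :+ x) := (con 1 :+ (con 1 :+ (con 1 :+ con 0))) :* x) refl x) (trans (cong (_* x) ι-p) (zeroˡ x))

  +triple : ∀ y x → y + (x + (x + x)) ≡ y
  +triple y x = trans (cong (y +_) (triple x)) (+-identityʳ y)

  2# : Carrier
  2# = 1# + 1#

  -1≡2 : - 1# ≡ 2#
  -1≡2 = sym (neg-uniqueˡ 2# 1# (trans (+-assoc 1# 1# 1#) (triple 1#)))

  ^m≡ : ∀ z → z ^ m ≡ z * z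
  ^m≡ z = trans (cong (z ^_) m≡2) (cong (z *_) (*-identityʳ z))

  ω⁴ : ω * ω * (ω * ω) ≡ 2#
  ω⁴ = begin
    ω * ω * (ω * ω)                        ≡⟨ cong₂ _*_ (cong (ω *_) (*-identityʳ ω)) (cong (ω *_) (*-identityʳ ω)) ⟨
    (ω ^ (2 ℕ.* h)) * (ω ^ (2 ℕ.* h))      ≡⟨ ^m≡ (ω ^ (2 ℕ.* h)) ⟨
    ζ (2 ℕ.* h)                            ≡⟨ ζ-2h ⟩
    - 1#                                   ≡⟨ -1≡2 ⟩
    2# ∎

  E : Carrier
  E = 1# + ω

  E≢0 : E ≢ 0#
  E≢0 e = -1≢1 (sym (begin
    1#                                      ≡⟨ trans (cong₂ _*_ -1*-1 -1*-1) (*-identityʳ 1#) ⟨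
    - 1# * - 1# * (- 1# * - 1#)             ≡⟨ cong (λ z → z * z * (z * z)) (neg-uniqueˡ ω 1# (trans (+-comm ω 1#) e)) ⟨
    ω * ω * (ω * ω)                         ≡⟨ ω⁴ ⟩
    2#                                      ≡⟨ -1≡2 ⟨
    - 1# ∎))

  -- The constants solve α + β = 1 and α + 2β = ω. As ω⁴ = 2, this makes f fix 1 and multiply ω² by
  -- ω.
  r α β : Carrier
  r = proj₁ (inverse E E≢0)
  α = 2# + 2# * ω
  β = 2# + ω

  rE : r * E ≡ 1#
  rE = trans (*-comm r E) (proj₂ (inverse E E≢0))

  -- f is the 𝔽₃-linear map with f 1 = 1 and f ω² = ω³, which carries the squares {±1, ±ω²} to {±1, ±ω³}.
  f g : Carrier → Carrier
  f x = α * x + β * x ^ 3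
  g y = r * (y + ω * y ^ 3)

  cube-+ : ∀ x y → (x + y) ^ 3 ≡ x ^ 3 + y ^ 3
  cube-+ = frobenius-additive 0<p frobeniusExponent-p

  f-+ : ∀ x y → f (x + y) ≡ f x + f y
  f-+ x y = trans (cong (λ z → α * (x + y) + β * z) (cube-+ x y))
    (solve 6 (λ a b x y X Y → a :* (x :+ y) :+ b :* (X :+ Y) := (a :* x :+ b :* X) :+ (a :* y :+ b :* Y)) refl α β x y (x ^ 3) (y ^ 3))

  f-- : ∀ x y → f (x - y) ≡ f x - f y
  f-- x y = trans (sym (+--cancel (f (x - y)) (f y))) (cong (_- f y) (trans (sym (f-+ (x - y) y)) (cong f (-+-cancel x y))))

  -- Reduction by ω⁴ = 2 and 3 = 0: X witnesses that what remains to be discarded is three times an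
  -- element.
  reduce : ∀ {x} a b X {y} → x ≡ a + b * (ω * ω * (ω * ω)) → a + b * 2# ≡ y + (X + (X + X)) → x ≡ y
  reduce a b X {y} e e′ = trans e (trans (cong (λ z → a + b * z) ω⁴) (trans e′ (+triple y X)))

  -- Together with `β+ωα³`, these are the coefficients of x and x³ in g (f x), up to the factor r.
  α+ωβ³ : α + ω * β ^ 3 ≡ E
  α+ωβ³ = reduce _ _ _
    (solve 1 (λ w → let two = con 1 :+ con 1 ; b = two :+ w in
      two :+ two :* w :+ w :* (b :* (b :* (b :* con 1))) := con 2 :+ con 10 :* w :+ con 12 :* w :* w :+ con 6 :* w :* w :* w :+ con 1 :* (w :* w :* (w :* w))) refl ω)
    (solve 1 (λ w → let X = con 1 :+ con 3 :* w :+ con 4 :* w :* w :+ con 2 :* w :* w :* w in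
      con 2 :+ con 10 :* w :+ con 12 :* w :* w :+ con 6 :* w :* w :* w :+ con 1 :* (con 1 :+ con 1) := con 1 :+ w :+ (X :+ (X :+ X))) refl ω)

  β+ωα³ : β + ω * α ^ 3 ≡ 0#
  β+ωα³ = reduce _ _ _
    (solve 1 (λ w → let two = con 1 :+ con 1 ; a = two :+ two :* w in
      two :+ w :+ w :* (a :* (a :* (a :* con 1))) := con 2 :+ con 9 :* w :+ con 24 :* w :* w :+ con 24 :* w :* w :* w :+ con 8 :* (w :* w :* (w :* w))) refl ω)
    (solve 1 (λ w → let X = con 6 :+ con 3 :* w :+ con 8 :* w :* w :+ con 8 :* w :* w :* w in
      con 2 :+ con 9 :* w :+ con 24 :* w :* w :+ con 24 :* w :* w :* w :+ con 8 :* (con 1 :+ con 1) := con 0 :+ (X :+ (X :+ X))) refl ω)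

  -- This and `2E³ω+β` are the error terms in f (g y) once r and r³ are cleared by E and E³.
  E³+βω³ : E ^ 3 + β * ω ^ 3 ≡ 0#
  E³+βω³ = reduce _ _ _
    (solve 1 (λ w → let e = con 1 :+ w in
      e :* (e :* (e :* con 1)) :+ (con 1 :+ con 1 :+ w) :* (w :* (w :* (w :* con 1))) := con 1 :+ con 3 :* w :+ con 3 :* w :* w :+ con 3 :* w :* w :* w :+ con 1 :* (w :* w :* (w :* w))) refl ω)
    (solve 1 (λ w → let X = con 1 :+ w :+ w :* w :+ w :* w :* w in
      con 1 :+ con 3 :* w :+ con 3 :* w :* w :+ con 3 :* w :* w :* w :+ con 1 :* (con 1 :+ con 1) := con 0 :+ (X :+ (X :+ X))) refl ω)

  2E³ω+β : 2# * E ^ 3 * ω + β ≡ 0#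
  2E³ω+β = reduce _ _ _
    (solve 1 (λ w → let e = con 1 :+ w in
      (con 1 :+ con 1) :* (e :* (e :* (e :* con 1))) :* w :+ (con 1 :+ con 1 :+ w) := con 2 :+ con 3 :* w :+ con 6 :* w :* w :+ con 6 :* w :* w :* w :+ con 2 :* (w :* w :* (w :* w))) refl ω)
    (solve 1 (λ w → let X = con 2 :+ w :+ con 2 :* w :* w :+ con 2 :* w :* w :* w in
      con 2 :+ con 3 :* w :+ con 6 :* w :* w :+ con 6 :* w :* w :* w :+ con 2 :* (con 1 :+ con 1) := con 0 :+ (X :+ (X :+ X))) refl ω)

  f-cube : ∀ x → f x ^ 3 ≡ α ^ 3 * x ^ 3 + β ^ 3 * x
  f-cube x = trans (cube-+ (α * x) (β * x ^ 3)) (cong₂ _+_ (^-*-distrib α x 3)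
    (trans (^-*-distrib β (x ^ 3) 3) (cong (β ^ 3 *_) (^p^p x))))

  g-f : ∀ x → g (f x) ≡ x
  g-f x = begin
    r * (f x + ω * f x ^ 3)
      ≡⟨ cong (λ z → r * (f x + ω * z)) (f-cube x) ⟩
    r * (α * x + β * x ^ 3 + ω * (α ^ 3 * x ^ 3 + β ^ 3 * x))
      ≡⟨ solve 8 (λ r a b w A B x X → r :* (a :* x :+ b :* X :+ w :* (A :* X :+ B :* x)) := r :* ((a :+ w :* B) :* x :+ (b :+ w :* A) :* X))
           refl r α β ω (α ^ 3) (β ^ 3) x (x ^ 3) ⟩
    r * ((α + ω * β ^ 3) * x + (β + ω * α ^ 3) * x ^ 3)
      ≡⟨ cong₂ (λ a b → r * (a * x + b * x ^ 3)) α+ωβ³ β+ωα³ ⟩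
    r * (E * x + 0# * x ^ 3)
      ≡⟨ solve 4 (λ r e x X → r :* (e :* x :+ con 0 :* X) := r :* e :* x) refl r E x (x ^ 3) ⟩
    r * E * x
      ≡⟨ trans (cong (_* x) rE) (*-identityˡ x) ⟩
    x ∎

  g-cube : ∀ y → g y ^ 3 ≡ r ^ 3 * (y ^ 3 + ω ^ 3 * y)
  g-cube y = trans (^-*-distrib r (y + ω * y ^ 3) 3) (cong (r ^ 3 *_) (trans (cube-+ y (ω * y ^ 3))
    (cong (y ^ 3 +_) (trans (^-*-distrib ω (y ^ 3) 3) (cong (ω ^ 3 *_) (^p^p y))))))

  f-g : ∀ y → f (g y) ≡ y
  f-g y = *-cancelˡ (E * E ^ 3) (*-nonzero E≢0 (^-nonzero 3 E≢0)) (begin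
    E * E³ * (α * (r * (y + ω * Y)) + β * g y ^ 3)
      ≡⟨ cong (λ z → E * E³ * (α * (r * (y + ω * Y)) + β * z)) (g-cube y) ⟩
    E * E³ * ((2# + 2# * ω) * (r * (y + ω * Y)) + β * (r ^ 3 * (Y + ω³ * y)))
      ≡⟨ cong (λ a → E * E³ * (a * (r * (y + ω * Y)) + β * (r ^ 3 * (Y + ω³ * y)))) (solve 2 (λ t w → t :+ t :* w := t :* (con 1 :+ w)) refl 2# ω) ⟩
    E * E³ * (2# * E * (r * (y + ω * Y)) + β * (r ^ 3 * (Y + ω³ * y)))
      ≡⟨ solve 10 (λ e e3 t r r3 y Y w b w3 →
           e :* e3 :* (t :* e :* (r :* (y :+ w :* Y)) :+ b :* (r3 :* (Y :+ w3 :* y))) :=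
           e :* e3 :* t :* (y :+ w :* Y) :* (r :* e) :+ e :* b :* (Y :+ w3 :* y) :* (r3 :* e3))
           refl E E³ 2# r (r ^ 3) y Y ω β ω³ ⟩
    E * E³ * 2# * (y + ω * Y) * (r * E) + E * β * (Y + ω³ * y) * (r ^ 3 * E³)
      ≡⟨ cong₂ (λ a b → E * E³ * 2# * (y + ω * Y) * a + E * β * (Y + ω³ * y) * b) rE
           (trans (sym (^-*-distrib r E 3)) (trans (cong (_^ 3) rE) (1^ 3))) ⟩
    E * E³ * 2# * (y + ω * Y) * 1# + E * β * (Y + ω³ * y) * 1#
      ≡⟨ solve 7 (λ e e3 y Y w b w3 → let t = con 1 :+ con 1 in
           e :* e3 :* t :* (y :+ w :* Y) :* con 1 :+ e :* b :* (Y :+ w3 :* y) :* con 1 :=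
           e :* e3 :* y :+ (e :* y :* (e3 :+ b :* w3) :+ e :* Y :* (t :* e3 :* w :+ b)))
           refl E E³ y Y ω β ω³ ⟩
    E * E³ * y + (E * y * (E³ + β * ω³) + E * Y * (2# * E³ * ω + β))
      ≡⟨ cong₂ (λ a b → E * E³ * y + (E * y * a + E * Y * b)) E³+βω³ 2E³ω+β ⟩
    E * E³ * y + (E * y * 0# + E * Y * 0#)
      ≡⟨ solve 4 (λ e e3 y Y → e :* e3 :* y :+ (e :* y :* con 0 :+ e :* Y :* con 0) := e :* e3 :* y) refl E E³ y Y ⟩
    E * E³ * y ∎)
    where
    Y E³ ω³ : Carrier
    Y = y ^ 3
    E³ = E ^ 3
    ω³ = ω ^ 3

  cube≡ : ∀ z → z ^ 3 ≡ z * z * z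
  cube≡ z = solve 1 (λ z → z :* (z :* (z :* con 1)) := z :* z :* z) refl z

  -- If z² = 1, then z³ = z and f z = (α + β) z = z; in the other coset z² = 2, hence f z = (α + 2β)
  -- z = ω z.
  member-f⁺ : ∀ {z} → Member (2 ℕ.* h) z → Member h (f z)
  member-f⁺ {z} (inj₁ e) = inj₁ (trans (cong (_^ m) fz≡z) e)
    where
    fz≡z : f z ≡ z
    fz≡z = begin
      α * z + β * z ^ 3                      ≡⟨ cong (λ c → α * z + β * c) (trans (cube≡ z) (cong (_* z) (trans (sym (^m≡ z)) e))) ⟩
      α * z + β * (1# * z)                   ≡⟨ solve 2 (λ w z → let t = con 1 :+ con 1 in (t :+ t :* w) :* z :+ (t :+ w) :* (con 1 :* z) :=
                                                   z :+ ((con 1 :+ w) :* z :+ ((con 1 :+ w) :* z :+ (con 1 :+ w) :* z))) refl ω z ⟩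
      z + (E * z + (E * z + E * z))          ≡⟨ +triple z (E * z) ⟩
      z ∎
  member-f⁺ {z} (inj₂ e) = inj₂ (trans (cong (_^ m) (trans (cong (ω ^ h *_) fz≡ωz)
      (solve 2 (λ w z → w :* con 1 :* (w :* z) := w :* (w :* con 1) :* z) refl ω z))) e)
    where
    z²≡2 : z * z ≡ 2#
    z²≡2 = begin
      z * z                                        ≡⟨ +triple (z * z) (z * z) ⟨
      z * z + (z * z + (z * z + z * z))            ≡⟨ solve 1 (λ s → s :+ (s :+ (s :+ s)) := (con 1 :+ con 1) :* ((con 1 :+ con 1) :* s)) refl (z * z) ⟩
      2# * (2# * (z * z))                          ≡⟨ cong (λ t → 2# * (t * (z * z))) ω⁴ ⟨
      2# * (ω * ω * (ω * ω) * (z * z))             ≡⟨ cong (2# *_) (solve 2 (λ w z → w :* w :* (w :* w) :* (z :* z) := (w :* (w :* con 1) :* z) :* (w :* (w :* con 1) :* z)) refl ω z) ⟩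
      2# * ((ω ^ (2 ℕ.* h) * z) * (ω ^ (2 ℕ.* h) * z)) ≡⟨ cong (2# *_) (trans (sym (^m≡ (ω ^ (2 ℕ.* h) * z))) e) ⟩
      2# * 1#                                      ≡⟨ *-identityʳ 2# ⟩
      2# ∎
    fz≡ωz : f z ≡ ω * z
    fz≡ωz = begin
      α * z + β * z ^ 3                      ≡⟨ cong (λ c → α * z + β * c) (trans (cube≡ z) (cong (_* z) z²≡2)) ⟩
      α * z + β * (2# * z)                   ≡⟨ solve 2 (λ w z → let t = con 1 :+ con 1 ; X = (t :+ w) :* z in (t :+ t :* w) :* z :+ (t :+ w) :* (t :* z) :=
                                                   w :* z :+ (X :+ (X :+ X))) refl ω z ⟩
      ω * z + (β * z + (β * z + β * z))      ≡⟨ +triple (ω * z) (β * z) ⟩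
      ω * z ∎

  -- If y² = 1, then g y = y; if (ω y)² = 1, then ω g y = y.
  member-g : ∀ {y} → Member h y → Member (2 ℕ.* h) (g y)
  member-g {y} (inj₁ e) = inj₁ (trans (cong (_^ m) gy≡y) e)
    where
    gy≡y : g y ≡ y
    gy≡y = begin
      r * (y + ω * y ^ 3)        ≡⟨ cong (λ c → r * (y + ω * c)) (trans (cube≡ y) (cong (_* y) (trans (sym (^m≡ y)) e))) ⟩
      r * (y + ω * (1# * y))     ≡⟨ solve 3 (λ r w y → r :* (y :+ w :* (con 1 :* y)) := r :* (con 1 :+ w) :* y) refl r ω y ⟩
      r * E * y                  ≡⟨ trans (cong (_* y) rE) (*-identityˡ y) ⟩
      y ∎
  member-g {y} (inj₂ e) = inj₂ (trans (cong (_^ m) (trans (solve 2 (λ w z → w :* (w :* con 1) :* z := w :* con 1 :* (w :* z)) refl ω (g y))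
      (cong (ω ^ h *_) ωgy≡y))) e)
    where
    ωgy≡y : ω * g y ≡ y
    ωgy≡y = begin
      ω * (r * (y + ω * y ^ 3))
        ≡⟨ solve 3 (λ w r y → w :* (r :* (y :+ w :* (y :* (y :* (y :* con 1))))) := r :* (w :* y :+ (w :* con 1 :* y) :* (w :* con 1 :* y) :* y)) refl ω r y ⟩
      r * (ω * y + (ω ^ h * y) * (ω ^ h * y) * y)
        ≡⟨ cong (λ c → r * (ω * y + c * y)) (trans (sym (^m≡ (ω ^ h * y))) e) ⟩
      r * (ω * y + 1# * y)
        ≡⟨ solve 3 (λ r w y → r :* (w :* y :+ con 1 :* y) := r :* (con 1 :+ w) :* y) refl r ω y ⟩
      r * E * y
        ≡⟨ trans (cong (_* y) rE) (*-identityˡ y) ⟩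
      y ∎

  member-f⁻ : ∀ {z} → Member h (f z) → Member (2 ℕ.* h) z
  member-f⁻ {z} mem = subst (Member (2 ℕ.* h)) (g-f z) (member-g mem)

  exceptional-iso : GraphIso (GPaleyAdj ω 2) (TGPaleyAdj ω 1)
  exceptional-iso = record
    { bij = mk↔ₛ′ f g f-g g-f
    ; preserves = λ u v → [ (λ s → inj₁ (forward v u s)) , (λ s → inj₂ (forward u v s)) ]′
    ; reflects = λ u v → [ (λ s → inj₁ (backward v u s)) , (λ s → inj₂ (backward u v s)) ]′
    }
    where
    forward : ∀ x y → GPaleySet ω 2 (x - y) → TGPaleySet ω 1 (f x - f y)
    forward x y s = subst (TGPaleySet ω 1) (f-- x y) (member⇒TGPaley (member-f⁺ (GPaley⇒member s)))
    backward : ∀ x y → TGPaleySet ω 1 (f x - f y) → GPaleySet ω 2 (x - y)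
    backward x y s = member⇒GPaley (member-f⁻ (subst (Member h) (sym (f-- x y)) (TGPaley⇒member s)))

-- Assembling the cases

open import Data.Nat using (_∸_; _^_; _*_; _≥_; _%_)

module _ {p : ℕ} (p-prime : Prime p) (h′ d′ u₁ n : ℕ)
  (p≡ : p ≡ suc (2 * (suc h′ * suc d′))) (1+p≡ : suc p ≡ 4 * suc u₁) (h-odd : suc h′ % 2 ≡ 1)
  (F : FiniteField (p ^ (suc n * 2))) (ω : FiniteField.Carrier F) (isPrimitive : FiniteField.IsPrimitive F ω) where

  not-isomorphic : ¬ (_≡_ {A = ℕ × ℕ × ℕ} (suc n * 2 , p , suc h′) (2 , 3 , 1)) →
    ¬ GraphIso (FiniteField.GPaleyAdj F ω (2 * suc h′)) (FiniteField.TGPaleyAdj F ω (suc h′))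
  not-isomorphic not-exceptional iso = go h′ n u₁ refl refl refl
    where
    go : ∀ a b c → h′ ≡ a → n ≡ b → u₁ ≡ c → ⊥
    go zero (suc _) _ refl refl _ = IndexTwo.no-iso-0<n F p p-prime d′ u₁ n p≡ 1+p≡ refl ω isPrimitive ℕ.z<s
      (Convolution.normalise F p p-prime h′ d′ (suc u₁) n p≡ 1+p≡ refl ω isPrimitive iso)
    go zero zero (suc _) refl refl refl = IndexTwo.QuadraticExtension.no-iso-0<u₁ F p p-prime d′ u₁ n p≡ 1+p≡ refl ω isPrimitive refl ℕ.z<s
      (Convolution.normalise F p p-prime h′ d′ (suc u₁) n p≡ 1+p≡ refl ω isPrimitive iso)
    -- Here h = 1, R = 2 and p + 1 = 4, which is the excluded triple.
    go zero zero zero refl refl refl = not-exceptional (cong (λ p → 2 , p , 1) (cong ℕ.pred 1+p≡))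
    go (suc zero) _ _ refl _ _ = contradiction h-odd λ ()
    go (suc (suc _)) _ _ refl _ _ = Convolution.no-iso-3≤h F p p-prime h′ d′ (suc u₁) n p≡ 1+p≡ refl ω isPrimitive (ℕ.s≤s (ℕ.s≤s (ℕ.s≤s ℕ.z≤n)))
      (Convolution.normalise F p p-prime h′ d′ (suc u₁) n p≡ 1+p≡ refl ω isPrimitive iso)

isomorphic : ∀ {R p h} → _≡_ {A = ℕ × ℕ × ℕ} (R , p , h) (2 , 3 , 1) → Prime p → (F : FiniteField (p ^ R)) (ω : FiniteField.Carrier F) →
  FiniteField.IsPrimitive F ω → GraphIso (FiniteField.GPaleyAdj F ω (2 * h)) (FiniteField.TGPaleyAdj F ω h)
isomorphic refl = Nine.exceptional-iso

theorem7p16 : (p R h : ℕ) → Prime p → p % 4 ≡ 3 → R ≥ 2 → 2 ∣ R → h % 2 ≡ 1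
    → (2 * h) ∣ (p ∸ 1)
    → (F : FiniteField (p ^ R)) → (ω : FiniteField.Carrier F) → FiniteField.IsPrimitive F ω
    → (¬ ((R , p , h) ≡ (2 , 3 , 1))
    → ¬ GraphIso (FiniteField.GPaleyAdj F ω (2 * h)) (FiniteField.TGPaleyAdj F ω h))
    × ((R , p , h) ≡ (2 , 3 , 1)
    → GraphIso (FiniteField.GPaleyAdj F ω (2 * h)) (FiniteField.TGPaleyAdj F ω h))
theorem7p16 zero _ _ _ ()
theorem7p16 (suc _) _ _ _ _ () (divides zero refl)
theorem7p16 (suc _) _ zero _ _ _ _ ()
theorem7p16 (suc zero) _ (suc _) _ () _ _ _ (divides zero _)
theorem7p16 (suc (suc _)) _ (suc _) _ _ _ _ _ (divides zero ())
theorem7p16 p@(suc p₁) _ h@(suc h′) p-prime p%4≡3 _ (divides (suc n) refl) h-odd (divides (suc d′) p₁≡) F ω isPrimitive =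
  -- As p = 3 + 4 (p / 4), the quotient p / 4 is the parameter u₁ = (p - 3)/4.
  not-isomorphic p-prime h′ d′ (p ℕ./ 4) n
    (cong suc (trans p₁≡ (arith h (suc d′))))
    (trans (cong suc (trans (m≡m%n+[m/n]*n p 4) (cong (ℕ._+ p ℕ./ 4 * 4) p%4≡3))) (arith′ (p ℕ./ 4)))
    h-odd F ω isPrimitive ,
  λ exceptional → isomorphic exceptional p-prime F ω isPrimitive
  where
  arith : ∀ h d → d * (2 * h) ≡ 2 * (h * d)
  arith = solve-∀
  arith′ : ∀ t → suc (3 ℕ.+ t * 4) ≡ 4 * suc t
  arith′ = solve-∀
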